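{- There is a function $\delta:\mathbb{N}\to[0,1]$ with $n\,\delta(n)\to 0$ as $n\to\infty$ such that the following holds. Suppose that $G$ is an $n$-vertex $(\varepsilon,s)$-expander with $2^{ -9}\le \varepsilon\le 1$ and $s\ge 2\log^{24} n$. Let $V\subseteq V(G)$ be a random subset chosen by including each vertex independently at random with probability $\frac13$. Then, with probability at least $1-\delta(n)$ (i.e. $1-o(1/n)$), for every non-empty $U\subseteq V(G)$ and every set $F\subseteq E(G)$ with $|F|\le \frac{|U|}{\log^{27} n}$, $$|B_{G-F}^{\log^4 n}(U,V)|>\frac{|V|}{2}.$$
   Context: Graphs are finite and simple; logarithms have base two and $\log^k n=(\log n)^k$. For a graph $G$ and $F\subseteq E(G)$, $G-F$ is $G$ with the edges of $F$ deleted. $N_G(U)$ is the set of vertices in $V(G)\setminus U$ with a neighbour in $U$. An $n$-vertex graph $G$ is an $(\varepsilon,s)$-expander if, for every $U\subseteq V(G)$ and $F\subseteq E(G)$ with $1\le|U|\le\frac23 n$ and $|F|\le s|U|$, we have $|N_{G-F}(U)|\ge \frac{\varepsilon|U|}{\log^2 n}$. A path through a vertex set $V$ is a path all of whose internal vertices lie in $V$ (its endvertices need not be in $V$). For $U,V\subseteq V(G)$ and $r\ge 0$, $B^{r}_G(U,V)$ is the set of vertices in $V$ which can be reached by a path in $G$ through $V$ of length at most $r$ starting from a vertex of $U$ (the starting vertex need not be in $V$; paths of length $0$ are allowed). -}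

module Defs where

open import Data.Bool.Base using (Bool; false; not; _∧_; T; if_then_else_)
open import Data.Bool.Properties using (T?)
open import Data.Fin.Base using (Fin; zero; suc; inject₁; fromℕ)
open import Data.Fin.Properties using (any?; _<?_)
open import Data.Fin.Subset using (Subset; inside; outside; ∣_∣; _∈_)
open import Data.Fin.Subset.Properties using (_∈?_)
open import Data.Integer.Base as ℤ using (+_)
import Data.Integer.Properties as ℤ
open import Data.List.Base using (length; filter; cartesianProduct; allFin)
open import Data.Nat.Base as ℕ using (ℕ; zero; suc)
import Data.Nat.Properties as ℕ
open import Data.Nat.Induction using (<-rec)
open import Data.Integer.Tactic.RingSolver using (solve-∀)
open import Data.Nat.Logarithm using (⌊log₂_⌋; ⌊log₂⌋-mono-≤; ⌊log₂[2^n]⌋≡n; ⌊log₂⌊n/2⌋⌋≡⌊log₂n⌋∸1)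
open import Data.Product.Base using (Σ-syntax; ∃-syntax; _×_; _,_)
open import Data.Rational.Base as ℚ using (ℚ; 0ℚ; 1ℚ; ½; mkℚ; _/_; fromℚᵘ; toℚᵘ)
import Data.Rational.Properties as ℚ
import Data.Rational.Unnormalised.Base as ℚᵘ
import Data.Rational.Unnormalised.Properties as ℚᵘ
open import Data.Rational.Solver using (module +-*-Solver)
open import Data.Sum.Base using (inj₁; inj₂)
open import Data.Vec.Base using (tabulate; []; _∷_)
open import Function.Base using (_∘_)
open import Function.Definitions using (Injective)
open import Level using (0ℓ)
open import Relation.Binary.PropositionalEquality using (_≡_; _≢_; refl; sym; trans; cong; cong₂; subst; subst₂)
open import Relation.Nullary using (does; contradiction)
open import Relation.Nullary.Decidable using (_×-dec_; ¬?)
open import Relation.Unary using (Pred)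

infix  4 _≤_ _⟶_ _⊆ᴱ_ _<#_
infixl 6 _+_ _-_ _∖_
infixl 7 _*_
infixr 8 _^_
infix  8 -_

------------------------------------------------------------------------
-- Real numbers, as Cauchy sequences of rationals. Two sequences x and y
-- represent the same real when x ≤ y and y ≤ x.

Cauchy : (ℕ → ℚ) → Set
Cauchy x = ∀ η → 0ℚ ℚ.< η →
  ∃[ N ] ∀ j k → N ℕ.≤ j → N ℕ.≤ k → ℚ.∣ x j ℚ.- x k ∣ ℚ.≤ η

record ℝ : Set where
  constructor mkℝ
  field
    seq    : ℕ → ℚ
    cauchy : Cauchy seq
open ℝ public

_≤_ : ℝ → ℝ → Set
x ≤ y = ∀ η → 0ℚ ℚ.< η → ∃[ N ] ∀ k → N ℕ.≤ k → seq x k ℚ.≤ seq y k ℚ.+ η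

private
  half-pos : ∀ {η} → 0ℚ ℚ.< η → 0ℚ ℚ.< ½ ℚ.* η
  half-pos {η} p = subst (ℚ._< ½ ℚ.* η) (ℚ.*-zeroʳ ½) (ℚ.*-monoʳ-<-pos ½ p)

  halves : ∀ η → ½ ℚ.* η ℚ.+ ½ ℚ.* η ≡ η
  halves η = trans (sym (ℚ.*-distribʳ-+ η ½ ½)) (ℚ.*-identityˡ η)

  p-p≡0 : ∀ p → p ℚ.- p ≡ 0ℚ
  p-p≡0 = ℚ.+-inverseʳ

  ∣-∣≤ : ∀ p q η → p ℚ.≤ q ℚ.+ η → q ℚ.≤ p ℚ.+ η → ℚ.∣ p ℚ.- q ∣ ℚ.≤ η
  ∣-∣≤ p q η p≤ q≤ with ℚ.∣p∣≡p∨∣p∣≡-p (p ℚ.- q)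
  ... | inj₁ e = subst₂ ℚ._≤_ (sym e)
    (solve 2 (λ q η → q :+ η :- q := η) refl q η) (ℚ.+-monoˡ-≤ (ℚ.- q) p≤)
    where open +-*-Solver
  ... | inj₂ e = subst₂ ℚ._≤_
    (trans (solve 2 (λ p q → q :- p := :- (p :- q)) refl p q) (sym e))
    (solve 2 (λ p η → p :+ η :- p := η) refl p η) (ℚ.+-monoˡ-≤ (ℚ.- p) q≤)
    where open +-*-Solver

  *-mono-≤-0≤ : ∀ {a b c d} → 0ℚ ℚ.≤ c → 0ℚ ℚ.≤ b → a ℚ.≤ b → c ℚ.≤ d →
                a ℚ.* c ℚ.≤ b ℚ.* d
  *-mono-≤-0≤ {a} {b} {c} {d} 0≤c 0≤b a≤b c≤d = ℚ.≤-trans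
    (ℚ.*-monoʳ-≤-nonNeg c {{ℚ.nonNegative 0≤c}} a≤b)
    (ℚ.*-monoˡ-≤-nonNeg b {{ℚ.nonNegative 0≤b}} c≤d)

  0<1 : 0ℚ ℚ.< 1ℚ
  0<1 = ℚ.positive⁻¹ 1ℚ

  bounded : ∀ x → Cauchy x →
    Σ[ B ∈ ℚ ] 0ℚ ℚ.< B × (∃[ N ] ∀ k → N ℕ.≤ k → ℚ.∣ x k ∣ ℚ.≤ B)
  bounded x c with c 1ℚ 0<1
  ... | N , h = ℚ.∣ x N ∣ ℚ.+ 1ℚ , ℚ.+-mono-≤-< (ℚ.0≤∣p∣ (x N)) 0<1 , N , λ k N≤k →
    ℚ.≤-trans (ℚ.≤-reflexive (cong ℚ.∣_∣
        (solve 2 (λ a b → a := b :+ (a :- b)) refl (x k) (x N))))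
      (ℚ.≤-trans (ℚ.∣p+q∣≤∣p∣+∣q∣ (x N) (x k ℚ.- x N))
        (ℚ.+-monoʳ-≤ ℚ.∣ x N ∣ (h k N N≤k ℕ.≤-refl)))
    where open +-*-Solver

  share : ∀ B η → 0ℚ ℚ.< B → 0ℚ ℚ.< η →
    Σ[ θ ∈ ℚ ] 0ℚ ℚ.< θ × B ℚ.* θ ≡ ½ ℚ.* η
  share B η 0<B 0<η = 1/B ℚ.* (½ ℚ.* η) ,
    subst (ℚ._< 1/B ℚ.* (½ ℚ.* η)) (ℚ.*-zeroʳ 1/B)
      (ℚ.*-monoʳ-<-pos 1/B {{ℚ.1/pos⇒pos B}} (half-pos 0<η)) ,
    trans (sym (ℚ.*-assoc B 1/B _))
      (trans (cong (ℚ._* (½ ℚ.* η)) (ℚ.*-inverseʳ B)) (ℚ.*-identityˡ _))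
    where
    instance
      B-pos : ℚ.Positive B
      B-pos = ℚ.positive 0<B
      B≢0 : ℚ.NonZero B
      B≢0 = ℚ.pos⇒nonZero B
    1/B : ℚ
    1/B = ℚ.1/ B

fromℚ : ℚ → ℝ
fromℚ q = mkℝ (λ _ → q) λ η 0<η → 0 , λ _ _ _ _ →
  subst (λ z → ℚ.∣ z ∣ ℚ.≤ η) (sym (p-p≡0 q)) (ℚ.<⇒≤ 0<η)

fromℕʳ : ℕ → ℝ
fromℕʳ k = fromℚ (+ k / 1)

_+_ : ℝ → ℝ → ℝ
(mkℝ x cx) + (mkℝ y cy) = mkℝ (λ k → x k ℚ.+ y k) λ η 0<η →
  let Nx , hx = cx (½ ℚ.* η) (half-pos 0<η)
      Ny , hy = cy (½ ℚ.* η) (half-pos 0<η)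
  in Nx ℕ.⊔ Ny , λ j k N≤j N≤k → begin
    ℚ.∣ (x j ℚ.+ y j) ℚ.- (x k ℚ.+ y k) ∣
      ≡⟨ cong ℚ.∣_∣ (solve 4 (λ a b c d → (a :+ b) :- (c :+ d) := (a :- c) :+ (b :- d))
           refl (x j) (y j) (x k) (y k)) ⟩
    ℚ.∣ (x j ℚ.- x k) ℚ.+ (y j ℚ.- y k) ∣
      ≤⟨ ℚ.∣p+q∣≤∣p∣+∣q∣ (x j ℚ.- x k) (y j ℚ.- y k) ⟩
    ℚ.∣ x j ℚ.- x k ∣ ℚ.+ ℚ.∣ y j ℚ.- y k ∣
      ≤⟨ ℚ.+-mono-≤ (hx j k (ℕ.m⊔n≤o⇒m≤o Nx Ny N≤j) (ℕ.m⊔n≤o⇒m≤o Nx Ny N≤k))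
                    (hy j k (ℕ.m⊔n≤o⇒n≤o Nx Ny N≤j) (ℕ.m⊔n≤o⇒n≤o Nx Ny N≤k)) ⟩
    ½ ℚ.* η ℚ.+ ½ ℚ.* η
      ≡⟨ halves η ⟩
    η ∎
  where
  open ℚ.≤-Reasoning
  open +-*-Solver

-_ : ℝ → ℝ
- (mkℝ x cx) = mkℝ (λ k → ℚ.- x k) λ η 0<η →
  let N , h = cx η 0<η
  in N , λ j k N≤j N≤k → subst (ℚ._≤ η)
    (cong ℚ.∣_∣ (solve 2 (λ a b → b :- a := (:- a) :- (:- b)) refl (x j) (x k)))
    (h k j N≤k N≤j)
  where open +-*-Solver

_-_ : ℝ → ℝ → ℝ
x - y = x + (- y)

_*_ : ℝ → ℝ → ℝ
(mkℝ x cx) * (mkℝ y cy) = mkℝ (λ k → x k ℚ.* y k) λ η 0<η →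
  let Bx , 0<Bx , Mx , bx = bounded x cx
      By , 0<By , My , by = bounded y cy
      θy , 0<θy , ey = share Bx η 0<Bx 0<η
      θx , 0<θx , ex = share By η 0<By 0<η
      Nx , hx = cx θx 0<θx
      Ny , hy = cy θy 0<θy
      M = Mx ℕ.⊔ My
      N = Nx ℕ.⊔ Ny
  in M ℕ.⊔ N , λ j k ≤j ≤k →
    let M≤j = ℕ.m⊔n≤o⇒m≤o M N ≤j
        M≤k = ℕ.m⊔n≤o⇒m≤o M N ≤k
        N≤j = ℕ.m⊔n≤o⇒n≤o M N ≤j
        N≤k = ℕ.m⊔n≤o⇒n≤o M N ≤k
    in begin
    ℚ.∣ x j ℚ.* y j ℚ.- x k ℚ.* y k ∣
      ≡⟨ cong ℚ.∣_∣ (solve 4 (λ a b c d → a :* b :- c :* d := a :* (b :- d) :+ d :* (a :- c))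
           refl (x j) (y j) (x k) (y k)) ⟩
    ℚ.∣ x j ℚ.* (y j ℚ.- y k) ℚ.+ y k ℚ.* (x j ℚ.- x k) ∣
      ≤⟨ ℚ.∣p+q∣≤∣p∣+∣q∣ (x j ℚ.* (y j ℚ.- y k)) (y k ℚ.* (x j ℚ.- x k)) ⟩
    ℚ.∣ x j ℚ.* (y j ℚ.- y k) ∣ ℚ.+ ℚ.∣ y k ℚ.* (x j ℚ.- x k) ∣
      ≡⟨ cong₂ ℚ._+_ (ℚ.∣p*q∣≡∣p∣*∣q∣ (x j) (y j ℚ.- y k))
                     (ℚ.∣p*q∣≡∣p∣*∣q∣ (y k) (x j ℚ.- x k)) ⟩
    ℚ.∣ x j ∣ ℚ.* ℚ.∣ y j ℚ.- y k ∣ ℚ.+ ℚ.∣ y k ∣ ℚ.* ℚ.∣ x j ℚ.- x k ∣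
      ≤⟨ ℚ.+-mono-≤
           (*-mono-≤-0≤ (ℚ.0≤∣p∣ (y j ℚ.- y k)) (ℚ.<⇒≤ 0<Bx)
             (bx j (ℕ.m⊔n≤o⇒m≤o Mx My M≤j))
             (hy j k (ℕ.m⊔n≤o⇒n≤o Nx Ny N≤j) (ℕ.m⊔n≤o⇒n≤o Nx Ny N≤k)))
           (*-mono-≤-0≤ (ℚ.0≤∣p∣ (x j ℚ.- x k)) (ℚ.<⇒≤ 0<By)
             (by k (ℕ.m⊔n≤o⇒n≤o Mx My M≤k))
             (hx j k (ℕ.m⊔n≤o⇒m≤o Nx Ny N≤j) (ℕ.m⊔n≤o⇒m≤o Nx Ny N≤k))) ⟩
    Bx ℚ.* θy ℚ.+ By ℚ.* θx
      ≡⟨ cong₂ ℚ._+_ ey ex ⟩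
    ½ ℚ.* η ℚ.+ ½ ℚ.* η
      ≡⟨ halves η ⟩
    η ∎
  where
  open ℚ.≤-Reasoning
  open +-*-Solver

_^_ : ℝ → ℕ → ℝ
x ^ zero  = fromℕʳ 1
x ^ suc k = x * x ^ k

_⟶_ : (ℕ → ℝ) → ℝ → Set
a ⟶ l = ∀ η → 0ℚ ℚ.< η → ∃[ N ] ∀ n → N ℕ.≤ n →
  (l - fromℚ η ≤ a n) × (a n ≤ l + fromℚ η)

------------------------------------------------------------------------
-- The binary logarithm. For n ≥ 1 and k ≥ 1, a = ⌊log₂ (n ^ k)⌋ satisfies
-- 2 ^ a ≤ n ^ k < 2 ^ (1 + a), i.e. a / k ≤ log₂ n < a / k + 1 / k, so the
-- rationals a / k converge to log₂ n. (For n = 0 the value is 0.)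

n<2^[1+⌊log₂n⌋] : ∀ n → n ℕ.< 2 ℕ.^ suc ⌊log₂ n ⌋
n<2^[1+⌊log₂n⌋] n = ℕ.≰⇒> λ le → ℕ.1+n≰n
  (subst (ℕ._≤ ⌊log₂ n ⌋) (⌊log₂[2^n]⌋≡n (suc ⌊log₂ n ⌋)) (⌊log₂⌋-mono-≤ le))

2^⌊log₂n⌋≤n : ∀ n → .{{ℕ.NonZero n}} → 2 ℕ.^ ⌊log₂ n ⌋ ℕ.≤ n
2^⌊log₂n⌋≤n = <-rec (λ n → .{{ℕ.NonZero n}} → 2 ℕ.^ ⌊log₂ n ⌋ ℕ.≤ n) step
  where
  step : ∀ n → (∀ {m} → m ℕ.< n → .{{ℕ.NonZero m}} → 2 ℕ.^ ⌊log₂ m ⌋ ℕ.≤ m) →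
         .{{ℕ.NonZero n}} → 2 ℕ.^ ⌊log₂ n ⌋ ℕ.≤ n
  step 1 _ = ℕ.≤-refl
  step n@(suc (suc m)) rec = begin
    2 ℕ.^ ⌊log₂ n ⌋               ≤⟨ ℕ.^-monoʳ-≤ 2 (ℕ.m≤n+m∸n ⌊log₂ n ⌋ 1) ⟩
    2 ℕ.* 2 ℕ.^ (⌊log₂ n ⌋ ℕ.∸ 1) ≡⟨ cong (λ e → 2 ℕ.* 2 ℕ.^ e) (⌊log₂⌊n/2⌋⌋≡⌊log₂n⌋∸1 n) ⟨
    2 ℕ.* 2 ℕ.^ ⌊log₂ ℕ.⌊ n /2⌋ ⌋ ≤⟨ ℕ.*-monoʳ-≤ 2 (rec (ℕ.⌊n/2⌋<n (suc m))) ⟩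
    2 ℕ.* ℕ.⌊ n /2⌋               ≡⟨ cong (ℕ.⌊ n /2⌋ ℕ.+_) (ℕ.+-identityʳ ℕ.⌊ n /2⌋) ⟩
    ℕ.⌊ n /2⌋ ℕ.+ ℕ.⌊ n /2⌋       ≤⟨ ℕ.+-monoʳ-≤ ℕ.⌊ n /2⌋ (ℕ.⌊n/2⌋≤⌈n/2⌉ n) ⟩
    ℕ.⌊ n /2⌋ ℕ.+ ℕ.⌈ n /2⌉       ≡⟨ ℕ.⌊n/2⌋+⌈n/2⌉≡n n ⟩
    n ∎
    where open ℕ.≤-Reasoning

log-seq : ℕ → ℕ → ℚ
log-seq n k = + ⌊log₂ (n ℕ.^ suc k) ⌋ / suc k

private
  cross : ∀ n j k → ⌊log₂ (n ℕ.^ suc j) ⌋ ℕ.* suc k ℕ.≤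
                    suc ⌊log₂ (n ℕ.^ suc k) ⌋ ℕ.* suc j
  cross zero      j k = ℕ.z≤n
  cross n@(suc _) j k = ℕ.≮⇒≥ λ lt →
    ℕ.<⇒≱ 2^aK<2^b′j′ (ℕ.^-monoʳ-≤ 2 (ℕ.<⇒≤ lt))
    where
    a b′ j′ k′ : ℕ
    j′  = suc j
    k′  = suc k
    a  = ⌊log₂ (n ℕ.^ j′) ⌋
    b′ = suc ⌊log₂ (n ℕ.^ k′) ⌋
    2^aK<2^b′j′ : 2 ℕ.^ (a ℕ.* k′) ℕ.< 2 ℕ.^ (b′ ℕ.* j′)
    2^aK<2^b′j′ = begin-strict
      2 ℕ.^ (a ℕ.* k′)  ≡⟨ ℕ.^-*-assoc 2 a k′ ⟨
      (2 ℕ.^ a) ℕ.^ k′  ≤⟨ ℕ.^-monoˡ-≤ k′ (2^⌊log₂n⌋≤n (n ℕ.^ j′) {{ℕ.m^n≢0 n j′}}) ⟩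
      (n ℕ.^ j′) ℕ.^ k′  ≡⟨ ℕ.^-*-assoc n j′ k′ ⟩
      n ℕ.^ (j′ ℕ.* k′)  ≡⟨ cong (n ℕ.^_) (ℕ.*-comm j′ k′) ⟩
      n ℕ.^ (k′ ℕ.* j′)  ≡⟨ ℕ.^-*-assoc n k′ j′ ⟨
      (n ℕ.^ k′) ℕ.^ j′  <⟨ ℕ.^-monoˡ-< j′ (n<2^[1+⌊log₂n⌋] (n ℕ.^ k′)) ⟩
      (2 ℕ.^ b′) ℕ.^ j′ ≡⟨ ℕ.^-*-assoc 2 b′ j′ ⟩
      2 ℕ.^ (b′ ℕ.* j′) ∎
      where open ℕ.≤-Reasoning

  fromℚᵘ-mono-≤ : ∀ {p q} → p ℚᵘ.≤ q → fromℚᵘ p ℚ.≤ fromℚᵘ q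
  fromℚᵘ-mono-≤ {p} {q} p≤q = ℚ.toℚᵘ-cancel-≤ (begin
    toℚᵘ (fromℚᵘ p) ≃⟨ ℚ.toℚᵘ-fromℚᵘ p ⟩
    p               ≤⟨ p≤q ⟩
    q               ≃⟨ ℚ.toℚᵘ-fromℚᵘ q ⟨
    toℚᵘ (fromℚᵘ q) ∎)
    where open ℚᵘ.≤-Reasoning

  fraction-≤ : ∀ a b j k → a ℕ.* suc k ℕ.≤ b ℕ.* suc j → + a / suc j ℚ.≤ + b / suc k
  fraction-≤ a b j k le = fromℚᵘ-mono-≤ {ℚᵘ.mkℚᵘ (+ a) j} {ℚᵘ.mkℚᵘ (+ b) k}
    (ℚᵘ.*≤* (subst₂ ℤ._≤_ (ℤ.pos-* a (suc k)) (ℤ.pos-* b (suc j)) (ℤ.+≤+ le)))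

  fraction-suc : ∀ b k → + suc b / suc k ≡ + b / suc k ℚ.+ + 1 / suc k
  fraction-suc b k = ℚ.toℚᵘ-injective (begin-equality
    toℚᵘ (+ suc b / suc k)
      ≃⟨ ℚ.toℚᵘ-fromℚᵘ (ℚᵘ.mkℚᵘ (+ suc b) k) ⟩
    ℚᵘ.mkℚᵘ (+ suc b) k
      ≃⟨ ℚᵘ.*≡* (trans (cong (+ suc b ℤ.*_) (ℤ.pos-* (suc k) (suc k))) (ring (+ b) (+ suc k))) ⟩
    ℚᵘ.mkℚᵘ (+ b) k ℚᵘ.+ ℚᵘ.mkℚᵘ (+ 1) k
      ≃⟨ ℚᵘ.+-cong (ℚ.toℚᵘ-fromℚᵘ (ℚᵘ.mkℚᵘ (+ b) k)) (ℚ.toℚᵘ-fromℚᵘ (ℚᵘ.mkℚᵘ (+ 1) k)) ⟨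
    toℚᵘ (+ b / suc k) ℚᵘ.+ toℚᵘ (+ 1 / suc k)
      ≃⟨ ℚ.toℚᵘ-homo-+ (+ b / suc k) (+ 1 / suc k) ⟨
    toℚᵘ (+ b / suc k ℚ.+ + 1 / suc k) ∎)
    where
    open ℚᵘ.≤-Reasoning
    ring : ∀ b k → (+ 1 ℤ.+ b) ℤ.* (k ℤ.* k) ≡ (b ℤ.* k ℤ.+ + 1 ℤ.* k) ℤ.* k
    ring = solve-∀

  1/k≤η : ∀ η → 0ℚ ℚ.< η → ∃[ N ] ∀ k → N ℕ.≤ k → + 1 / suc k ℚ.≤ η
  1/k≤η η@(mkℚ (+ zero)    d _) 0<η = contradiction 0<η λ where (ℚ.*<* (ℤ.+<+ ()))
  1/k≤η η@(mkℚ (+ (suc p)) d _) 0<η = d , λ k d≤k →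
    subst (+ 1 / suc k ℚ.≤_) (ℚ.↥p/↧p≡p η)
      (fraction-≤ 1 (suc p) k d (ℕ.≤-trans (ℕ.≤-reflexive (ℕ.*-identityˡ (suc d)))
        (ℕ.≤-trans (ℕ.s≤s d≤k) (ℕ.m≤n*m (suc k) (suc p)))))
  1/k≤η η@(mkℚ (ℤ.-[1+ _ ]) d _) 0<η = contradiction 0<η λ where (ℚ.*<* ())

log₂ : ℕ → ℝ
log₂ n = mkℝ (log-seq n) λ η 0<η →
  let N , small = 1/k≤η η 0<η
      close = λ j k N≤k → begin
        log-seq n j
          ≤⟨ fraction-≤ ⌊log₂ (n ℕ.^ suc j) ⌋ (suc ⌊log₂ (n ℕ.^ suc k) ⌋) j k (cross n j k) ⟩
        + suc ⌊log₂ (n ℕ.^ suc k) ⌋ / suc k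
          ≡⟨ fraction-suc ⌊log₂ (n ℕ.^ suc k) ⌋ k ⟩
        log-seq n k ℚ.+ + 1 / suc k
          ≤⟨ ℚ.+-monoʳ-≤ (log-seq n k) (small k N≤k) ⟩
        log-seq n k ℚ.+ η ∎
  in N , λ j k N≤j N≤k →
    ∣-∣≤ (log-seq n j) (log-seq n k) η (close j k N≤k) (close k j N≤j)
  where open ℚ.≤-Reasoning

------------------------------------------------------------------------
-- Graphs with vertex set Fin n

record Graph (n : ℕ) : Set where
  field
    adj        : Fin n → Fin n → Bool
    adj-sym    : ∀ u v → adj u v ≡ adj v u
    adj-irrefl : ∀ v → adj v v ≡ false
open Graph public using (adj)

Adj : ∀ {n} → Graph n → Fin n → Fin n → Set
Adj G u v = T (adj G u v)

-- A set F of edges of G is represented by the spanning subgraph of G whose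
-- edges are those of F.
_⊆ᴱ_ : ∀ {n} → Graph n → Graph n → Set
F ⊆ᴱ G = ∀ u v → Adj F u v → Adj G u v

∣_∣ᴱ : ∀ {n} → Graph n → ℕ
∣_∣ᴱ {n} F = length (filter (λ (u , v) → (u <? v) ×-dec T? (adj F u v))
                            (cartesianProduct (allFin n) (allFin n)))

_∖_ : ∀ {n} → Graph n → Graph n → Graph n
G ∖ F = record
  { adj        = λ u v → adj G u v ∧ not (adj F u v)
  ; adj-sym    = λ u v → cong₂ (λ g f → g ∧ not f) (Graph.adj-sym G u v) (Graph.adj-sym F u v)
  ; adj-irrefl = λ v → cong (_∧ not (adj F v v)) (Graph.adj-irrefl G v)
  }

Nbr : ∀ {n} → Graph n → Subset n → Subset n
Nbr G U = tabulate λ v → does (¬? (v ∈? U) ×-dec any? λ u → (u ∈? U) ×-dec T? (adj G u v))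

-- The bound ∣ Nbr U ∣ ≥ ε ∣ U ∣ / log² n is multiplied out; the conditions on
-- ∣ U ∣ cannot be met unless n ≥ 2, so the denominator is positive.
Expander : ∀ {n} → ℝ → ℝ → Graph n → Set
Expander {n} ε s G = ∀ (U : Subset n) (F : Graph n) → F ⊆ᴱ G →
  1 ℕ.≤ ∣ U ∣ → 3 ℕ.* ∣ U ∣ ℕ.≤ 2 ℕ.* n →
  fromℕʳ ∣ F ∣ᴱ ≤ s * fromℕʳ ∣ U ∣ →
  ε * fromℕʳ ∣ U ∣ ≤ fromℕʳ ∣ Nbr (G ∖ F) U ∣ * log₂ n ^ 2

-- Only the internal vertices of the path are required to lie in V.
record PathThrough {n} (G : Graph n) (V : Subset n) (u v : Fin n) (ℓ : ℕ) : Set where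
  field
    vertex   : Fin (suc ℓ) → Fin n
    start    : vertex zero ≡ u
    end      : vertex (fromℕ ℓ) ≡ v
    edges    : ∀ i → Adj G (vertex (inject₁ i)) (vertex (suc i))
    distinct : Injective _≡_ _≡_ vertex
    internal : ∀ i → i ≢ zero → i ≢ fromℕ ℓ → vertex i ∈ V

Ball : ∀ {n} → Graph n → ℝ → Subset n → Subset n → Pred (Fin n) 0ℓ
Ball G r U V v = v ∈ V × ∃[ u ] u ∈ U × ∃[ ℓ ] fromℕʳ ℓ ≤ r × PathThrough G V u v ℓ

-- The set P has more than q elements. As membership in P need not be
-- decidable (the order on ℝ is not), the elements are exhibited as a Subset.
_<#_ : ∀ {n} → ℚ → Pred (Fin n) 0ℓ → Set
_<#_ {n} q P = Σ[ W ∈ Subset n ] (∀ v → v ∈ W → P v) × q ℚ.< + ∣ W ∣ / 1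

------------------------------------------------------------------------
-- Random subsets of Fin n

-- The probability that E holds for a subset to which each element belongs
-- independently with probability p, by conditioning on the element zero.
ℙ : ∀ {n} → ℚ → (Subset n → Bool) → ℚ
ℙ {zero}  p E = if E [] then 1ℚ else 0ℚ
ℙ {suc n} p E = p ℚ.* ℙ p (E ∘ (inside ∷_)) ℚ.+ (1ℚ ℚ.- p) ℚ.* ℙ p (E ∘ (outside ∷_))

-- The event E has probability at least r. For an E that need not be
-- decidable this asks for a decidable event contained in E; classically
-- E itself is one.
ProbAtLeast : ∀ {n} → ℚ → ℝ → Pred (Subset n) 0ℓ → Set
ProbAtLeast {n} p r E = Σ[ E′ ∈ (Subset n → Bool) ]
  (∀ V → T (E′ V) → E V) × r ≤ fromℚ (ℙ p E′)

module Submission where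

-- A set A of reached vertices is a small certificate for the ball when
-- K ∣ A ∣ ≤ 2 ∣ Γ A ∣, where Γ A is the set of all vertices with a neighbour in A
-- and K is about log³ n. Fix sets P, D, Q and put B = Γ P ─ D. If few vertices
-- outside B are adjacent to Q, then a proportion of order 1/log² n of the
-- vertices of B are "wide", having K neighbours outside B ∪ Γ Q: otherwise
-- remove the wide vertices from B, delete the few remaining edges that leave
-- B ∪ Γ Q, and contradict the expansion. Hence V misses all wide vertices with
-- probability exponentially small in ∣ B ∣ / log² n. As long as
-- ∣ P ∣ + ∣ D ∣ + ∣ Q ∣ ≤ 6 ∣ B ∣ / K, this survives a union bound over P, D, Q; so
-- does the event that a set B with 3 ∣ B ∣ > 2 n contains at most half of V.
--
-- Off these events, let B be the neighbourhood of a certificate A in G ∖ F,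
-- that is Γ A ─ D with ∣ D ∣ ≤ 2 ∣ F ∣. Adding wide vertices in V ∩ B to A one at a
-- time enlarges the neighbourhood by a factor 1 + c/log² n and keeps A a small
-- certificate, at the price of one more step of the paths. After O(log³ n)
-- rounds the neighbourhood exceeds 2n/3, and most of V lies in it.

open import Data.Bool.Base using (Bool; true; false; not; _∧_; _∨_; T; if_then_else_)
open import Data.Bool.Properties using (T-∧; T-∨; T?; T-≡; ∨-comm)
open import Data.Fin.Base using (Fin; zero; suc; inject₁; fromℕ; opposite)
open import Data.Fin.Properties as Fin using (any?)
open import Data.Fin.Subset
  using (Subset; inside; outside; _∈_; _∉_; _⊆_; ⁅_⁆; ⊥; ⊤; ∁; _∩_; _∪_; _─_; Nonempty; ∣_∣)
open import Data.Fin.Subset.Properties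
open import Data.List.Base as List using (length; filter; cartesianProduct; _++_)
open import Data.List.Properties as List using (filter-++; length-++)
open import Data.Nat.Base as ℕ using (ℕ; zero; suc)
import Data.Nat.DivMod as ℕ
open import Data.Nat.Logarithm using (⌊log₂_⌋; ⌊log₂⌋-mono-≤; ⌊log₂[2^n]⌋≡n)
import Data.Nat.Properties as ℕ
open import Data.Nat.Tactic.RingSolver using (solve-∀)
open import Data.Product.Base using (Σ-syntax; ∃-syntax; _×_; _,_; proj₁; proj₂)
open import Data.Sum.Base using (_⊎_; inj₁; inj₂; [_,_]′)
open import Data.Unit.Base using (tt)
open import Data.Vec.Base using ([]; _∷_; here; there; lookup; tabulate)
open import Data.Vec.Properties using (lookup∘tabulate; tabulate∘lookup; lookup⇒[]=; []=⇒lookup)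
open import Function.Base using (_∘_; id)
open import Function.Bundles using (Equivalence)
open import Function.Definitions using (Injective)
open import Level using (0ℓ)
open import Relation.Binary.Definitions using (tri<; tri≈; tri>)
open import Relation.Binary.PropositionalEquality
  using (_≡_; _≢_; refl; sym; trans; cong; cong₂; subst; subst₂; module ≡-Reasoning)
open import Relation.Nullary using (Dec; does; yes; no; contradiction; ¬_)
open import Relation.Nullary.Decidable using (_×-dec_; _⊎-dec_; ¬?)
open import Relation.Unary using (Pred; Decidable)

-- One V must serve every U, every F and every round, so no fresh randomness is available later on,
-- and there are too many pairs U, F for a union bound over them. It becomes affordable because
-- wideness is measured in G: U and F enter a round only through B, and B is fixed by the two sets A
-- and D. Together with Q these have total size m = O(∣ B ∣ / K), and there are at most (3n)^m such
-- triples. A failure at a B with at most 2n/3 vertices has probability at most (2/3)^(∣ B ∣ / M),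
-- where M is of order log² n, so K must exceed M by a factor of order log n; this is the choice K =
-- 60 M l with l = 1 + ⌊log₂ n⌋. What F takes away is deducted only after each round, and at least
-- half of the gain remains. A round therefore gains a factor 1 + 1/(2M), 2M rounds double the
-- neighbourhood, and l doublings would exceed n. The resulting length 2Ml + 1 is about 8192 log³ n,
-- which is below log⁴ n once log n is large; for smaller n, δ(n) = 1 makes the claim trivial.
-- Probabilities are kept in ℕ: sums over V have total weight 3ⁿ and all bounds are cleared of
-- denominators.

-- Cardinalities of finite sets.

module Sets where

  open import Data.Nat.Base using (_+_; _*_; _≤_; z≤n; s≤s; s≤s⁻¹)
  open import Data.Nat.DivMod using (_%_; m≡m%n+[m/n]*n; m%n<n; m/n*n≤m; m*n/n≡m; /-monoˡ-≤)
  open import Data.Nat.Properties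
  private variable n : ℕ

  ∈-tabulate⁺ : ∀ (f : Fin n → Bool) {v} → T (f v) → v ∈ tabulate f
  ∈-tabulate⁺ f {v} t = lookup⇒[]= v (tabulate f)
    (trans (lookup∘tabulate f v) (Equivalence.to T-≡ t))

  ∈-tabulate⁻ : ∀ (f : Fin n → Bool) {v} → v ∈ tabulate f → T (f v)
  ∈-tabulate⁻ f {v} v∈ = Equivalence.from T-≡
    (trans (sym (lookup∘tabulate f v)) ([]=⇒lookup v∈))

  ∈⇒T-lookup : ∀ {p : Subset n} {v} → v ∈ p → T (lookup p v)
  ∈⇒T-lookup v∈p = Equivalence.from T-≡ ([]=⇒lookup v∈p)

  T-lookup⇒∈ : ∀ {p : Subset n} {v} → T (lookup p v) → v ∈ p
  T-lookup⇒∈ {p = p} {v} t = lookup⇒[]= v p (Equivalence.to T-≡ t)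

  x∈p─q⇒x∉q : ∀ (p q : Subset n) {x} → x ∈ p ─ q → x ∉ q
  x∈p─q⇒x∉q (_ ∷ p) (outside ∷ q) (there x∈) (there x∈q) = x∈p─q⇒x∉q p q x∈ x∈q
  x∈p─q⇒x∉q (_ ∷ p) (inside ∷ q)  (there x∈) (there x∈q) = x∈p─q⇒x∉q p q x∈ x∈q

  ∣p∪q∣≤∣p∣+∣q∣ : ∀ (p q : Subset n) → ∣ p ∪ q ∣ ≤ ∣ p ∣ + ∣ q ∣
  ∣p∪q∣≤∣p∣+∣q∣ []            []            = z≤n
  ∣p∪q∣≤∣p∣+∣q∣ (outside ∷ p) (outside ∷ q) = ∣p∪q∣≤∣p∣+∣q∣ p q
  ∣p∪q∣≤∣p∣+∣q∣ (outside ∷ p) (inside ∷ q)  =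
    subst (suc ∣ p ∪ q ∣ ≤_) (sym (+-suc ∣ p ∣ ∣ q ∣)) (s≤s (∣p∪q∣≤∣p∣+∣q∣ p q))
  ∣p∪q∣≤∣p∣+∣q∣ (inside ∷ p)  (outside ∷ q) = s≤s (∣p∪q∣≤∣p∣+∣q∣ p q)
  ∣p∪q∣≤∣p∣+∣q∣ (inside ∷ p)  (inside ∷ q)  =
    s≤s (≤-trans (∣p∪q∣≤∣p∣+∣q∣ p q) (+-monoʳ-≤ ∣ p ∣ (n≤1+n ∣ q ∣)))

  ∣p∣+∣q─p∣≤∣p∪q∣ : ∀ (p q : Subset n) → ∣ p ∣ + ∣ q ─ p ∣ ≤ ∣ p ∪ q ∣
  ∣p∣+∣q─p∣≤∣p∪q∣ []            []            = z≤n
  ∣p∣+∣q─p∣≤∣p∪q∣ (outside ∷ p) (outside ∷ q) = ∣p∣+∣q─p∣≤∣p∪q∣ p q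
  ∣p∣+∣q─p∣≤∣p∪q∣ (outside ∷ p) (inside ∷ q)  =
    subst (_≤ suc ∣ p ∪ q ∣) (sym (+-suc ∣ p ∣ ∣ q ─ p ∣)) (s≤s (∣p∣+∣q─p∣≤∣p∪q∣ p q))
  ∣p∣+∣q─p∣≤∣p∪q∣ (inside ∷ p)  (outside ∷ q) = s≤s (∣p∣+∣q─p∣≤∣p∪q∣ p q)
  ∣p∣+∣q─p∣≤∣p∪q∣ (inside ∷ p)  (inside ∷ q)  = s≤s (∣p∣+∣q─p∣≤∣p∪q∣ p q)

  ∣p∣≤∣p─q∣+∣q∣ : ∀ (p q : Subset n) → ∣ p ∣ ≤ ∣ p ─ q ∣ + ∣ q ∣
  ∣p∣≤∣p─q∣+∣q∣ p q = ≤-trans (p⊆q⇒∣p∣≤∣q∣ cover) (∣p∪q∣≤∣p∣+∣q∣ (p ─ q) q)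
    where
    cover : p ⊆ (p ─ q) ∪ q
    cover {x} x∈p with x ∈? q
    ... | yes x∈q = x∈p∪q⁺ (inj₂ x∈q)
    ... | no  x∉q = x∈p∪q⁺ (inj₁ (x∈p∧x∉q⇒x∈p─q x∈p x∉q))

  1≤∣p∣ : ∀ {p : Subset n} {x} → x ∈ p → 1 ≤ ∣ p ∣
  1≤∣p∣ {x = x} x∈p = subst (_≤ _) (∣⁅x⁆∣≡1 x)
    (p⊆q⇒∣p∣≤∣q∣ λ y∈ → subst (_∈ _) (sym (x∈⁅y⁆⇒x≡y x y∈)) x∈p)

  nonempty : ∀ {p : Subset n} → 1 ≤ ∣ p ∣ → Nonempty p
  nonempty {n} {p} 1≤ with nonempty? p
  ... | yes ne = ne
  ... | no  e  = contradiction (subst (1 ≤_) (trans (cong ∣_∣ (Empty-unique e)) (∣⊥∣≡0 n)) 1≤) λ ()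

  subset-of-size : ∀ (p : Subset n) k → k ≤ ∣ p ∣ → Σ[ q ∈ Subset n ] q ⊆ p × ∣ q ∣ ≡ k
  subset-of-size []            zero    _  = [] , id , refl
  subset-of-size (outside ∷ p) k       k≤ with subset-of-size p k k≤
  ... | q , q⊆p , eq = outside ∷ q , out⊆ q⊆p , eq
  subset-of-size (inside ∷ p)  zero    _  with subset-of-size p 0 z≤n
  ... | q , q⊆p , eq = outside ∷ q , out⊆ q⊆p , eq
  subset-of-size (inside ∷ p)  (suc k) (s≤s k≤) with subset-of-size p k k≤
  ... | q , q⊆p , eq = inside ∷ q , in⊆in q⊆p , cong suc eq

  -- Rounding up keeps a third of a nonempty set nonempty, and the slack 2 is harmless once n ≥ 2.
  -- This cuts an arbitrary U down to a size to which the expander condition applies.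
  subset-of-third : ∀ (p : Subset n) →
    Σ[ q ∈ Subset n ] q ⊆ p × ∣ p ∣ ≤ 3 * ∣ q ∣ × 3 * ∣ q ∣ ≤ ∣ p ∣ + 2
  subset-of-third p with subset-of-size p k k≤
    where
    k = (∣ p ∣ + 2) ℕ./ 3
    k≤ : k ≤ ∣ p ∣
    k≤ with ∣ p ∣
    ... | zero  = z≤n
    ... | suc m = ≤-trans (/-monoˡ-≤ 3 (≤-trans (+-monoʳ-≤ (suc m) (*-monoʳ-≤ 2 (s≤s (z≤n {m}))))
                      (≤-reflexive (*-comm 3 (suc m)))))
                    (≤-reflexive (m*n/n≡m (suc m) 3))
  ... | q , q⊆p , eq = q , q⊆p ,
    subst (λ k → ∣ p ∣ ≤ 3 * k) (sym eq) lower , subst (λ k → 3 * k ≤ m) (sym eq) upper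
    where
    m = ∣ p ∣ + 2
    lower : ∣ p ∣ ≤ 3 * (m ℕ./ 3)
    lower = +-cancelʳ-≤ 2 _ _ (begin
      m                     ≡⟨ m≡m%n+[m/n]*n m 3 ⟩
      m % 3 + (m ℕ./ 3) * 3   ≤⟨ +-monoˡ-≤ _ (s≤s⁻¹ (m%n<n m 3)) ⟩
      2 + (m ℕ./ 3) * 3       ≡⟨ +-comm 2 _ ⟩
      (m ℕ./ 3) * 3 + 2       ≡⟨ cong (_+ 2) (*-comm (m ℕ./ 3) 3) ⟩
      3 * (m ℕ./ 3) + 2       ∎)
      where open ≤-Reasoning
    upper : 3 * (m ℕ./ 3) ≤ m
    upper = ≤-trans (≤-reflexive (*-comm 3 (m ℕ./ 3))) (m/n*n≤m m 3)

-- Counting by sums of indicators.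

module Sums where

  open import Data.Nat.Base using (_+_; _*_; _≤_; z≤n; s≤s)
  open import Data.Nat.Properties
  open import Algebra.Properties.CommutativeMonoid.Sum +-0-commutativeMonoid public
    using (sum; ∑-comm; ∑-distrib-+; sum-cong-≗; sum-replicate-zero)
  private variable n : ℕ

  bit : Bool → ℕ
  bit b = if b then 1 else 0

  sum-mono-≤ : ∀ {f g : Fin n → ℕ} → (∀ i → f i ≤ g i) → sum f ≤ sum g
  sum-mono-≤ {zero}  h = z≤n
  sum-mono-≤ {suc n} h = +-mono-≤ (h zero) (sum-mono-≤ (h ∘ suc))

  term≤sum : ∀ (f : Fin n → ℕ) i → f i ≤ sum f
  term≤sum f zero    = m≤m+n (f zero) _
  term≤sum f (suc i) = ≤-trans (term≤sum (f ∘ suc) i) (m≤n+m _ (f zero))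

  ∣tabulate∣≡sum : ∀ (f : Fin n → Bool) → ∣ tabulate f ∣ ≡ sum (bit ∘ f)
  ∣tabulate∣≡sum {zero}  f = refl
  ∣tabulate∣≡sum {suc n} f with f zero
  ... | true  = cong suc (∣tabulate∣≡sum (f ∘ suc))
  ... | false = ∣tabulate∣≡sum (f ∘ suc)

  ∣p∣≡sum : ∀ (p : Subset n) → ∣ p ∣ ≡ sum (bit ∘ lookup p)
  ∣p∣≡sum p = trans (cong ∣_∣ (sym (tabulate∘lookup p))) (∣tabulate∣≡sum (lookup p))

  sum-lookup-* : ∀ (p : Subset n) k → sum (λ v → bit (lookup p v) * k) ≡ ∣ p ∣ * k
  sum-lookup-* []            k = refl
  sum-lookup-* (outside ∷ p) k = sum-lookup-* p k
  sum-lookup-* (inside ∷ p)  k = cong₂ _+_ (+-identityʳ k) (sum-lookup-* p k)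

  bit-mono-≤ : ∀ {b c} → (T b → T c) → bit b ≤ bit c
  bit-mono-≤ {false}         h = z≤n
  bit-mono-≤ {true}  {true}  h = s≤s z≤n
  bit-mono-≤ {true}  {false} h = contradiction tt h

  bit-⊎ : ∀ {a b c} → (T a → T b ⊎ T c) → bit a ≤ bit b + bit c
  bit-⊎ {false}                h = z≤n
  bit-⊎ {true} {true}          h = s≤s z≤n
  bit-⊎ {true} {false} {true}  h = s≤s z≤n
  bit-⊎ {true} {false} {false} h = contradiction (h tt) [ id , id ]′

  bit-disjoint : ∀ {a b c} → (T a → T c) → (T b → T c) → (T a → ¬ T b) → bit a + bit b ≤ bit c
  bit-disjoint {true}  {true}          _ _ d = contradiction tt (d tt)
  bit-disjoint {false} {false}         _ _ _ = z≤n
  bit-disjoint {true}  {false} {true}  _ _ _ = s≤s z≤n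
  bit-disjoint {false} {true}  {true}  _ _ _ = s≤s z≤n
  bit-disjoint {true}  {false} {false} h _ _ = contradiction tt h
  bit-disjoint {false} {true}  {false} _ h _ = contradiction tt h

  length-filter-tabulate : ∀ {A : Set} {P : Pred A 0ℓ} (P? : Decidable P) (f : Fin n → A) →
    length (filter P? (List.tabulate f)) ≡ sum λ i → bit (does (P? (f i)))
  length-filter-tabulate {zero}  P? f = refl
  length-filter-tabulate {suc n} P? f with does (P? (f zero))
  ... | true  = cong suc (length-filter-tabulate P? (f ∘ suc))
  ... | false = length-filter-tabulate P? (f ∘ suc)

  -- The number of edges is defined by filtering a list of pairs; as a double sum it can be
  -- transposed and bounded row by row.
  length-filter-× : ∀ {m} {A B : Set} {P : Pred (A × B) 0ℓ} (P? : Decidable P)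
    (f : Fin m → A) (g : Fin n → B) →
    length (filter P? (cartesianProduct (List.tabulate f) (List.tabulate g))) ≡
    sum λ i → sum λ j → bit (does (P? (f i , g j)))
  length-filter-× {m = zero}  P? f g = refl
  length-filter-× {m = suc m} P? f g = begin
    length (filter P? (List.map (f zero ,_) ys ++ rest))
      ≡⟨ cong length (filter-++ P? (List.map (f zero ,_) ys) rest) ⟩
    length (filter P? (List.map (f zero ,_) ys) ++ filter P? rest)
      ≡⟨ length-++ (filter P? (List.map (f zero ,_) ys)) ⟩
    length (filter P? (List.map (f zero ,_) ys)) + length (filter P? rest)
      ≡⟨ cong₂ _+_
           (trans (cong (length ∘ filter P?) (List.map-tabulate g (f zero ,_)))
                  (length-filter-tabulate P? ((f zero ,_) ∘ g)))
           (length-filter-× P? (f ∘ suc) g) ⟩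
    sum (λ i → sum λ j → bit (does (P? (f i , g j)))) ∎
    where
    open ≡-Reasoning
    ys = List.tabulate g
    rest = cartesianProduct (List.tabulate (f ∘ suc)) ys

-- Edge counts and neighbourhoods.

module Edges where

  open import Data.Nat.Base using (_+_; _*_; _≤_; z≤n)
  open import Data.Nat.Properties
  open import Defs using (Graph; adj; Adj; ∣_∣ᴱ; _⊆ᴱ_; _∖_; Nbr)
  open Sets
  open Sums
  private variable n : ℕ

  T-does⁻ : ∀ {A : Set} (a? : Dec A) → T (does a?) → A
  T-does⁻ (yes a) _ = a

  T-does⁺ : ∀ {A : Set} (a? : Dec A) → A → T (does a?)
  T-does⁺ (yes _) _ = tt
  T-does⁺ (no ¬a) a = contradiction a ¬a

  ∧⁺ : ∀ {b c} → T b → T c → T (b ∧ c)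
  ∧⁺ p q = Equivalence.from T-∧ (p , q)

  ∧⁻ : ∀ b {c} → T (b ∧ c) → T b × T c
  ∧⁻ b = Equivalence.to T-∧

  ∨⁻ : ∀ b {c} → T (b ∨ c) → T b ⊎ T c
  ∨⁻ b = Equivalence.to T-∨

  ∨⁺ : ∀ {b c} → T b ⊎ T c → T (b ∨ c)
  ∨⁺ = Equivalence.from T-∨

  T-not⁺ : ∀ {b} → ¬ T b → T (not b)
  T-not⁺ {true}  ¬t = ¬t tt
  T-not⁺ {false} _  = tt

  T-not⁻ : ∀ {b} → T (not b) → ¬ T b
  T-not⁻ {false} _ ()

  Adj-sym : (G : Graph n) → ∀ {u v} → Adj G u v → Adj G v u
  Adj-sym G {u} {v} = subst T (Graph.adj-sym G u v)

  Adj-irrefl : (G : Graph n) → ∀ {v} → ¬ Adj G v v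
  Adj-irrefl G {v} = subst T (Graph.adj-irrefl G v)

  ∣F∣ᴱ≡sum : (F : Graph n) →
    ∣ F ∣ᴱ ≡ sum λ u → sum λ v → bit (does (u Fin.<? v) ∧ adj F u v)
  ∣F∣ᴱ≡sum F = length-filter-× (λ (u , v) → (u Fin.<? v) ×-dec T? (adj F u v)) id id

  -- An adjacent ordered pair is increasing or decreasing; transposition turns the decreasing ones
  -- into the increasing ones that `∣ F ∣ᴱ` counts.
  sum-adj≤2∣F∣ᴱ : (F : Graph n) → (sum λ u → sum λ v → bit (adj F u v)) ≤ 2 * ∣ F ∣ᴱ
  sum-adj≤2∣F∣ᴱ {n} F = begin
    (sum λ u → sum λ v → bit (adj F u v))
      ≤⟨ sum-mono-≤ (λ u → sum-mono-≤ (λ v → bit-⊎ (split u v))) ⟩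
    (sum λ u → sum λ v → up u v + up v u)
      ≡⟨ sum-cong-≗ (λ u → ∑-distrib-+ (up u) (λ v → up v u)) ⟩
    (sum λ u → sum (up u) + sum (λ v → up v u))
      ≡⟨ ∑-distrib-+ (λ u → sum (up u)) (λ u → sum (λ v → up v u)) ⟩
    sum (λ u → sum (up u)) + sum (λ u → sum (λ v → up v u))
      ≡⟨ cong (sum (λ u → sum (up u)) +_) (∑-comm (λ u v → up v u)) ⟩
    sum (λ u → sum (up u)) + sum (λ u → sum (up u))
      ≡⟨ cong₂ _+_ (sym (∣F∣ᴱ≡sum F)) (trans (sym (∣F∣ᴱ≡sum F)) (sym (+-identityʳ _))) ⟩
    2 * ∣ F ∣ᴱ ∎
    where
    open ≤-Reasoning
    up : Fin n → Fin n → ℕ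
    up u v = bit (does (u Fin.<? v) ∧ adj F u v)
    split : ∀ u v → T (adj F u v) →
      T (does (u Fin.<? v) ∧ adj F u v) ⊎ T (does (v Fin.<? u) ∧ adj F v u)
    split u v a with Fin.<-cmp u v
    ... | tri< u<v _ _ = inj₁ (∧⁺ (T-does⁺ (u Fin.<? v) u<v) a)
    ... | tri> _ _ v<u = inj₂ (∧⁺ (T-does⁺ (v Fin.<? u) v<u) (Adj-sym F a))
    ... | tri≈ _ refl _ = contradiction a (Adj-irrefl F)

  touched : Graph n → Subset n
  touched F = tabulate λ v → does (any? λ u → T? (adj F v u))

  ∈-touched : (F : Graph n) → ∀ {u v} → Adj F v u → v ∈ touched F
  ∈-touched F {u} {v} a = ∈-tabulate⁺ _ (T-does⁺ (any? λ w → T? (adj F v w)) (u , a))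

  ∣touched∣≤ : (F : Graph n) → ∣ touched F ∣ ≤ 2 * ∣ F ∣ᴱ
  ∣touched∣≤ {n} F = begin
    ∣ touched F ∣
      ≡⟨ ∣tabulate∣≡sum (λ u → does (any? λ v → T? (adj F u v))) ⟩
    _                                      ≤⟨ sum-mono-≤ {n} row ⟩
    (sum λ u → sum λ v → bit (adj F u v))  ≤⟨ sum-adj≤2∣F∣ᴱ F ⟩
    2 * ∣ F ∣ᴱ                             ∎
    where
    open ≤-Reasoning
    row : ∀ u → bit (does (any? λ v → T? (adj F u v))) ≤ sum λ v → bit (adj F u v)
    row u with any? (λ v → T? (adj F u v))
    ... | no _        = z≤n
    ... | yes (v , a) = ≤-trans (bit-mono-≤ {true} λ _ → a) (term≤sum (bit ∘ adj F u) v)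

  N[_] : Graph n → Fin n → Subset n
  N[ G ] u = tabulate (adj G u)

  -- The edges of G joining a vertex of B to one outside W, with the condition symmetrised. This is
  -- the deleted set in `wide-large`.
  crossing : Graph n → Subset n → Subset n → Graph n
  crossing G B W = record
    { adj        = λ u v → adj G u v ∧ (exits u v ∨ exits v u)
    ; adj-sym    = λ u v → cong₂ _∧_ (Graph.adj-sym G u v) (∨-comm (exits u v) (exits v u))
    ; adj-irrefl = λ v → cong (_∧ (exits v v ∨ exits v v)) (Graph.adj-irrefl G v)
    }
    where
    exits : _ → _ → Bool
    exits u v = lookup B u ∧ not (lookup W v)

  crossing⊆ : (G : Graph n) (B W : Subset n) → crossing G B W ⊆ᴱ G
  crossing⊆ G B W u v = proj₁ ∘ ∧⁻ (adj G u v)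

  ∈-crossing : (G : Graph n) {B W : Subset n} → ∀ {u v} →
    Adj G u v → u ∈ B → v ∉ W → Adj (crossing G B W) u v
  ∈-crossing G a u∈B v∉W =
    ∧⁺ a (∨⁺ (inj₁ (∧⁺ (∈⇒T-lookup u∈B) (T-not⁺ (v∉W ∘ T-lookup⇒∈)))))

  -- Each edge is charged to an ordered pair that starts in B and ends outside W. Such a pair is not
  -- both increasing and decreasing, so it is charged at most once, and the row of a vertex of B
  -- holds at most k of them.
  ∣crossing∣≤ : (G : Graph n) (B W : Subset n) (k : ℕ) →
    (∀ {u} → u ∈ B → ∣ N[ G ] u ─ W ∣ ≤ k) → ∣ crossing G B W ∣ᴱ ≤ ∣ B ∣ * k
  ∣crossing∣≤ {n} G B W k small = begin
    ∣ crossing G B W ∣ᴱ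
      ≡⟨ ∣F∣ᴱ≡sum (crossing G B W) ⟩
    (sum λ u → sum λ v → bit (does (u Fin.<? v) ∧ adj (crossing G B W) u v))
      ≤⟨ sum-mono-≤ (λ u → sum-mono-≤ (λ v → bit-⊎ (split u v))) ⟩
    (sum λ u → sum λ v → up u v + down v u)
      ≡⟨ sum-cong-≗ (λ u → ∑-distrib-+ (up u) (λ v → down v u)) ⟩
    (sum λ u → sum (up u) + sum (λ v → down v u))
      ≡⟨ ∑-distrib-+ (λ u → sum (up u)) (λ u → sum (λ v → down v u)) ⟩
    sum (λ u → sum (up u)) + sum (λ u → sum (λ v → down v u))
      ≡⟨ cong (sum (λ u → sum (up u)) +_) (∑-comm (λ u v → down v u)) ⟩
    sum (λ u → sum (up u)) + sum (λ u → sum (down u))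
      ≡⟨ ∑-distrib-+ (λ u → sum (up u)) (λ u → sum (down u)) ⟨
    (sum λ u → sum (up u) + sum (down u))
      ≡⟨ sum-cong-≗ (λ u → sym (∑-distrib-+ (up u) (down u))) ⟩
    (sum λ u → sum λ v → up u v + down u v)
      ≤⟨ sum-mono-≤ {n} (λ u → sum-mono-≤ {n} (λ v → bit-disjoint
           (proj₂ ∘ ∧⁻ (does (u Fin.<? v))) (proj₂ ∘ ∧⁻ (does (v Fin.<? u))) (λ p q → Fin.<-asym
             (T-does⁻ (u Fin.<? v) (proj₁ (∧⁻ (does (u Fin.<? v)) p)))
             (T-does⁻ (v Fin.<? u) (proj₁ (∧⁻ (does (v Fin.<? u)) q)))))) ⟩
    (sum λ u → sum λ v → bit (out u v))
      ≤⟨ sum-mono-≤ row ⟩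
    sum (λ u → bit (lookup B u) * k)
      ≡⟨ sum-lookup-* B k ⟩
    ∣ B ∣ * k ∎
    where
    open ≤-Reasoning
    out : Fin n → Fin n → Bool
    out u v = adj G u v ∧ (lookup B u ∧ not (lookup W v))
    up down : Fin n → Fin n → ℕ
    up u v = bit (does (u Fin.<? v) ∧ out u v)
    down u v = bit (does (v Fin.<? u) ∧ out u v)
    split : ∀ u v → T (does (u Fin.<? v) ∧ adj (crossing G B W) u v) →
      T (does (u Fin.<? v) ∧ out u v) ⊎ T (does (u Fin.<? v) ∧ out v u)
    split u v t with ∧⁻ (does (u Fin.<? v)) t
    ... | u<v , e with ∧⁻ (adj G u v) e
    ... | a , d with ∨⁻ (lookup B u ∧ not (lookup W v)) d
    ... | inj₁ p = inj₁ (∧⁺ u<v (∧⁺ a p))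
    ... | inj₂ p = inj₂ (∧⁺ u<v (∧⁺ (Adj-sym G a) p))
    row : ∀ u → sum (bit ∘ out u) ≤ bit (lookup B u) * k
    row u with lookup B u in eq
    ... | false = ≤-trans (sum-mono-≤ {n} λ v →
                      bit-mono-≤ {c = false} (proj₂ ∘ ∧⁻ (adj G u v)))
                    (≤-reflexive (sum-replicate-zero n))
    ... | true  = begin
      sum (λ v → bit (adj G u v ∧ not (lookup W v)))
        ≤⟨ sum-mono-≤ (λ v → bit-mono-≤ λ t →
             ∈⇒T-lookup (x∈p∧x∉q⇒x∈p─q (∈-tabulate⁺ (adj G u) (proj₁ (∧⁻ (adj G u v) t)))
               (T-not⁻ (proj₂ (∧⁻ (adj G u v) t)) ∘ ∈⇒T-lookup))) ⟩
      sum (bit ∘ lookup (N[ G ] u ─ W))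
        ≡⟨ ∣p∣≡sum (N[ G ] u ─ W) ⟨
      ∣ N[ G ] u ─ W ∣
        ≤⟨ small (T-lookup⇒∈ (subst T (sym eq) tt)) ⟩
      k ≡⟨ +-identityʳ k ⟨
      k + 0 ∎

  -- Unlike `Nbr`, this keeps the vertices of P that have a neighbour in P, which makes it monotone
  -- in P.
  Γ : Graph n → Subset n → Subset n
  Γ G P = tabulate λ v → does (any? λ u → (u ∈? P) ×-dec T? (adj G u v))

  ∈-Γ⁺ : (G : Graph n) {P : Subset n} → ∀ {u v} → u ∈ P → Adj G u v → v ∈ Γ G P
  ∈-Γ⁺ G {P} {u} {v} u∈P a = ∈-tabulate⁺ _
    (T-does⁺ (any? λ w → (w ∈? P) ×-dec T? (adj G w v)) (u , u∈P , a))

  ∈-Γ⁻ : (G : Graph n) (P : Subset n) → ∀ {v} → v ∈ Γ G P → ∃[ u ] u ∈ P × Adj G u v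
  ∈-Γ⁻ G P {v} v∈ = T-does⁻ (any? λ w → (w ∈? P) ×-dec T? (adj G w v)) (∈-tabulate⁻ _ v∈)

  ∈-Nbr⁻ : (G : Graph n) (P : Subset n) → ∀ {v} → v ∈ Nbr G P →
    v ∉ P × ∃[ u ] u ∈ P × Adj G u v
  ∈-Nbr⁻ G P {v} v∈ =
    T-does⁻ (¬? (v ∈? P) ×-dec any? λ w → (w ∈? P) ×-dec T? (adj G w v)) (∈-tabulate⁻ _ v∈)

  Γ-mono : (G : Graph n) {P Q : Subset n} → P ⊆ Q → Γ G P ⊆ Γ G Q
  Γ-mono G {P} P⊆Q v∈ with ∈-Γ⁻ G P v∈
  ... | u , u∈P , a = ∈-Γ⁺ G (P⊆Q u∈P) a

  Γ-∖⊆ : (G F : Graph n) (P : Subset n) → Γ (G ∖ F) P ⊆ Γ G P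
  Γ-∖⊆ G F P v∈ with ∈-Γ⁻ (G ∖ F) P v∈
  ... | u , u∈P , a = ∈-Γ⁺ G u∈P (proj₁ (∧⁻ (adj G u _) a))

  Γ─Γ-∖⊆touched : (G F : Graph n) (P : Subset n) → Γ G P ─ Γ (G ∖ F) P ⊆ touched F
  Γ─Γ-∖⊆touched G F P {v} v∈ with ∈-Γ⁻ G P (p─q⊆p _ _ v∈)
  ... | u , u∈P , a with T? (adj F u v)
  ... | yes f = ∈-touched F (Adj-sym F f)
  ... | no ¬f = contradiction (∈-Γ⁺ (G ∖ F) u∈P (∧⁺ a (T-not⁺ ¬f))) (x∈p─q⇒x∉q _ _ v∈)

-- Wide vertices and greedy enlargement.

module Expansion where

  open import Data.Nat.Base using (_+_; _*_; _≤_; _<_; z≤n; s≤s; >-nonZero)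
  open import Data.Nat.Properties
  open import Defs using (Graph; adj; ∣_∣ᴱ; _⊆ᴱ_; _∖_; Nbr)
  open Sets
  open Edges

  -- Expansion in natural numbers only: q stands for log² n / ε and S for s, each rounded in the
  -- safe direction.
  ExpandsBy : ∀ {n} → ℕ → ℕ → Graph n → Set
  ExpandsBy {n} q S G = ∀ (U : Subset n) (F : Graph n) → F ⊆ᴱ G →
    1 ≤ ∣ U ∣ → 3 * ∣ U ∣ ≤ 2 * n → ∣ F ∣ᴱ ≤ ∣ U ∣ * S → ∣ U ∣ ≤ q * ∣ Nbr (G ∖ F) U ∣

  fresh : ∀ {n} → Graph n → Subset n → Subset n → Subset n
  fresh G B Q = Γ G Q ─ B

  wide : ∀ {n} → Graph n → ℕ → Subset n → Subset n → Subset n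
  wide G K B Q = tabulate λ v →
    does ((v ∈? B) ×-dec (K ≤? ∣ N[ G ] v ─ (B ∪ Γ G Q) ∣))

  ∈-wide⁻ : ∀ {n} (G : Graph n) K B Q {v} → v ∈ wide G K B Q →
    v ∈ B × K ≤ ∣ N[ G ] v ─ (B ∪ Γ G Q) ∣
  ∈-wide⁻ G K B Q {v} v∈ =
    T-does⁻ ((v ∈? B) ×-dec (K ≤? ∣ N[ G ] v ─ (B ∪ Γ G Q) ∣)) (∈-tabulate⁻ _ v∈)

  ∈-wide⁺ : ∀ {n} (G : Graph n) K B Q {v} → v ∈ B → K ≤ ∣ N[ G ] v ─ (B ∪ Γ G Q) ∣ →
    v ∈ wide G K B Q
  ∈-wide⁺ G K B Q {v} v∈B K≤ = ∈-tabulate⁺ _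
    (T-does⁺ ((v ∈? B) ×-dec (K ≤? ∣ N[ G ] v ─ (B ∪ Γ G Q) ∣)) (v∈B , K≤))

  -- Otherwise the expander condition fails for B minus its wide vertices, after
  -- deletion of the few edges that leave it towards neither B nor Γ Q.
  wide-large : ∀ {n} (G : Graph n) (q S K : ℕ) → ExpandsBy q S G → K ≤ S → 1 ≤ q →
    ∀ B Q → 1 ≤ ∣ B ∣ → 3 * ∣ B ∣ ≤ 2 * n → 4 * q * ∣ fresh G B Q ∣ < ∣ B ∣ →
    ∣ B ∣ ≤ 4 * q * ∣ wide G K B Q ∣
  wide-large {n} G q S K exp K≤S 1≤q B Q 1≤B B≤ fresh< = ≮⇒≥ λ wide< →
    n≮n (4 * b) (begin-strict
      4 * b                            ≤⟨ *-monoʳ-≤ 4 (∣p∣≤∣p─q∣+∣q∣ B T₀) ⟩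
      4 * (b₁ + t)                     ≤⟨ *-monoʳ-≤ 4 (+-monoˡ-≤ t (b₁≤ wide<)) ⟩
      4 * (q * (z + t) + t)            ≡⟨ ring q z t ⟩
      4 * q * z + 4 * q * t + 4 * t    <⟨ +-mono-<-≤ (+-mono-< fresh< wide<)
                                            (≤-trans (4t≤ wide<) (m≤m+n b b)) ⟩
      b + b + (b + b)                  ≡⟨ ring₂ b ⟩
      4 * b ∎)
    where
    open ≤-Reasoning
    T₀ = wide G K B Q
    B₁ = B ─ T₀
    W  = B ∪ Γ G Q
    b  = ∣ B ∣
    b₁ = ∣ B₁ ∣
    t  = ∣ T₀ ∣
    z  = ∣ fresh G B Q ∣
    F  = crossing G B₁ W
    ring : ∀ q z t → 4 * (q * (z + t) + t) ≡ 4 * q * z + 4 * q * t + 4 * t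
    ring = solve-∀
    ring₂ : ∀ b → b + b + (b + b) ≡ 4 * b
    ring₂ = solve-∀
    4t≤ : 4 * q * t < b → 4 * t ≤ b
    4t≤ wide< = ≤-trans (*-monoˡ-≤ t (*-monoʳ-≤ 4 1≤q)) (<⇒≤ wide<)
    few : ∣ F ∣ᴱ ≤ b₁ * S
    few = ∣crossing∣≤ G B₁ W S λ {u} u∈B₁ → ≮⇒≥ λ S< →
      x∈p─q⇒x∉q B T₀ u∈B₁ (∈-wide⁺ G K B Q (p─q⊆p B T₀ u∈B₁) (≤-trans K≤S (<⇒≤ S<)))
    nbr⊆ : Nbr (G ∖ F) B₁ ⊆ fresh G B Q ∪ T₀
    nbr⊆ {v} v∈ with ∈-Nbr⁻ (G ∖ F) B₁ v∈
    ... | v∉B₁ , u , u∈B₁ , a with ∧⁻ (adj G u v) a | v ∈? W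
    ... | g , ¬f | no v∉W = contradiction (∈-crossing G g u∈B₁ v∉W) (T-not⁻ ¬f)
    ... | g , ¬f | yes v∈W with v ∈? B | v ∈? T₀
    ... | _       | yes v∈T = x∈p∪q⁺ (inj₂ v∈T)
    ... | yes v∈B | no  v∉T = contradiction (x∈p∧x∉q⇒x∈p─q v∈B v∉T) v∉B₁
    ... | no  v∉B | no  v∉T with x∈p∪q⁻ B (Γ G Q) v∈W
    ... | inj₁ v∈B = contradiction v∈B v∉B
    ... | inj₂ v∈Γ = x∈p∪q⁺ (inj₁ (x∈p∧x∉q⇒x∈p─q v∈Γ v∉B))
    b₁≤ : 4 * q * t < b → b₁ ≤ q * (z + t)
    b₁≤ wide< = begin
      b₁                           ≤⟨ exp B₁ F (crossing⊆ G B₁ W) 1≤b₁ 3b₁≤ few ⟩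
      q * ∣ Nbr (G ∖ F) B₁ ∣       ≤⟨ *-monoʳ-≤ q (p⊆q⇒∣p∣≤∣q∣ nbr⊆) ⟩
      q * ∣ fresh G B Q ∪ T₀ ∣     ≤⟨ *-monoʳ-≤ q (∣p∪q∣≤∣p∣+∣q∣ (fresh G B Q) T₀) ⟩
      q * (z + t)                  ∎
      where
      t<b : t < b
      t<b = ≤-<-trans (m≤n*m t (4 * q) {{>-nonZero (*-mono-≤ (s≤s (z≤n {3})) 1≤q)}}) wide<
      1≤b₁ : 1 ≤ b₁
      1≤b₁ = +-cancelʳ-≤ t 1 b₁ (≤-trans t<b (∣p∣≤∣p─q∣+∣q∣ B T₀))
      3b₁≤ : 3 * b₁ ≤ 2 * n
      3b₁≤ = ≤-trans (*-monoʳ-≤ 3 (∣p─q∣≤∣p∣ B T₀)) B≤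

  -- The K neighbours that make v wide avoid Γ Q as well as B, so they come on top of what Q has
  -- already gained.
  fresh-∪ : ∀ {n} (G : Graph n) (K : ℕ) (B Q : Subset n) {v} → v ∈ wide G K B Q →
    ∣ fresh G B Q ∣ + K ≤ ∣ fresh G B (Q ∪ ⁅ v ⁆) ∣
  fresh-∪ G K B Q {v} v∈ = begin
    ∣ fresh G B Q ∣ + K               ≤⟨ +-monoʳ-≤ _ (proj₂ (∈-wide⁻ G K B Q v∈)) ⟩
    ∣ fresh G B Q ∣ + ∣ R ∣           ≤⟨ +-monoʳ-≤ _ (p⊆q⇒∣p∣≤∣q∣ R⊆) ⟩
    ∣ fresh G B Q ∣ + ∣ R ─ fresh G B Q ∣ ≤⟨ ∣p∣+∣q─p∣≤∣p∪q∣ (fresh G B Q) R ⟩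
    ∣ fresh G B Q ∪ R ∣               ≤⟨ p⊆q⇒∣p∣≤∣q∣ ⊆fresh ⟩
    ∣ fresh G B (Q ∪ ⁅ v ⁆) ∣         ∎
    where
    open ≤-Reasoning
    R = N[ G ] v ─ (B ∪ Γ G Q)
    R⊆ : R ⊆ R ─ fresh G B Q
    R⊆ x∈ = x∈p∧x∉q⇒x∈p─q x∈ λ x∈f →
      x∈p─q⇒x∉q (N[ G ] v) (B ∪ Γ G Q) x∈ (x∈p∪q⁺ (inj₂ (p─q⊆p (Γ G Q) B x∈f)))
    ⊆fresh : fresh G B Q ∪ R ⊆ fresh G B (Q ∪ ⁅ v ⁆)
    ⊆fresh {x} x∈ with x∈p∪q⁻ (fresh G B Q) R x∈
    ... | inj₁ x∈f = x∈p∧x∉q⇒x∈p─q (Γ-mono G (p⊆p∪q ⁅ v ⁆) (p─q⊆p (Γ G Q) B x∈f))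
                       (x∈p─q⇒x∉q (Γ G Q) B x∈f)
    ... | inj₂ x∈R = x∈p∧x∉q⇒x∈p─q
      (∈-Γ⁺ G (x∈p∪q⁺ {p = Q} (inj₂ (x∈⁅x⁆ v))) (∈-tabulate⁻ (adj G v) (p─q⊆p (N[ G ] v) _ x∈R)))
      (x∈p─q⇒x∉q (N[ G ] v) (B ∪ Γ G Q) x∈R ∘ x∈p∪q⁺ ∘ inj₁)

  -- `pick` is consulted only about sets Q that are still light and whose gain is still below ∣ B ∣
  -- / M; these are exactly the Q that the failure events cover. Each vertex added brings K fresh
  -- ones, which preserves K ∣ Q ∣ ≤ ∣ fresh ∣.
  greedy : ∀ {n} (G : Graph n) (K M : ℕ) (B V : Subset n) → 1 ≤ K → 1 ≤ M →
    (∀ Q → K * ∣ Q ∣ ≤ ∣ fresh G B Q ∣ → M * ∣ fresh G B Q ∣ < ∣ B ∣ →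
      ∃[ v ] v ∈ V × v ∈ wide G K B Q) →
    Σ[ Q ∈ Subset n ] Q ⊆ V × Q ⊆ B × K * ∣ Q ∣ ≤ ∣ fresh G B Q ∣ × ∣ B ∣ ≤ M * ∣ fresh G B Q ∣
  greedy {n} G K M B V 1≤K 1≤M pick =
    go ∣ B ∣ ⊥ (λ x∈ → contradiction x∈ ∉⊥) (λ x∈ → contradiction x∈ ∉⊥)
      (subst (_≤ ∣ fresh G B ⊥ ∣) (sym (trans (cong (K *_) (∣⊥∣≡0 n)) (*-zeroʳ K))) z≤n)
      (m≤n+m ∣ B ∣ _)
    where
    Result = Σ[ Q ∈ Subset n ] Q ⊆ V × Q ⊆ B × K * ∣ Q ∣ ≤ ∣ fresh G B Q ∣ × ∣ B ∣ ≤ M * ∣ fresh G B Q ∣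
    go : ∀ fuel Q → Q ⊆ V → Q ⊆ B → K * ∣ Q ∣ ≤ ∣ fresh G B Q ∣ →
      ∣ B ∣ ≤ ∣ fresh G B Q ∣ + fuel → Result
    go fuel Q Q⊆V Q⊆B KQ≤ enough with ∣ B ∣ ≤? M * ∣ fresh G B Q ∣
    ... | yes B≤ = Q , Q⊆V , Q⊆B , KQ≤ , B≤
    ... | no  B≰ with fuel
    -- The fuel bounds how far `fresh` falls short of ∣ B ∣, and each new vertex lowers this by K ≥
    -- 1. With no fuel left ∣ B ∣ ≤ ∣ fresh ∣, so the target has been met.
    ... | zero = contradiction (≤-trans (subst (∣ B ∣ ≤_) (+-identityʳ _) enough)
                   (m≤n*m _ M {{>-nonZero 1≤M}})) B≰
    ... | suc fuel with pick Q KQ≤ (≰⇒> B≰)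
    ... | v , v∈V , v∈wide = go fuel (Q ∪ ⁅ v ⁆)
      (λ x∈ → [ Q⊆V , (λ x∈v → subst (_∈ V) (sym (x∈⁅y⁆⇒x≡y v x∈v)) v∈V) ]′ (x∈p∪q⁻ Q ⁅ v ⁆ x∈))
      (λ x∈ → [ Q⊆B , (λ x∈v → subst (_∈ B) (sym (x∈⁅y⁆⇒x≡y v x∈v))
                               (proj₁ (∈-wide⁻ G K B Q v∈wide))) ]′ (x∈p∪q⁻ Q ⁅ v ⁆ x∈))
      (begin
        K * ∣ Q ∪ ⁅ v ⁆ ∣             ≤⟨ *-monoʳ-≤ K (∣p∪q∣≤∣p∣+∣q∣ Q ⁅ v ⁆) ⟩
        K * (∣ Q ∣ + ∣ ⁅ v ⁆ ∣)       ≡⟨ *-distribˡ-+ K ∣ Q ∣ _ ⟩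
        K * ∣ Q ∣ + K * ∣ ⁅ v ⁆ ∣
          ≡⟨ cong (K * ∣ Q ∣ +_) (trans (cong (K *_) (∣⁅x⁆∣≡1 v)) (*-identityʳ K)) ⟩
        K * ∣ Q ∣ + K                 ≤⟨ +-monoˡ-≤ K KQ≤ ⟩
        ∣ fresh G B Q ∣ + K           ≤⟨ fresh-∪ G K B Q v∈wide ⟩
        ∣ fresh G B (Q ∪ ⁅ v ⁆) ∣     ∎)
      (begin
        ∣ B ∣                               ≤⟨ enough ⟩
        ∣ fresh G B Q ∣ + suc fuel          ≡⟨ +-assoc ∣ fresh G B Q ∣ 1 fuel ⟨
        ∣ fresh G B Q ∣ + 1 + fuel          ≤⟨ +-monoˡ-≤ fuel (+-monoʳ-≤ _ 1≤K) ⟩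
        ∣ fresh G B Q ∣ + K + fuel          ≤⟨ +-monoˡ-≤ fuel (fresh-∪ G K B Q v∈wide) ⟩
        ∣ fresh G B (Q ∪ ⁅ v ⁆) ∣ + fuel    ∎)
      where open ≤-Reasoning

-- Paths through V and reachability.

module Paths where

  open import Data.Nat.Base using (_≤_; s≤s)
  open import Data.Nat.Properties
  open import Defs using (Graph; Adj; PathThrough)
  open Edges using (Adj-sym)
  private variable
    n : ℕ
    H : Graph n
    V : Subset n
    u v w : Fin n
    ℓ : ℕ

  -- Listed from the last vertex back to u, so that a path is extended at
  -- index zero.
  record ReversedPath {n} (H : Graph n) (V : Subset n) (u v : Fin n) (ℓ : ℕ) : Set where
    field
      vertex   : Fin (suc ℓ) → Fin n
      head     : vertex zero ≡ v
      last     : vertex (fromℕ ℓ) ≡ u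
      edges    : ∀ i → Adj H (vertex (inject₁ i)) (vertex (suc i))
      distinct : Injective _≡_ _≡_ vertex
      internal : ∀ i → i ≢ zero → i ≢ fromℕ ℓ → vertex i ∈ V
  open ReversedPath

  opposite-inject₁ : (i : Fin n) → opposite (inject₁ i) ≡ suc (opposite i)
  opposite-inject₁ zero    = refl
  opposite-inject₁ (suc i) = cong inject₁ (opposite-inject₁ i)

  opposite-injective : Injective _≡_ _≡_ (opposite {n})
  opposite-injective {x = i} {j} eq =
    trans (sym (Fin.opposite-involutive i)) (trans (cong opposite eq) (Fin.opposite-involutive j))

  reverse : ReversedPath H V u v ℓ → PathThrough H V u v ℓ
  reverse {H = H} {ℓ = ℓ} P = record
    { vertex   = vertex P ∘ opposite
    ; start    = last P
    ; end      = trans (cong (vertex P) (Fin.opposite-involutive zero)) (head P)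
    ; edges    = λ i → subst (λ k → Adj H (vertex P k) (vertex P (inject₁ (opposite i))))
                         (sym (opposite-inject₁ i)) (Adj-sym H (edges P (opposite i)))
    ; distinct = opposite-injective ∘ distinct P
    ; internal = λ i i≢0 i≢ℓ → internal P (opposite i)
        (λ eq → i≢ℓ (opposite-injective (trans eq (sym (Fin.opposite-involutive zero)))))
        (λ eq → i≢0 (opposite-injective eq))
    }

  drop-head : (P : ReversedPath H V u v (suc ℓ)) → ReversedPath H V u (vertex P (suc zero)) ℓ
  drop-head P = record
    { vertex   = vertex P ∘ suc
    ; head     = refl
    ; last     = last P
    ; edges    = edges P ∘ suc
    ; distinct = Fin.suc-injective ∘ distinct P
    ; internal = λ i i≢0 i≢ℓ → internal P (suc i) (λ ()) (i≢ℓ ∘ Fin.suc-injective)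
    }

  truncate : ∀ {ℓ v} (P : ReversedPath H V u v ℓ) i →
    ∃[ k ] k ≤ ℓ × ReversedPath H V u (vertex P i) k
  truncate {ℓ = ℓ} P zero = ℓ , ≤-refl , record
    { vertex   = vertex P
    ; head     = refl
    ; last     = last P
    ; edges    = edges P
    ; distinct = distinct P
    ; internal = internal P
    }
  truncate {ℓ = suc ℓ} P (suc i) with truncate (drop-head P) i
  ... | k , k≤ℓ , P′ = k , m≤n⇒m≤1+n k≤ℓ , P′

  trivial : ReversedPath H V u u 0
  trivial {u = u} = record
    { vertex   = λ _ → u
    ; head     = refl
    ; last     = refl
    ; edges    = λ ()
    ; distinct = λ { {zero} {zero} _ → refl }
    ; internal = λ { zero i≢0 _ → contradiction refl i≢0 }
    }

  -- If v already lies on the path, the path is cut there, so that vertices stay distinct; hence the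
  -- length is only bounded. The old end w becomes internal unless the path is trivial, in which
  -- case w is the start and may lie outside V.
  extend : (P : ReversedPath H V u w ℓ) → (ℓ ≢ 0 → w ∈ V) → Adj H w v →
    ∃[ k ] k ≤ suc ℓ × ReversedPath H V u v k
  extend {H = H} {V = V} {w = w} {ℓ = ℓ} {v = v} P w∈V a with any? (λ i → vertex P i Fin.≟ v)
  ... | yes (i , eq) with truncate P i
  ... | k , k≤ℓ , P′ = k , m≤n⇒m≤1+n k≤ℓ , subst (λ x → ReversedPath H V _ x k) eq P′
  extend {H = H} {V = V} {w = w} {ℓ = ℓ} {v = v} P w∈V a | no new = suc ℓ , ≤-refl , record
    { vertex   = vertex′
    ; head     = refl
    ; last     = last P
    ; edges    = λ where
        zero    → subst (Adj H v) (sym (head P)) (Adj-sym H a)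
        (suc i) → edges P i
    ; distinct = distinct′
    ; internal = internal′
    }
    where
    vertex′ : Fin (suc (suc ℓ)) → Fin _
    vertex′ zero    = v
    vertex′ (suc i) = vertex P i
    distinct′ : Injective _≡_ _≡_ vertex′
    distinct′ {zero}  {zero}  _  = refl
    distinct′ {zero}  {suc j} eq = contradiction (j , sym eq) new
    distinct′ {suc i} {zero}  eq = contradiction (i , eq) new
    distinct′ {suc i} {suc j} eq = cong suc (distinct P eq)
    internal′ : ∀ i → i ≢ zero → i ≢ fromℕ (suc ℓ) → vertex′ i ∈ V
    internal′ zero          i≢0 _   = contradiction refl i≢0
    internal′ (suc zero)    _   i≢ℓ = subst (_∈ V) (sym (head P)) (w∈V λ { refl → i≢ℓ refl })
    internal′ (suc (suc i)) _   i≢ℓ = internal P (suc i) (λ ()) (i≢ℓ ∘ cong suc)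

  -- The end v may lie outside V. Membership in V is asked for only when the path is continued
  -- through v or when v is counted.
  Reach : ∀ {n} → Graph n → Subset n → Subset n → ℕ → Fin n → Set
  Reach H V U j v = ∃[ u ] u ∈ U × ∃[ ℓ ] ℓ ≤ j × ReversedPath H V u v ℓ

  Reach-mono : ∀ {U j k} → j ≤ k → Reach H V U j v → Reach H V U k v
  Reach-mono j≤k (u , u∈U , ℓ , ℓ≤j , P) = u , u∈U , ℓ , ≤-trans ℓ≤j j≤k , P

  Reach-neighbour : ∀ {U} → u ∈ U → Adj H u v → Reach H V U 1 v
  Reach-neighbour {u = u} u∈U a with extend trivial (λ 0≢0 → contradiction refl 0≢0) a
  ... | k , k≤1 , P = u , u∈U , k , k≤1 , P

  Reach-step : ∀ {U j} → Reach H V U j w → w ∈ V → Adj H w v → Reach H V U (suc j) v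
  Reach-step (u , u∈U , ℓ , ℓ≤j , P) w∈V a with extend P (λ _ → w∈V) a
  ... | k , k≤ , P′ = u , u∈U , k , ≤-trans k≤ (s≤s ℓ≤j) , P′

-- Growth of certificates in rounds.

module Growth where

  open import Data.Nat.Base using (_+_; _*_; _^_; _≤_; _<_; z≤n; >-nonZero)
  open import Data.Nat.Properties
  open import Defs using (Graph; Adj; ∣_∣ᴱ; _∖_)
  open Sets
  open Edges
  open Expansion
  open Paths

  -- Neither U nor F occurs, so these events depend on G alone. The 6 is 2 + 2 + 1 + 1, the shares
  -- of the `suc`, P, D and Q in `light-enough`. The `suc` secures one spare factor in the union
  -- bound, which becomes the final failure probability.
  Fail : ∀ {n} → Graph n → (K M : ℕ) (P D Q V : Subset n) → Set
  Fail {n} G K M P D Q V =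
    K * suc (∣ P ∣ + ∣ D ∣ + ∣ Q ∣) ≤ 6 * ∣ B ∣ ×
    ((3 * ∣ B ∣ ≤ 2 * n × M * ∣ fresh G B Q ∣ < ∣ B ∣ × ¬ Nonempty (V ∩ wide G K B Q)) ⊎
     (2 * n < 3 * ∣ B ∣ × 2 * ∣ B ∩ V ∣ ≤ ∣ V ∣))
    where B = Γ G P ─ D

  fail? : ∀ {n} (G : Graph n) K M P D Q V → Dec (Fail G K M P D Q V)
  fail? {n} G K M P D Q V = (_ ≤? _) ×-dec
    (((_ ≤? _) ×-dec (_ <? _) ×-dec ¬? (nonempty? (V ∩ wide G K (Γ G P ─ D) Q))) ⊎-dec
     ((_ <? _) ×-dec (_ ≤? _)))

  -- Wideness is measured in G to keep F out of the failure events; this is the price for returning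
  -- to the graph without F. Every vertex lost is an end of a deleted edge.
  Γ─-∖ : ∀ {n} (G F : Graph n) (Q B : Subset n) →
    ∣ Γ G Q ─ B ∣ ≤ ∣ Γ (G ∖ F) Q ─ B ∣ + 2 * ∣ F ∣ᴱ
  Γ─-∖ G F Q B = begin
    ∣ Γ G Q ─ B ∣                                        ≤⟨ ∣p∣≤∣p─q∣+∣q∣ (Γ G Q ─ B) (touched F) ⟩
    ∣ Γ G Q ─ B ─ touched F ∣ + ∣ touched F ∣
      ≤⟨ +-mono-≤ (p⊆q⇒∣p∣≤∣q∣ sub) (∣touched∣≤ F) ⟩
    ∣ Γ (G ∖ F) Q ─ B ∣ + 2 * ∣ F ∣ᴱ                     ∎
    where
    open ≤-Reasoning
    sub : Γ G Q ─ B ─ touched F ⊆ Γ (G ∖ F) Q ─ B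
    sub {x} x∈ with x ∈? Γ (G ∖ F) Q
    ... | yes x∈Γ = x∈p∧x∉q⇒x∈p─q x∈Γ (x∈p─q⇒x∉q (Γ G Q) B (p─q⊆p (Γ G Q ─ B) (touched F) x∈))
    ... | no  x∉Γ = contradiction
      (Γ─Γ-∖⊆touched G F Q (x∈p∧x∉q⇒x∈p─q (p─q⊆p (Γ G Q) B (p─q⊆p (Γ G Q ─ B) (touched F) x∈)) x∉Γ))
      (x∈p─q⇒x∉q (Γ G Q ─ B) (touched F) x∈)

  module _ {n : ℕ} (G F : Graph n) (V U : Subset n) (K M : ℕ)
    (1≤M : 1 ≤ M) (2M≤K : 2 * M ≤ K)
    (good : ∀ P D Q → ¬ Fail G K M P D Q V) where

    private
      H = G ∖ F
      f = ∣ F ∣ᴱ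
      1≤K : 1 ≤ K
      1≤K = ≤-trans 1≤M (≤-trans (m≤n*m M 2) 2M≤K)
    open ≤-Reasoning

    -- A is the certificate and b the size of its neighbourhood after deletion of F. The 2 in
    -- `light` allows for F destroying up to half of the gain of a round, and `few-edges` ensures
    -- that it destroys no more.
    record Stage (j b : ℕ) : Set where
      field
        A         : Subset n
        size      : ∣ Γ H A ∣ ≡ b
        1≤b       : 1 ≤ b
        light     : K * ∣ A ∣ ≤ 2 * b
        few-edges : K * (2 * f) ≤ b
        reached   : ∀ {v} → v ∈ Γ H A → Reach H V U j v

    Majority : ℕ → Set
    Majority j = Σ[ W ∈ Subset n ]
      (∀ {v} → v ∈ W → v ∈ V × Reach H V U j v) × ∣ V ∣ < 2 * ∣ W ∣

    Majority-mono : ∀ {j k} → j ≤ k → Majority j → Majority k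
    Majority-mono j≤k (W , r , big) =
      W , (λ v∈ → proj₁ (r v∈) , Reach-mono j≤k (proj₂ (r v∈))) , big

    -- A round gains z ≥ b / M vertices in G, of which F takes at most z / 2, so b′ ≥ b + z / 2 ≥ (1
    -- + 1/(2M)) b; the conclusion states this without division. If B has more than 2n/3 vertices,
    -- the absence of the majority failure ends the process instead.
    step : ∀ {j b} → Stage j b →
      Majority j ⊎ ∃[ b′ ] Stage (suc j) b′ × 2 * M * b + b ≤ 2 * M * b′
    step {j} {b} st = go (3 * b ≤? 2 * n)
      where
      open Stage st
      B D : Subset n
      B = Γ H A
      D = Γ G A ─ B
      a = ∣ A ∣
      d = ∣ D ∣
      B≡ : Γ G A ─ D ≡ B
      B≡ = ⊆-antisym
        (λ {x} x∈ → case x x∈ (x ∈? B))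
        (λ x∈B → x∈p∧x∉q⇒x∈p─q (Γ-∖⊆ G F A x∈B) λ x∈D → x∈p─q⇒x∉q (Γ G A) B x∈D x∈B)
        where
        case : ∀ x → x ∈ Γ G A ─ D → Dec (x ∈ B) → x ∈ B
        case x x∈ (yes x∈B) = x∈B
        case x x∈ (no x∉B)  = contradiction
          (x∈p∧x∉q⇒x∈p─q (p─q⊆p (Γ G A) D x∈) x∉B) (x∈p─q⇒x∉q (Γ G A) D x∈)
      -- A is nonempty because its neighbourhood is, so `light` bounds K itself; this pays for the
      -- `suc` in `Fail`.
      K≤2b : K ≤ 2 * b
      K≤2b with nonempty (subst (1 ≤_) (sym size) 1≤b)
      ... | v , v∈B with ∈-Γ⁻ H A v∈B
      ... | u , u∈A , _ = ≤-trans (m≤m*n K a {{>-nonZero (1≤∣p∣ u∈A)}}) light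
      Kd≤b : K * d ≤ b
      Kd≤b = ≤-trans (*-monoʳ-≤ K (≤-trans (p⊆q⇒∣p∣≤∣q∣ (Γ─Γ-∖⊆touched G F A)) (∣touched∣≤ F))) few-edges
      light-enough : ∀ {x} → K * x ≤ b → K * suc (a + d + x) ≤ 6 * b
      light-enough {x} Kx≤b = begin
        K * suc (a + d + x)                ≡⟨ ring K a d x ⟩
        K + K * a + K * d + K * x          ≤⟨ +-mono-≤ (+-mono-≤ (+-mono-≤ K≤2b light) Kd≤b) Kx≤b ⟩
        2 * b + 2 * b + b + b              ≡⟨ ring₂ b ⟩
        6 * b                              ∎
        where
        ring : ∀ K a d x → K * suc (a + d + x) ≡ K + K * a + K * d + K * x
        ring = solve-∀
        ring₂ : ∀ b → 2 * b + 2 * b + b + b ≡ 6 * b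
        ring₂ = solve-∀
      size≡ : ∣ Γ G A ─ D ∣ ≡ b
      size≡ = trans (cong ∣_∣ B≡) size
      go : Dec (3 * b ≤ 2 * n) →
        Majority j ⊎ ∃[ b′ ] Stage (suc j) b′ × 2 * M * b + b ≤ 2 * M * b′
      go (no B>) = inj₁ (B ∩ V , (λ v∈ → proj₂ (x∈p∩q⁻ B V v∈) , reached (proj₁ (x∈p∩q⁻ B V v∈))) ,
        ≰⇒> λ small → good A D ⊥
          ( subst (λ c → K * suc (a + d + ∣ ⊥ {n} ∣) ≤ 6 * c) (sym size≡) (light-enough (subst (_≤ b)
              (sym (trans (cong (K *_) (∣⊥∣≡0 n)) (*-zeroʳ K))) z≤n))
          , inj₂ (subst (λ c → 2 * n < 3 * c) (sym size≡) (≰⇒> B>)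
                 , subst (λ X → 2 * ∣ X ∩ V ∣ ≤ ∣ V ∣) (sym B≡) small)))
      go (yes B≤) with greedy G K M B V 1≤K 1≤M pick
        where
        pick : ∀ Q → K * ∣ Q ∣ ≤ ∣ fresh G B Q ∣ → M * ∣ fresh G B Q ∣ < ∣ B ∣ →
          ∃[ v ] v ∈ V × v ∈ wide G K B Q
        pick Q KQ≤ fresh< with nonempty? (V ∩ wide G K B Q)
        ... | yes (v , v∈) = v , x∈p∩q⁻ V (wide G K B Q) v∈
        ... | no  none = contradiction
          ( subst (λ c → K * suc (a + d + ∣ Q ∣) ≤ 6 * c) (sym size≡) (light-enough (begin
              K * ∣ Q ∣                ≤⟨ KQ≤ ⟩
              ∣ fresh G B Q ∣          ≤⟨ m≤n*m _ M {{>-nonZero 1≤M}} ⟩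
              M * ∣ fresh G B Q ∣      ≤⟨ <⇒≤ fresh< ⟩
              ∣ B ∣                    ≡⟨ size ⟩
              b                        ∎))
          , inj₁ (subst (λ c → 3 * c ≤ 2 * n) (sym size≡) B≤
                 , subst (λ X → M * ∣ fresh G X Q ∣ < ∣ X ∣) (sym B≡) fresh<
                 , subst (λ X → ¬ Nonempty (V ∩ wide G K X Q)) (sym B≡) none))
          (good A D Q)
      ... | Q , Q⊆V , Q⊆B , KQ≤z , B≤Mz = inj₂ (b′ , next , growth)
        where
        A′ = A ∪ Q
        b′ = ∣ Γ H A′ ∣
        z = ∣ fresh G B Q ∣
        -- This is where K ≥ 2M matters: 2f ≤ b / K ≤ b / (2M) ≤ z / 2.
        4f≤z : 4 * f ≤ z
        4f≤z = *-cancelˡ-≤ M {{>-nonZero 1≤M}} (begin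
          M * (4 * f)          ≡⟨ ring M f ⟩
          2 * M * (2 * f)      ≤⟨ *-monoˡ-≤ (2 * f) 2M≤K ⟩
          K * (2 * f)          ≤⟨ few-edges ⟩
          b                    ≡⟨ size ⟨
          ∣ B ∣                ≤⟨ B≤Mz ⟩
          M * z                ∎)
          where
          ring : ∀ M f → M * (4 * f) ≡ 2 * M * (2 * f)
          ring = solve-∀
        b+z≤ : b + z ≤ b′ + 2 * f
        b+z≤ = begin
          b + z                                  ≤⟨ +-monoʳ-≤ b (Γ─-∖ G F Q B) ⟩
          b + (∣ Γ H Q ─ B ∣ + 2 * f)            ≡⟨ +-assoc b _ _ ⟨
          b + ∣ Γ H Q ─ B ∣ + 2 * f              ≡⟨ cong (λ c → c + ∣ Γ H Q ─ B ∣ + 2 * f) size ⟨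
          ∣ B ∣ + ∣ Γ H Q ─ B ∣ + 2 * f          ≤⟨ +-monoˡ-≤ (2 * f) (∣p∣+∣q─p∣≤∣p∪q∣ B (Γ H Q)) ⟩
          ∣ B ∪ Γ H Q ∣ + 2 * f                  ≤⟨ +-monoˡ-≤ (2 * f) (p⊆q⇒∣p∣≤∣q∣ λ x∈ →
            [ Γ-mono H (p⊆p∪q Q) , Γ-mono H (q⊆p∪q A Q) ]′ (x∈p∪q⁻ B (Γ H Q) x∈)) ⟩
          b′ + 2 * f                             ∎
        2b+z≤ : 2 * b + z ≤ 2 * b′
        2b+z≤ = +-cancelʳ-≤ z _ _ (begin
          2 * b + z + z            ≡⟨ ring b z ⟩
          2 * (b + z)              ≤⟨ *-monoʳ-≤ 2 b+z≤ ⟩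
          2 * (b′ + 2 * f)         ≡⟨ ring₂ b′ f ⟩
          2 * b′ + 4 * f           ≤⟨ +-monoʳ-≤ (2 * b′) 4f≤z ⟩
          2 * b′ + z               ∎)
          where
          ring : ∀ b z → 2 * b + z + z ≡ 2 * (b + z)
          ring = solve-∀
          ring₂ : ∀ b f → 2 * (b + 2 * f) ≡ 2 * b + 4 * f
          ring₂ = solve-∀
        b≤b′ : b ≤ b′
        b≤b′ = *-cancelˡ-≤ 2 (≤-trans (m≤m+n (2 * b) z) 2b+z≤)
        growth : 2 * M * b + b ≤ 2 * M * b′
        growth = begin
          2 * M * b + b            ≤⟨ +-monoʳ-≤ _ (subst (_≤ M * z) size B≤Mz) ⟩
          2 * M * b + M * z        ≡⟨ ring M b z ⟩
          M * (2 * b + z)          ≤⟨ *-monoʳ-≤ M 2b+z≤ ⟩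
          M * (2 * b′)             ≡⟨ ring₂ M b′ ⟩
          2 * M * b′               ∎
          where
          ring : ∀ M b z → 2 * M * b + M * z ≡ M * (2 * b + z)
          ring = solve-∀
          ring₂ : ∀ M b → M * (2 * b) ≡ 2 * M * b
          ring₂ = solve-∀
        next : Stage (suc j) b′
        next = record
          { A         = A′
          ; size      = refl
          ; 1≤b       = ≤-trans 1≤b b≤b′
          ; light     = begin
              K * ∣ A ∪ Q ∣          ≤⟨ *-monoʳ-≤ K (∣p∪q∣≤∣p∣+∣q∣ A Q) ⟩
              K * (a + ∣ Q ∣)        ≡⟨ *-distribˡ-+ K a ∣ Q ∣ ⟩
              K * a + K * ∣ Q ∣      ≤⟨ +-mono-≤ light KQ≤z ⟩
              2 * b + z              ≤⟨ 2b+z≤ ⟩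
              2 * b′                 ∎
          ; few-edges = ≤-trans few-edges b≤b′
          ; reached   = λ v∈ → next-reached v∈
          }
          where
          next-reached : ∀ {v} → v ∈ Γ H A′ → Reach H V U (suc j) v
          next-reached v∈ with ∈-Γ⁻ H A′ v∈
          ... | w , w∈A′ , wv with x∈p∪q⁻ A Q w∈A′
          ... | inj₁ w∈A = Reach-mono (n≤1+n j) (reached (∈-Γ⁺ H w∈A wv))
          ... | inj₂ w∈Q = Reach-step (reached (Q⊆B w∈Q)) (Q⊆V w∈Q) wv

    -- Sizes do not decrease, so each round gains at least b / (2M) for the starting size b and the
    -- gains add up linearly. After k = 2M rounds the size has doubled.
    iterate : ∀ k {j b} → Stage j b →
      Majority (k + j) ⊎ ∃[ b′ ] Stage (k + j) b′ × b ≤ b′ × 2 * M * b + k * b ≤ 2 * M * b′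
    iterate zero    {b = b} st = inj₂ (b , st , ≤-refl , ≤-reflexive (+-identityʳ _))
    iterate (suc k) {j} {b} st with iterate k st
    ... | inj₁ m = inj₁ (Majority-mono (n≤1+n (k + j)) m)
    ... | inj₂ (b′ , st′ , b≤b′ , grown) with step st′
    ... | inj₁ m = inj₁ (Majority-mono (n≤1+n (k + j)) m)
    ... | inj₂ (b″ , st″ , grown′) = inj₂ (b″ , st″ ,
        *-cancelˡ-≤ (2 * M) {{>-nonZero (≤-trans 1≤M (m≤n*m M 2))}}
          (≤-trans (m≤m+n (2 * M * b) _) total) , total)
      where
      total : 2 * M * b + (b + k * b) ≤ 2 * M * b″
      total = begin
        2 * M * b + (b + k * b)    ≡⟨ ring (2 * M * b) b (k * b) ⟩
        2 * M * b + k * b + b      ≤⟨ +-mono-≤ grown b≤b′ ⟩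
        2 * M * b′ + b′            ≤⟨ grown′ ⟩
        2 * M * b″                 ∎
        where
        ring : ∀ x b y → x + (b + y) ≡ x + y + b
        ring = solve-∀

    doubling : ∀ i {j b} → Stage j b →
      Majority (i * (2 * M) + j) ⊎ ∃[ b′ ] Stage (i * (2 * M) + j) b′ × 2 ^ i * b ≤ b′
    doubling zero    {b = b} st = inj₂ (b , st , ≤-reflexive (+-identityʳ b))
    doubling (suc i) {j} {b} st with doubling i st
    ... | inj₁ m = inj₁ (Majority-mono (+-monoˡ-≤ j (m≤n+m (i * (2 * M)) (2 * M))) m)
    ... | inj₂ (b′ , st′ , grown) with iterate (2 * M) st′
    ... | inj₁ m = inj₁ (subst Majority (sym (+-assoc (2 * M) _ j)) m)
    ... | inj₂ (b″ , st″ , _ , grown′) =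
      inj₂ (b″ , subst (λ k → Stage k b″) (sym (+-assoc (2 * M) _ j)) st″ , (begin
        2 * 2 ^ i * b       ≡⟨ *-assoc 2 (2 ^ i) b ⟩
        2 * (2 ^ i * b)     ≤⟨ *-monoʳ-≤ 2 grown ⟩
        2 * b′              ≤⟨ *-cancelˡ-≤ (2 * M) {{>-nonZero (≤-trans 1≤M (m≤n*m M 2))}}
                                 (subst (_≤ 2 * M * b″) (ring (2 * M) b′) grown′) ⟩
        b″                  ∎))
      where
      ring : ∀ x b → x * b + x * b ≡ x * (2 * b)
      ring = solve-∀

    -- Starting from b ≥ 1, l doublings would produce a neighbourhood of more than n vertices, so
    -- the process must have ended in a majority.
    majority : ∀ l {b} → n < 2 ^ l → Stage 1 b → Majority (l * (2 * M) + 1)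
    majority l {b} n< st with doubling l st
    ... | inj₁ m = m
    ... | inj₂ (b′ , st′ , grown) = contradiction (begin-strict
        n               <⟨ n< ⟩
        2 ^ l           ≤⟨ m≤m*n (2 ^ l) b {{>-nonZero (Stage.1≤b st)}} ⟩
        2 ^ l * b       ≤⟨ grown ⟩
        b′              ≡⟨ Stage.size st′ ⟨
        ∣ Γ H (Stage.A st′) ∣ ≤⟨ ∣p∣≤n (Γ H (Stage.A st′)) ⟩
        n ∎) (n≮n n)

    -- The first stage needs no luck: it grows from a third of U, and the first
    -- vertex of a path need not lie in V.
    first-stage : ∀ {q S} → 2 ≤ n → M ≡ 4 * q → ExpandsBy q S G → K ≤ S → Nonempty U →
      3 * M * (K * (2 * f) + 2 * f) ≤ ∣ U ∣ → ∃[ b ] Stage 1 b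
    first-stage {q} {S} 2≤n refl exp K≤S (u₀ , u₀∈U) f-small with subset-of-third U
    ... | U₁ , U₁⊆U , U≤ , ≤U = build (greedy G K M U₁ ⊤ 1≤K 1≤M pick)
      where
      1≤U₁ : 1 ≤ ∣ U₁ ∣
      1≤U₁ = *-cancelˡ-< 3 0 ∣ U₁ ∣ (≤-trans (1≤∣p∣ u₀∈U) U≤)
      U₁≤ : 3 * ∣ U₁ ∣ ≤ 2 * n
      U₁≤ = begin
        3 * ∣ U₁ ∣      ≤⟨ ≤U ⟩
        ∣ U ∣ + 2       ≤⟨ +-mono-≤ (∣p∣≤n U) 2≤n ⟩
        n + n           ≡⟨ cong (n +_) (+-identityʳ n) ⟨
        2 * n           ∎
      1≤q : 1 ≤ q
      1≤q = *-cancelˡ-< 4 0 q 1≤M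
      pick : ∀ Q → K * ∣ Q ∣ ≤ ∣ fresh G U₁ Q ∣ → M * ∣ fresh G U₁ Q ∣ < ∣ U₁ ∣ →
        ∃[ v ] v ∈ ⊤ × v ∈ wide G K U₁ Q
      pick Q _ fresh< with nonempty {p = wide G K U₁ Q} (*-cancelˡ-< M 0 _ (begin-strict
        M * 0                     ≡⟨ *-zeroʳ M ⟩
        0                         <⟨ 1≤U₁ ⟩
        ∣ U₁ ∣                    ≤⟨ wide-large G q S K exp K≤S 1≤q U₁ Q 1≤U₁ U₁≤ fresh< ⟩
        M * ∣ wide G K U₁ Q ∣     ∎))
      ... | v , v∈ = v , ∈⊤ , v∈
      build : Σ[ Q ∈ Subset n ] Q ⊆ ⊤ × Q ⊆ U₁ × K * ∣ Q ∣ ≤ ∣ fresh G U₁ Q ∣ ×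
        ∣ U₁ ∣ ≤ M * ∣ fresh G U₁ Q ∣ → ∃[ b ] Stage 1 b
      build (Q , _ , Q⊆U₁ , KQ≤z , U₁≤Mz) = b , record
        { A         = Q
        ; size      = refl
        ; 1≤b       = *-cancelˡ-< 2 0 b (≤-trans 1≤z z≤2b)
        ; light     = ≤-trans KQ≤z z≤2b
        ; few-edges = +-cancelʳ-≤ (2 * f) _ _ (≤-trans 2Kf+2f≤z z≤b+2f)
        ; reached   = λ v∈ → reached′ (∈-Γ⁻ H Q v∈)
        }
        where
        z b : ℕ
        z = ∣ fresh G U₁ Q ∣
        b = ∣ Γ H Q ∣
        reached′ : ∀ {v} → ∃[ u ] u ∈ Q × Adj H u v → Reach H V U 1 v
        reached′ (u , u∈Q , wv) = Reach-neighbour (U₁⊆U (Q⊆U₁ u∈Q)) wv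
        z≤b+2f : z ≤ b + 2 * f
        z≤b+2f = ≤-trans (Γ─-∖ G F Q U₁) (+-monoˡ-≤ (2 * f) (∣p─q∣≤∣p∣ (Γ H Q) U₁))
        -- In the bound on ∣ U ∣ the 3 pays for passing to a third of U and the M for the share of
        -- it that the greedy choice gains. The summand 2f is what F may take from z.
        2Kf+2f≤z : K * (2 * f) + 2 * f ≤ z
        2Kf+2f≤z = *-cancelˡ-≤ (3 * M) {{>-nonZero (≤-trans 1≤M (m≤n*m M 3))}} (begin
          3 * M * (K * (2 * f) + 2 * f)  ≤⟨ f-small ⟩
          ∣ U ∣                          ≤⟨ U≤ ⟩
          3 * ∣ U₁ ∣                     ≤⟨ *-monoʳ-≤ 3 U₁≤Mz ⟩
          3 * (M * z)                    ≡⟨ *-assoc 3 M z ⟨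
          3 * M * z                      ∎)
        1≤z : 1 ≤ z
        1≤z = *-cancelˡ-< M 0 z (subst (_< M * z) (sym (*-zeroʳ M)) (≤-trans 1≤U₁ U₁≤Mz))
        z≤2b : z ≤ 2 * b
        z≤2b = +-cancelʳ-≤ z _ _ (begin
          z + z                        ≤⟨ +-mono-≤ z≤b+2f z≤b+2f ⟩
          b + 2 * f + (b + 2 * f)      ≡⟨ ring b (2 * f) ⟩
          2 * b + (2 * f + 2 * f)      ≤⟨ +-monoʳ-≤ (2 * b) (≤-trans
            (+-monoˡ-≤ (2 * f) (m≤n*m (2 * f) K {{>-nonZero 1≤K}})) 2Kf+2f≤z) ⟩
          2 * b + z                    ∎)
          where
          ring : ∀ b x → b + x + (b + x) ≡ 2 * b + (x + x)
          ring = solve-∀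

-- Weighted sums over subsets, moments and tail estimates.

module Weights where

  open import Data.Nat.Base using (_+_; _*_; _∸_; _^_; _≤_; >-nonZero)
  open import Data.Nat.Properties
  open Sums
  private variable n : ℕ

  -- ∑ over all V of a^∣V∣ b^∣∁V∣ f(V); with a = 1 and b = 2 this is 3ⁿ times the
  -- expectation of f when each element is kept with probability 1/3.
  wsum : (a b : ℕ) → (Subset n → ℕ) → ℕ
  wsum {zero}  a b f = f []
  wsum {suc n} a b f = a * wsum a b (f ∘ (inside ∷_)) + b * wsum a b (f ∘ (outside ∷_))

  module _ (a b : ℕ) where

    open ≤-Reasoning

    wsum-mono-≤ : ∀ {f g : Subset n → ℕ} → (∀ V → f V ≤ g V) → wsum a b f ≤ wsum a b g
    wsum-mono-≤ {zero}  h = h []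
    wsum-mono-≤ {suc n} h = +-mono-≤ (*-monoʳ-≤ a (wsum-mono-≤ (h ∘ (inside ∷_))))
                                     (*-monoʳ-≤ b (wsum-mono-≤ (h ∘ (outside ∷_))))

    wsum-cong : ∀ {f g : Subset n → ℕ} → (∀ V → f V ≡ g V) → wsum a b f ≡ wsum a b g
    wsum-cong h = ≤-antisym (wsum-mono-≤ (≤-reflexive ∘ h)) (wsum-mono-≤ (≤-reflexive ∘ sym ∘ h))

    wsum-linear : ∀ c d (f g : Subset n → ℕ) →
      wsum a b (λ V → c * f V + d * g V) ≡ c * wsum a b f + d * wsum a b g
    wsum-linear {zero}  c d f g = refl
    wsum-linear {suc n} c d f g = begin-equality
      a * wsum a b (λ V → c * f₁ V + d * g₁ V) + b * wsum a b (λ V → c * f₀ V + d * g₀ V)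
        ≡⟨ cong₂ (λ x y → a * x + b * y) (wsum-linear c d f₁ g₁) (wsum-linear c d f₀ g₀) ⟩
      a * (c * wsum a b f₁ + d * wsum a b g₁) + b * (c * wsum a b f₀ + d * wsum a b g₀)
        ≡⟨ ring a b c d (wsum a b f₁) (wsum a b g₁) (wsum a b f₀) (wsum a b g₀) ⟩
      c * (a * wsum a b f₁ + b * wsum a b f₀) + d * (a * wsum a b g₁ + b * wsum a b g₀) ∎
      where
      f₁ = f ∘ (inside ∷_)
      f₀ = f ∘ (outside ∷_)
      g₁ = g ∘ (inside ∷_)
      g₀ = g ∘ (outside ∷_)
      ring : ∀ a b c d f g h k → a * (c * f + d * g) + b * (c * h + d * k) ≡
                                 c * (a * f + b * h) + d * (a * g + b * k)
      ring = solve-∀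

    wsum-+ : ∀ (f g : Subset n → ℕ) → wsum a b (λ V → f V + g V) ≡ wsum a b f + wsum a b g
    wsum-+ f g = begin-equality
      wsum a b (λ V → f V + g V)
        ≡⟨ wsum-cong (λ V → sym (cong₂ _+_ (*-identityˡ (f V)) (*-identityˡ (g V)))) ⟩
      wsum a b (λ V → 1 * f V + 1 * g V)       ≡⟨ wsum-linear 1 1 f g ⟩
      1 * wsum a b f + 1 * wsum a b g
        ≡⟨ cong₂ _+_ (*-identityˡ (wsum a b f)) (*-identityˡ (wsum a b g)) ⟩
      wsum a b f + wsum a b g                  ∎

    wsum-*ʳ : ∀ (f : Subset n → ℕ) c → wsum a b (λ V → f V * c) ≡ wsum a b f * c
    wsum-*ʳ f c = begin-equality
      wsum a b (λ V → f V * c)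
        ≡⟨ wsum-cong (λ V → trans (*-comm (f V) c) (sym (+-identityʳ _))) ⟩
      wsum a b (λ V → c * f V + 0 * f V)    ≡⟨ wsum-linear c 0 f f ⟩
      c * wsum a b f + 0                    ≡⟨ trans (+-identityʳ _) (*-comm c _) ⟩
      wsum a b f * c                        ∎

    wsum-*ˡ : ∀ c (f : Subset n → ℕ) → wsum a b (λ V → c * f V) ≡ c * wsum a b f
    wsum-*ˡ c f = trans (wsum-cong λ V → *-comm c (f V)) (trans (wsum-*ʳ f c) (*-comm _ c))

    wsum-const : ∀ c → wsum {n} a b (λ _ → c) ≡ (a + b) ^ n * c
    wsum-const {zero}  c = sym (+-identityʳ c)
    wsum-const {suc n} c = begin-equality
      a * wsum {n} a b (λ _ → c) + b * wsum {n} a b (λ _ → c)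
        ≡⟨ *-distribʳ-+ (wsum {n} a b (λ _ → c)) a b ⟨
      (a + b) * wsum {n} a b (λ _ → c)     ≡⟨ cong ((a + b) *_) (wsum-const {n} c) ⟩
      (a + b) * ((a + b) ^ n * c)          ≡⟨ *-assoc (a + b) _ c ⟨
      (a + b) * (a + b) ^ n * c            ∎

  -- Fubini for finite sums. It moves the sum over V inside the sums over P, D and Q.
  wsum-swap : ∀ {m} a b c d (f : Subset m → Subset n → ℕ) →
    wsum a b (λ V → wsum c d (f V)) ≡ wsum c d (λ P → wsum a b (λ V → f V P))
  wsum-swap {m = zero}  a b c d f = refl
  wsum-swap {m = suc m} a b c d f = trans
    (cong₂ (λ x y → a * x + b * y)
      (wsum-swap a b c d (f ∘ (inside ∷_))) (wsum-swap a b c d (f ∘ (outside ∷_))))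
    (sym (wsum-linear c d a b (λ P → wsum a b (λ V → f (inside ∷ V) P))
                              (λ P → wsum a b (λ V → f (outside ∷ V) P))))

  term≤wsum : ∀ (f : Subset n → ℕ) P → f P ≤ wsum 1 1 f
  term≤wsum f []            = ≤-refl
  term≤wsum f (inside ∷ P)  = ≤-trans (term≤wsum f₁ P)
    (≤-trans (≤-reflexive (sym (*-identityˡ (wsum 1 1 f₁)))) (m≤m+n (1 * wsum 1 1 f₁) _))
    where f₁ = f ∘ (inside ∷_)
  term≤wsum f (outside ∷ P) = ≤-trans (term≤wsum f₀ P)
    (≤-trans (≤-reflexive (sym (*-identityˡ (wsum 1 1 f₀))))
      (m≤n+m (1 * wsum 1 1 f₀) (1 * wsum 1 1 (f ∘ (inside ∷_)))))
    where f₀ = f ∘ (outside ∷_)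

  ∣p∣+∣∁p∣≡n : ∀ (p : Subset n) → ∣ p ∣ + ∣ ∁ p ∣ ≡ n
  ∣p∣+∣∁p∣≡n p = trans (cong (∣ p ∣ +_) (∣∁p∣≡n∸∣p∣ p)) (m+[n∸m]≡n (∣p∣≤n p))

  -- The binomial theorem. The complement appears because weights x^(-∣ P ∣) are multiplied by xⁿ to
  -- stay in ℕ.
  wsum-power : ∀ x → wsum {n} 1 1 (λ P → x ^ ∣ ∁ P ∣) ≡ suc x ^ n
  wsum-power {zero}  x = refl
  wsum-power {suc n} x = begin-equality
    1 * wsum {n} 1 1 (λ P → x ^ ∣ ∁ P ∣) + 1 * wsum {n} 1 1 (λ P → x * x ^ ∣ ∁ P ∣)
      ≡⟨ cong₂ _+_ (*-identityˡ _) (trans (*-identityˡ _) (wsum-*ˡ 1 1 x (λ (P : Subset n) → x ^ ∣ ∁ P ∣))) ⟩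
    suc x * wsum {n} 1 1 (λ P → x ^ ∣ ∁ P ∣)
      ≡⟨ cong (suc x *_) (wsum-power {n} x) ⟩
    suc x * suc x ^ n ∎
    where open ≤-Reasoning

  avoids : Subset n → Subset n → ℕ
  avoids []            []            = 1
  avoids (inside ∷ T)  (inside ∷ V)  = 0
  avoids (inside ∷ T)  (outside ∷ V) = avoids T V
  avoids (outside ∷ T) (_ ∷ V)       = avoids T V

  avoids≡1 : ∀ (T V : Subset n) → ¬ Nonempty (V ∩ T) → avoids T V ≡ 1
  avoids≡1 []            []            _ = refl
  avoids≡1 (inside ∷ T)  (inside ∷ V)  e = contradiction (zero , here) e
  avoids≡1 (inside ∷ T)  (outside ∷ V) e = avoids≡1 T V λ (x , x∈) → e (suc x , there x∈)
  avoids≡1 (outside ∷ T) (_ ∷ V)       e = avoids≡1 T V λ (x , x∈) → e (suc x , there x∈)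

  -- V misses T with probability (2/3)^∣ T ∣: an element of T keeps only the weight 2, out of 3, of
  -- being left out.
  wsum-avoids : ∀ (T : Subset n) → wsum 1 2 (avoids T) * 3 ^ ∣ T ∣ ≡ 2 ^ ∣ T ∣ * 3 ^ n
  wsum-avoids []            = refl
  wsum-avoids {suc n} (outside ∷ T) = begin-equality
    (1 * w + 2 * w) * 3 ^ t     ≡⟨ ring w (3 ^ t) ⟩
    w * 3 ^ t * 3               ≡⟨ cong (_* 3) (wsum-avoids T) ⟩
    2 ^ t * 3 ^ n * 3           ≡⟨ ring₂ (2 ^ t) (3 ^ n) ⟩
    2 ^ t * (3 * 3 ^ n)         ∎
    where
    open ≤-Reasoning
    w = wsum 1 2 (avoids T)
    t = ∣ T ∣
    ring : ∀ w x → (1 * w + 2 * w) * x ≡ w * x * 3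
    ring = solve-∀
    ring₂ : ∀ x y → x * y * 3 ≡ x * (3 * y)
    ring₂ = solve-∀
  wsum-avoids {suc n} (inside ∷ T) = begin-equality
    (1 * wsum {n} 1 2 (λ _ → 0) + 2 * w) * (3 * 3 ^ t)
      ≡⟨ cong (λ z → (1 * z + 2 * w) * (3 * 3 ^ t)) (trans (wsum-const 1 2 {n} 0) (*-zeroʳ (3 ^ n))) ⟩
    2 * w * (3 * 3 ^ t)         ≡⟨ ring w (3 ^ t) ⟩
    w * 3 ^ t * 6               ≡⟨ cong (_* 6) (wsum-avoids T) ⟩
    2 ^ t * 3 ^ n * 6           ≡⟨ ring₂ (2 ^ t) (3 ^ n) ⟩
    2 * 2 ^ t * (3 * 3 ^ n)     ∎
    where
    open ≤-Reasoning
    w = wsum 1 2 (avoids T)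
    t = ∣ T ∣
    ring : ∀ w x → 2 * w * (3 * x) ≡ w * x * 6
    ring = solve-∀
    ring₂ : ∀ x y → x * y * 6 ≡ 2 * x * (3 * y)
    ring₂ = solve-∀

  -- tilt B V = 2^(∣B ─ V∣ + ∣V ─ B∣), the exponential moment for ∣B ∩ V∣ ≤ ∣V∣ / 2.
  tilt : Subset n → Subset n → ℕ
  tilt []            []            = 1
  tilt (inside ∷ B)  (inside ∷ V)  = tilt B V
  tilt (inside ∷ B)  (outside ∷ V) = 2 * tilt B V
  tilt (outside ∷ B) (inside ∷ V)  = 2 * tilt B V
  tilt (outside ∷ B) (outside ∷ V) = tilt B V

  tilt-∩ : ∀ (B V : Subset n) → tilt B V * 4 ^ ∣ B ∩ V ∣ ≡ 2 ^ ∣ B ∣ * 2 ^ ∣ V ∣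
  tilt-∩ []            []            = refl
  tilt-∩ (inside ∷ B)  (inside ∷ V)  = trans (ring (tilt B V) _)
    (trans (cong (4 *_) (tilt-∩ B V)) (ring₂ (2 ^ ∣ B ∣) _))
    where
    ring : ∀ t x → t * (4 * x) ≡ 4 * (t * x)
    ring = solve-∀
    ring₂ : ∀ x y → 4 * (x * y) ≡ 2 * x * (2 * y)
    ring₂ = solve-∀
  tilt-∩ (inside ∷ B)  (outside ∷ V) = trans (*-assoc 2 (tilt B V) _)
    (trans (cong (2 *_) (tilt-∩ B V)) (sym (*-assoc 2 (2 ^ ∣ B ∣) _)))
  tilt-∩ (outside ∷ B) (inside ∷ V)  = trans (*-assoc 2 (tilt B V) _)
    (trans (cong (2 *_) (tilt-∩ B V)) (ring (2 ^ ∣ B ∣) _))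
    where
    ring : ∀ x y → 2 * (x * y) ≡ x * (2 * y)
    ring = solve-∀
  tilt-∩ (outside ∷ B) (outside ∷ V) = tilt-∩ B V

  2^∣B∣≤tilt : ∀ (B V : Subset n) → 2 * ∣ B ∩ V ∣ ≤ ∣ V ∣ → 2 ^ ∣ B ∣ ≤ tilt B V
  2^∣B∣≤tilt B V few = *-cancelʳ-≤ _ _ (4 ^ ∣ B ∩ V ∣) {{m^n≢0 4 ∣ B ∩ V ∣}} (begin
    2 ^ ∣ B ∣ * 4 ^ ∣ B ∩ V ∣           ≡⟨ cong (2 ^ ∣ B ∣ *_) (^-*-assoc 2 2 ∣ B ∩ V ∣) ⟩
    2 ^ ∣ B ∣ * 2 ^ (2 * ∣ B ∩ V ∣)     ≤⟨ *-monoʳ-≤ (2 ^ ∣ B ∣) (^-monoʳ-≤ 2 few) ⟩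
    2 ^ ∣ B ∣ * 2 ^ ∣ V ∣               ≡⟨ tilt-∩ B V ⟨
    tilt B V * 4 ^ ∣ B ∩ V ∣            ∎)
    where open ≤-Reasoning

  -- The elements contribute independently: 1 · 1 + 2 · 2 = 5 for one in B and 1 · 2 + 2 · 1 = 4 for
  -- one outside B.
  wsum-tilt : ∀ (B : Subset n) → wsum 1 2 (tilt B) ≡ 5 ^ ∣ B ∣ * 4 ^ ∣ ∁ B ∣
  wsum-tilt []            = refl
  wsum-tilt {suc n} (inside ∷ B) = begin-equality
    1 * w + 2 * wsum 1 2 (λ V → 2 * tilt B V)
      ≡⟨ cong (λ z → 1 * w + 2 * z) (wsum-*ˡ 1 2 2 (tilt B)) ⟩
    1 * w + 2 * (2 * w)                         ≡⟨ ring w ⟩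
    5 * w                                       ≡⟨ cong (5 *_) (wsum-tilt B) ⟩
    5 * (5 ^ ∣ B ∣ * 4 ^ ∣ ∁ B ∣)               ≡⟨ *-assoc 5 (5 ^ ∣ B ∣) _ ⟨
    5 * 5 ^ ∣ B ∣ * 4 ^ ∣ ∁ B ∣                 ∎
    where
    open ≤-Reasoning
    w = wsum 1 2 (tilt B)
    ring : ∀ w → 1 * w + 2 * (2 * w) ≡ 5 * w
    ring = solve-∀
  wsum-tilt {suc n} (outside ∷ B) = begin-equality
    1 * wsum 1 2 (λ V → 2 * tilt B V) + 2 * w
      ≡⟨ cong (λ z → 1 * z + 2 * w) (wsum-*ˡ 1 2 2 (tilt B)) ⟩
    1 * (2 * w) + 2 * w                         ≡⟨ ring w ⟩
    w * 4                                       ≡⟨ cong (_* 4) (wsum-tilt B) ⟩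
    5 ^ ∣ B ∣ * 4 ^ ∣ ∁ B ∣ * 4                 ≡⟨ ring₂ (5 ^ ∣ B ∣) _ ⟩
    5 ^ ∣ B ∣ * (4 * 4 ^ ∣ ∁ B ∣)               ∎
    where
    open ≤-Reasoning
    w = wsum 1 2 (tilt B)
    ring : ∀ w → 1 * (2 * w) + 2 * w ≡ w * 4
    ring = solve-∀
    ring₂ : ∀ x y → x * y * 4 ≡ x * (4 * y)
    ring₂ = solve-∀

  -- Bernoulli's inequality in the form (x / (x + 1))^k ≥ 1 - k / x with x = k + r. The induction on
  -- k keeps x fixed, so r grows as k decreases.
  bernoulli : ∀ k r → suc (k + r) ^ k * r ≤ (k + r) ^ suc k
  bernoulli zero    r = ≤-reflexive (*-comm 1 r)
  bernoulli (suc k) r = begin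
    suc x * suc x ^ k * r           ≡⟨ ring (suc x ^ k) x r ⟩
    suc x ^ k * (r + x * r)         ≤⟨ *-monoʳ-≤ (suc x ^ k) (+-monoˡ-≤ (x * r) (m≤n+m r (suc k))) ⟩
    suc x ^ k * (x + x * r)         ≡⟨ cong (suc x ^ k *_) (*-suc x r) ⟨
    suc x ^ k * (x * suc r)         ≡⟨ ring₂ (suc x ^ k) x (suc r) ⟩
    x * (suc x ^ k * suc r)
      ≤⟨ *-monoʳ-≤ x (subst (λ y → suc y ^ k * suc r ≤ y ^ suc k) (+-suc k r) (bernoulli k (suc r))) ⟩
    x * x ^ suc k                   ∎
    where
    open ≤-Reasoning
    x = suc k + r
    ring : ∀ p x r → suc x * p * r ≡ p * (r + x * r)
    ring = solve-∀
    ring₂ : ∀ p x s → p * (x * s) ≡ x * (p * s)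
    ring₂ = solve-∀

  -- Bernoulli gives (1 + 1/x)^k ≤ x / (x - k), and k is at most half of x.
  suc-^≤ : ∀ k x → 1 ≤ x → 2 * k ≤ x → suc x ^ k ≤ 2 * x ^ k
  suc-^≤ k x 1≤x 2k≤x = *-cancelʳ-≤ _ _ x {{>-nonZero 1≤x}} (begin
    suc x ^ k * x               ≤⟨ *-monoʳ-≤ (suc x ^ k) x≤2r ⟩
    suc x ^ k * (2 * r)         ≡⟨ ring (suc x ^ k) r ⟩
    2 * (suc x ^ k * r)
      ≤⟨ *-monoʳ-≤ 2 (subst (λ y → suc y ^ k * r ≤ y ^ suc k) k+r≡x (bernoulli k r)) ⟩
    2 * (x * x ^ k)             ≡⟨ ring₂ x (x ^ k) ⟩
    2 * x ^ k * x               ∎)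
    where
    open ≤-Reasoning
    r = x ∸ k
    k≤x : k ≤ x
    k≤x = ≤-trans (m≤n*m k 2) 2k≤x
    k+r≡x : k + r ≡ x
    k+r≡x = m+[n∸m]≡n k≤x
    x≤2r : x ≤ 2 * r
    x≤2r = +-cancelʳ-≤ (2 * k) _ _ (begin
      x + 2 * k           ≤⟨ +-monoʳ-≤ x 2k≤x ⟩
      x + x               ≡⟨ cong (x +_) (+-identityʳ x) ⟨
      2 * x               ≡⟨ cong (2 *_) k+r≡x ⟨
      2 * (k + r)         ≡⟨ ring₃ k r ⟩
      2 * r + 2 * k       ∎)
      where
      ring₃ : ∀ k r → 2 * (k + r) ≡ 2 * r + 2 * k
      ring₃ = solve-∀
    ring : ∀ p r → p * (2 * r) ≡ 2 * (p * r)
    ring = solve-∀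
    ring₂ : ∀ x p → 2 * (x * p) ≡ 2 * p * x
    ring₂ = solve-∀

  ^-distribʳ-* : ∀ k x y → (x * y) ^ k ≡ x ^ k * y ^ k
  ^-distribʳ-* zero    x y = refl
  ^-distribʳ-* (suc k) x y = trans (cong (x * y *_) (^-distribʳ-* k x y)) (ring x y (x ^ k) (y ^ k))
    where
    ring : ∀ x y p q → x * y * (p * q) ≡ x * p * (y * q)
    ring = solve-∀

  -- Two factors 3/2 outweigh one factor 2, since 8 ≤ 9.
  2^e*2^t≤3^t : ∀ e t → 2 * e ≤ t → 2 ^ e * 2 ^ t ≤ 3 ^ t
  2^e*2^t≤3^t e t 2e≤t = begin
    2 ^ e * 2 ^ t                        ≡⟨ cong (λ t → 2 ^ e * 2 ^ t) t≡ ⟩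
    2 ^ e * 2 ^ (2 * e + r)              ≡⟨ cong (2 ^ e *_) (^-distribˡ-+-* 2 (2 * e) r) ⟩
    2 ^ e * (2 ^ (2 * e) * 2 ^ r)        ≡⟨ cong (λ z → 2 ^ e * (z * 2 ^ r)) (^-*-assoc 2 2 e) ⟨
    2 ^ e * (4 ^ e * 2 ^ r)              ≡⟨ *-assoc (2 ^ e) (4 ^ e) (2 ^ r) ⟨
    2 ^ e * 4 ^ e * 2 ^ r                ≡⟨ cong (_* 2 ^ r) (^-distribʳ-* e 2 4) ⟨
    8 ^ e * 2 ^ r
      ≤⟨ *-mono-≤ (^-monoˡ-≤ e (n≤1+n 8)) (^-monoˡ-≤ r (n≤1+n 2)) ⟩
    9 ^ e * 3 ^ r                        ≡⟨ cong (_* 3 ^ r) (^-*-assoc 3 2 e) ⟩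
    3 ^ (2 * e) * 3 ^ r                  ≡⟨ ^-distribˡ-+-* 3 (2 * e) r ⟨
    3 ^ (2 * e + r)                      ≡⟨ cong (3 ^_) t≡ ⟨
    3 ^ t                                ∎
    where
    open ≤-Reasoning
    r = t ∸ 2 * e
    t≡ : t ≡ 2 * e + r
    t≡ = sym (m+[n∸m]≡n 2e≤t)

  -- Ten factors 27/25 outweigh one factor 2, since 1.08^10 is about 2.16.
  2^e*25^t≤27^t : ∀ e t → 10 * e ≤ t → 2 ^ e * 25 ^ t ≤ 27 ^ t
  2^e*25^t≤27^t e t 10e≤t = begin
    2 ^ e * 25 ^ t                       ≡⟨ cong (λ t → 2 ^ e * 25 ^ t) t≡ ⟩
    2 ^ e * 25 ^ (10 * e + r)            ≡⟨ cong (2 ^ e *_) (^-distribˡ-+-* 25 (10 * e) r) ⟩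
    2 ^ e * (25 ^ (10 * e) * 25 ^ r)     ≡⟨ cong (λ z → 2 ^ e * (z * 25 ^ r)) (^-*-assoc 25 10 e) ⟨
    2 ^ e * ((25 ^ 10) ^ e * 25 ^ r)     ≡⟨ *-assoc (2 ^ e) ((25 ^ 10) ^ e) (25 ^ r) ⟨
    2 ^ e * (25 ^ 10) ^ e * 25 ^ r       ≡⟨ cong (_* 25 ^ r) (^-distribʳ-* e 2 (25 ^ 10)) ⟨
    (2 * 25 ^ 10) ^ e * 25 ^ r
      ≤⟨ *-mono-≤ (^-monoˡ-≤ e (≤ᵇ⇒≤ (2 * 25 ^ 10) (27 ^ 10) _)) (^-monoˡ-≤ r (≤ᵇ⇒≤ 25 27 _)) ⟩
    (27 ^ 10) ^ e * 27 ^ r               ≡⟨ cong (_* 27 ^ r) (^-*-assoc 27 10 e) ⟩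
    27 ^ (10 * e) * 27 ^ r               ≡⟨ ^-distribˡ-+-* 27 (10 * e) r ⟨
    27 ^ (10 * e + r)                    ≡⟨ cong (27 ^_) t≡ ⟨
    27 ^ t                               ∎
    where
    open ≤-Reasoning
    r = t ∸ 10 * e
    t≡ : t ≡ 10 * e + r
    t≡ = sym (m+[n∸m]≡n 10e≤t)

  -- Put b = 2c + d. Two elements of B paired with one outside contribute 5² · 4 / (2² · 3³) = 25/27
  -- to the ratio, and each of the d others contributes 5/6 ≤ 25/27. The ratio is thus at most
  -- (25/27)^(c + d), where c + d ≥ b / 2 ≥ 10e.
  majority-tail : ∀ b c e → 2 * c ≤ b → 20 * e ≤ b → 2 ^ e * (5 ^ b * 4 ^ c) ≤ 2 ^ b * 3 ^ (b + c)
  majority-tail b c e 2c≤b 20e≤b = *-cancelʳ-≤ _ _ (25 ^ d) {{m^n≢0 25 d}} (begin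
    2 ^ e * (5 ^ b * 4 ^ c) * 25 ^ d
      ≡⟨ cong (λ z → 2 ^ e * (z * 4 ^ c) * 25 ^ d) (split 5 b d b≡) ⟩
    2 ^ e * (25 ^ c * 5 ^ d * 4 ^ c) * 25 ^ d
      ≡⟨ ring (2 ^ e) (25 ^ c) (5 ^ d) (4 ^ c) (25 ^ d) ⟩
    2 ^ e * (25 ^ c * 25 ^ d) * (5 ^ d * 4 ^ c)
      ≡⟨ cong (λ z → 2 ^ e * z * (5 ^ d * 4 ^ c)) (^-distribˡ-+-* 25 c d) ⟨
    2 ^ e * 25 ^ (c + d) * (5 ^ d * 4 ^ c)
      ≤⟨ *-monoˡ-≤ (5 ^ d * 4 ^ c) (2^e*25^t≤27^t e (c + d) 10e≤) ⟩
    27 ^ (c + d) * (5 ^ d * 4 ^ c)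
      ≡⟨ cong (_* (5 ^ d * 4 ^ c)) (^-distribˡ-+-* 27 c d) ⟩
    27 ^ c * 27 ^ d * (5 ^ d * 4 ^ c)
      ≡⟨ ring₂ (27 ^ c) (27 ^ d) (5 ^ d) (4 ^ c) ⟩
    27 ^ c * 4 ^ c * (27 ^ d * 5 ^ d)
      ≡⟨ cong (27 ^ c * 4 ^ c *_) (^-distribʳ-* d 27 5) ⟨
    27 ^ c * 4 ^ c * 135 ^ d
      ≤⟨ *-monoʳ-≤ (27 ^ c * 4 ^ c) (^-monoˡ-≤ d (≤ᵇ⇒≤ 135 150 _)) ⟩
    27 ^ c * 4 ^ c * 150 ^ d
      ≡⟨ cong (27 ^ c * 4 ^ c *_) (trans (^-distribʳ-* d 6 25) (cong (_* 25 ^ d) (^-distribʳ-* d 2 3))) ⟩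
    27 ^ c * 4 ^ c * (2 ^ d * 3 ^ d * 25 ^ d)
      ≡⟨ cong (λ z → z * 4 ^ c * (2 ^ d * 3 ^ d * 25 ^ d)) (^-distribʳ-* c 9 3) ⟩
    9 ^ c * 3 ^ c * 4 ^ c * (2 ^ d * 3 ^ d * 25 ^ d)
      ≡⟨ ring₃ (9 ^ c) (3 ^ c) (4 ^ c) (2 ^ d) (3 ^ d) (25 ^ d) ⟩
    4 ^ c * 2 ^ d * (9 ^ c * 3 ^ d * 3 ^ c) * 25 ^ d
      ≡⟨ cong (_* 25 ^ d) (cong₂ _*_ (split 2 b d b≡)
           (trans (^-distribˡ-+-* 3 b c) (cong (_* 3 ^ c) (split 3 b d b≡)))) ⟨
    2 ^ b * 3 ^ (b + c) * 25 ^ d ∎)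
    where
    open ≤-Reasoning
    d = b ∸ 2 * c
    b≡ : b ≡ 2 * c + d
    b≡ = sym (m+[n∸m]≡n 2c≤b)
    split : ∀ x b d → b ≡ 2 * c + d → x ^ b ≡ (x * (x * 1)) ^ c * x ^ d
    split x b d refl = trans (^-distribˡ-+-* x (2 * c) d) (cong (_* x ^ d) (sym (^-*-assoc x 2 c)))
    10e≤ : 10 * e ≤ c + d
    10e≤ = *-cancelˡ-≤ 2 (begin
      2 * (10 * e)       ≡⟨ *-assoc 2 10 e ⟨
      20 * e             ≤⟨ 20e≤b ⟩
      b                  ≡⟨ b≡ ⟩
      2 * c + d          ≤⟨ +-monoʳ-≤ (2 * c) (m≤n*m d 2) ⟩
      2 * c + 2 * d      ≡⟨ *-distribˡ-+ 2 c d ⟨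
      2 * (c + d)        ∎)
    ring : ∀ a b c d e → a * (b * c * d) * e ≡ a * (b * e) * (c * d)
    ring = solve-∀
    ring₂ : ∀ a b c d → a * b * (c * d) ≡ a * d * (b * c)
    ring₂ = solve-∀
    ring₃ : ∀ a b c d e f → a * b * c * (d * e * f) ≡ c * d * (a * e * b) * f
    ring₃ = solve-∀

-- The union bound over P, D and Q.

module UnionBound where

  open import Data.Nat.Base using (_+_; _*_; _^_; _≤_; _<_; z≤n; s≤s; >-nonZero; >-nonZero⁻¹; NonZero)
  open import Data.Nat.Properties
  open import Defs using (Graph)
  open Sums
  open Edges
  open Expansion
  open Growth
  open Weights

  bit-dec-*≤ : ∀ {A : Set} (a? : Dec A) {x k} → (A → x ≤ k) → bit (does a?) * x ≤ k
  bit-dec-*≤ (yes a) {x} h = ≤-trans (≤-reflexive (+-identityʳ x)) (h a)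
  bit-dec-*≤ (no _)      _ = z≤n

  bit-dec≤ : ∀ {A : Set} (a? : Dec A) {k} → (A → 1 ≤ k) → bit (does a?) ≤ k
  bit-dec≤ a? h = ≤-trans (≤-reflexive (sym (*-identityʳ (bit (does a?))))) (bit-dec-*≤ a? h)

  module _ {n : ℕ} (G : Graph n) (K M : ℕ) where

    failures : (P D Q : Subset n) → Subset n → ℕ
    failures P D Q V = bit (does (fail? G K M P D Q V))

    count : Subset n → ℕ
    count V = wsum 1 1 λ P → wsum 1 1 λ D → wsum 1 1 λ Q → failures P D Q V

    avoids-failure : ∀ V → count V ≡ 0 → ∀ P D Q → ¬ Fail G K M P D Q V
    avoids-failure V c≡0 P D Q fail = contradiction (begin
      1
        ≤⟨ bit-mono-≤ {true} (λ _ → T-does⁺ (fail? G K M P D Q V) fail) ⟩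
      failures P D Q V                                     ≤⟨ term≤wsum (λ Q → failures P D Q V) Q ⟩
      wsum 1 1 (λ Q → failures P D Q V)
        ≤⟨ term≤wsum (λ D → wsum 1 1 λ Q → failures P D Q V) D ⟩
      wsum 1 1 (λ D → wsum 1 1 λ Q → failures P D Q V)
        ≤⟨ term≤wsum (λ P → wsum 1 1 λ D → wsum 1 1 λ Q → failures P D Q V) P ⟩
      count V                                              ≡⟨ c≡0 ⟩
      0                                                    ∎) λ ()
      where open ≤-Reasoning

    -- First moment: 3ⁿ times the expected number of failing triples, which is at least the weight
    -- of all V with a failing triple.
    bad : ℕ
    bad = wsum 1 2 count

    good+bad : 3 ^ n ≤ wsum 1 2 (λ V → bit (does (count V ≟ 0))) + bad
    good+bad = begin
      3 ^ n
        ≡⟨ trans (wsum-const 1 2 {n} 1) (*-identityʳ (3 ^ n)) ⟨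
      wsum {n} 1 2 (λ _ → 1)                       ≤⟨ wsum-mono-≤ 1 2 one≤ ⟩
      wsum 1 2 (λ V → bit (does (count V ≟ 0)) + count V)
        ≡⟨ wsum-+ 1 2 (λ V → bit (does (count V ≟ 0))) count ⟩
      wsum 1 2 (λ V → bit (does (count V ≟ 0))) + bad ∎
      where
      open ≤-Reasoning
      one≤ : ∀ V → 1 ≤ bit (does (count V ≟ 0)) + count V
      one≤ V with count V
      ... | zero  = s≤s z≤n
      ... | suc _ = s≤s z≤n

    module _ {q S l : ℕ} (M≡ : M ≡ 4 * q) (K≡ : K ≡ 60 * M * l)
      (exp : ExpandsBy q S G) (K≤S : K ≤ S) (10≤q : 10 ≤ q) (1≤l : 1 ≤ l) (n< : n < 2 ^ l) where

      open ≤-Reasoning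

      private
        X : ℕ
        -- As n < 2^l, X exceeds n⁵. This beats the choices for an element of P, D or Q and leaves a
        -- factor above n² to spare.
        X = 2 ^ (5 * l)

        instance
          M≢0 : NonZero M
          M≢0 = >-nonZero (subst (1 ≤_) (sym M≡) (≤-trans (s≤s z≤n) (*-mono-≤ (s≤s (z≤n {3})) 10≤q)))
          X≢0 : NonZero X
          X≢0 = m^n≢0 2 (5 * l)

      -- A triple of total size m - 1 fails with probability at most X^(-m). For B up to 2n/3 this
      -- is the chance of missing all wide vertices, of which there are at least b / M; for larger B
      -- it is Markov's inequality for `tilt`.
      weight≤ : ∀ P D Q →
        wsum 1 2 (failures P D Q) * X ^ suc (∣ P ∣ + ∣ D ∣ + ∣ Q ∣) ≤ 3 ^ n
      weight≤ P D Q = subst (λ y → w * y ≤ 3 ^ n) (sym (^-*-assoc 2 (5 * l) m))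
        (split (K * m ≤? 6 * b) (3 * b ≤? 2 * n) (M * z <? b))
        where
        B = Γ G P ─ D
        b = ∣ B ∣
        z = ∣ fresh G B Q ∣
        T₀ = wide G K B Q
        t = ∣ T₀ ∣
        m = suc (∣ P ∣ + ∣ D ∣ + ∣ Q ∣)
        e = 5 * l * m
        w = wsum 1 2 (failures P D Q)
        impossible : (∀ V → ¬ Fail G K M P D Q V) → w * 2 ^ e ≤ 3 ^ n
        impossible none = begin
          w * 2 ^ e                 ≤⟨ *-monoˡ-≤ (2 ^ e) (wsum-mono-≤ 1 2 λ V →
            bit-dec≤ (fail? G K M P D Q V) {0} λ fail → contradiction fail (none V)) ⟩
          wsum {n} 1 2 (λ _ → 0) * 2 ^ e
            ≡⟨ cong (_* 2 ^ e) (trans (wsum-const 1 2 {n} 0) (*-zeroʳ (3 ^ n))) ⟩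
          0                         ≤⟨ z≤n ⟩
          3 ^ n                     ∎
        split : Dec (K * m ≤ 6 * b) → Dec (3 * b ≤ 2 * n) → Dec (M * z < b) → w * 2 ^ e ≤ 3 ^ n
        split (no C) _ _ = impossible λ V (c , _) → C c
        split (yes C) (yes b≤) (no z≮) = impossible λ where
          V (_ , inj₁ (_ , z< , _)) → z≮ z<
          V (_ , inj₂ (b> , _))     → <⇒≱ b> b≤
        split (yes C) (yes b≤) (yes z<) = *-cancelʳ-≤ _ _ (3 ^ t) {{m^n≢0 3 t}} (begin
          w * 2 ^ e * 3 ^ t
            ≤⟨ *-monoˡ-≤ (3 ^ t) (*-monoˡ-≤ (2 ^ e) (wsum-mono-≤ 1 2 λ V →
            bit-dec≤ (fail? G K M P D Q V) λ where
              (_ , inj₁ (_ , _ , none)) → ≤-reflexive (sym (avoids≡1 T₀ V none))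
              (_ , inj₂ (b> , _))       → contradiction b≤ (<⇒≱ b>))) ⟩
          wsum 1 2 (avoids T₀) * 2 ^ e * 3 ^ t  ≡⟨ ring (wsum 1 2 (avoids T₀)) (2 ^ e) (3 ^ t) ⟩
          2 ^ e * (wsum 1 2 (avoids T₀) * 3 ^ t) ≡⟨ cong (2 ^ e *_) (wsum-avoids T₀) ⟩
          2 ^ e * (2 ^ t * 3 ^ n)               ≡⟨ *-assoc (2 ^ e) (2 ^ t) (3 ^ n) ⟨
          2 ^ e * 2 ^ t * 3 ^ n                 ≤⟨ *-monoˡ-≤ (3 ^ n) (2^e*2^t≤3^t e t 2e≤t) ⟩
          3 ^ t * 3 ^ n                         ≡⟨ *-comm (3 ^ t) (3 ^ n) ⟩
          3 ^ n * 3 ^ t                         ∎)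
          where
          ring : ∀ w x y → w * x * y ≡ x * (w * y)
          ring = solve-∀
          ring₂ : ∀ M l m → 6 * M * (2 * (5 * l * m)) ≡ 60 * M * l * m
          ring₂ = solve-∀
          -- 60 = 6 · 2 · 5: the 6 of `Fail`, the two factors 3/2 needed for each factor 2, and the
          -- 5 in the exponent of X.
          2e≤t : 2 * e ≤ t
          2e≤t = *-cancelˡ-≤ (6 * M) {{m*n≢0 6 M}} (begin
            6 * M * (2 * e)      ≡⟨ ring₂ M l m ⟩
            60 * M * l * m       ≡⟨ cong (_* m) K≡ ⟨
            K * m                ≤⟨ C ⟩
            6 * b                ≤⟨ *-monoʳ-≤ 6 (subst (λ M → b ≤ M * t) (sym M≡)
                                      (wide-large G q S K exp K≤S (≤-trans (s≤s z≤n) 10≤q) B Q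
                                        (≤-trans (s≤s z≤n) z<) b≤ (subst (λ M → M * z < b) M≡ z<))) ⟩
            6 * (M * t)          ≡⟨ *-assoc 6 M t ⟨
            6 * M * t            ∎)
        split (yes C) (no b≰) _ = *-cancelˡ-≤ (2 ^ b) {{m^n≢0 2 b}} (begin
          2 ^ b * (w * 2 ^ e)                ≡⟨ ring (2 ^ b) w (2 ^ e) ⟩
          2 ^ e * (w * 2 ^ b)
            ≡⟨ cong (2 ^ e *_) (wsum-*ʳ 1 2 (failures P D Q) (2 ^ b)) ⟨
          2 ^ e * wsum 1 2 (λ V → failures P D Q V * 2 ^ b)
            ≤⟨ *-monoʳ-≤ (2 ^ e) (wsum-mono-≤ 1 2 markov) ⟩
          2 ^ e * wsum 1 2 (tilt B)          ≡⟨ cong (2 ^ e *_) (wsum-tilt B) ⟩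
          2 ^ e * (5 ^ b * 4 ^ c)            ≤⟨ majority-tail b c e 2c≤b 20e≤b ⟩
          2 ^ b * 3 ^ (b + c)                ≡⟨ cong (λ k → 2 ^ b * 3 ^ k) b+c≡n ⟩
          2 ^ b * 3 ^ n                      ∎)
          where
          c = ∣ ∁ B ∣
          b+c≡n : b + c ≡ n
          b+c≡n = ∣p∣+∣∁p∣≡n B
          ring : ∀ x w y → x * (w * y) ≡ y * (w * x)
          ring = solve-∀
          markov : ∀ V → failures P D Q V * 2 ^ b ≤ tilt B V
          markov V = bit-dec-*≤ (fail? G K M P D Q V) λ where
            (_ , inj₁ (b≤ , _))  → contradiction b≤ b≰
            (_ , inj₂ (_ , few)) → 2^∣B∣≤tilt B V few
          2c≤b : 2 * c ≤ b
          2c≤b = +-cancelˡ-≤ (2 * b) _ _ (begin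
            2 * b + 2 * c     ≡⟨ *-distribˡ-+ 2 b c ⟨
            2 * (b + c)       ≡⟨ cong (2 *_) b+c≡n ⟩
            2 * n             ≤⟨ <⇒≤ (≰⇒> b≰) ⟩
            3 * b             ≡⟨ ring₂ b ⟩
            2 * b + b         ∎)
            where
            ring₂ : ∀ b → 3 * b ≡ 2 * b + b
            ring₂ = solve-∀
          20e≤b : 20 * e ≤ b
          -- Here e is compared with b itself and not with b / M, so M = 4q ≥ 40 makes up for the
          -- slower rate of `majority-tail`.
          20e≤b = *-cancelˡ-≤ 6 (begin
            6 * (20 * e)
              ≤⟨ *-monoʳ-≤ 6 (*-monoˡ-≤ e (≤-trans (m≤m+n 20 60) (*-monoʳ-≤ 8 10≤q))) ⟩
            6 * (8 * q * e)         ≡⟨ ring₂ q l m ⟩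
            60 * (4 * q) * l * m    ≡⟨ cong (λ M → 60 * M * l * m) M≡ ⟨
            60 * M * l * m          ≡⟨ cong (_* m) K≡ ⟨
            K * m                   ≤⟨ C ⟩
            6 * b                   ∎)
            where
            ring₂ : ∀ q l m → 6 * (8 * q * (5 * l * m)) ≡ 60 * (4 * q) * l * m
            ring₂ = solve-∀

      bad≡ : bad ≡ wsum 1 1 λ P → wsum 1 1 λ D → wsum 1 1 λ Q → wsum 1 2 (failures P D Q)
      bad≡ = trans (wsum-swap {n} {n} 1 2 1 1 _) (wsum-cong 1 1 {n} λ P →
             trans (wsum-swap {n} {n} 1 2 1 1 _) (wsum-cong 1 1 {n} λ D →
             wsum-swap 1 2 1 1 (λ V Q → failures P D Q V)))

      -- Multiplication by X^(1 + 3n) replaces division by X^m; the exponents left over are the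
      -- sizes of the complements, which `wsum-power` can sum.
      term≤ : ∀ P D Q → wsum 1 2 (failures P D Q) * X ^ suc (3 * n) ≤
        X ^ ∣ ∁ Q ∣ * X ^ ∣ ∁ D ∣ * X ^ ∣ ∁ P ∣ * 3 ^ n
      term≤ P D Q = begin
        w * X ^ suc (3 * n)                 ≡⟨ cong (λ k → w * X ^ suc k) exponent ⟩
        w * X ^ (suc m + m′)                ≡⟨ cong (w *_) (^-distribˡ-+-* X (suc m) m′) ⟩
        w * (X ^ suc m * X ^ m′)            ≡⟨ *-assoc w (X ^ suc m) (X ^ m′) ⟨
        w * X ^ suc m * X ^ m′              ≤⟨ *-monoˡ-≤ (X ^ m′) (weight≤ P D Q) ⟩
        3 ^ n * X ^ m′                      ≡⟨ *-comm (3 ^ n) (X ^ m′) ⟩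
        X ^ m′ * 3 ^ n
          ≡⟨ cong (_* 3 ^ n) (trans (^-distribˡ-+-* X (∣ ∁ Q ∣ + ∣ ∁ D ∣) (∣ ∁ P ∣))
                                                 (cong (_* X ^ ∣ ∁ P ∣) (^-distribˡ-+-* X (∣ ∁ Q ∣) (∣ ∁ D ∣)))) ⟩
        X ^ ∣ ∁ Q ∣ * X ^ ∣ ∁ D ∣ * X ^ ∣ ∁ P ∣ * 3 ^ n ∎
        where
        w = wsum 1 2 (failures P D Q)
        m = ∣ P ∣ + ∣ D ∣ + ∣ Q ∣
        m′ = ∣ ∁ Q ∣ + ∣ ∁ D ∣ + ∣ ∁ P ∣
        ring : ∀ p d q p′ d′ q′ → p + p′ + (d + d′) + (q + q′) ≡ p + d + q + (q′ + d′ + p′)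
        ring = solve-∀
        ring₂ : ∀ n → 3 * n ≡ n + n + n
        ring₂ = solve-∀
        exponent : 3 * n ≡ m + m′
        exponent = begin-equality
          3 * n        ≡⟨ ring₂ n ⟩
          n + n + n    ≡⟨ cong₂ _+_ (cong₂ _+_ (∣p∣+∣∁p∣≡n P) (∣p∣+∣∁p∣≡n D)) (∣p∣+∣∁p∣≡n Q) ⟨
          _            ≡⟨ ring (∣ P ∣) (∣ D ∣) (∣ Q ∣) (∣ ∁ P ∣) (∣ ∁ D ∣) (∣ ∁ Q ∣) ⟩
          m + m′       ∎

      -- After division by X^(1 + 3n), the sum of X^(-1 - ∣ P ∣ - ∣ D ∣ - ∣ Q ∣) over all triples
      -- factors as X^(-1) (1 + 1/X)^(3n).
      bad*X^≤ : bad * X ^ suc (3 * n) ≤ suc X ^ n * suc X ^ n * suc X ^ n * 3 ^ n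
      bad*X^≤ = begin
        bad * Y
          ≡⟨ cong (_* Y) bad≡ ⟩
        wsum 1 1 (λ P → wsum 1 1 λ D → wsum 1 1 λ Q → wsum 1 2 (failures P D Q)) * Y
          ≡⟨ wsum-*ʳ 1 1 {n} _ Y ⟨
        wsum 1 1 (λ P → wsum 1 1 (λ D → wsum 1 1 λ Q → wsum 1 2 (failures P D Q)) * Y)
          ≡⟨ wsum-cong 1 1 {n} (λ P → sym (wsum-*ʳ 1 1 {n} _ Y)) ⟩
        wsum 1 1 (λ P → wsum 1 1 λ D → wsum 1 1 (λ Q → wsum 1 2 (failures P D Q)) * Y)
          ≡⟨ wsum-cong 1 1 (λ P → wsum-cong 1 1 λ D → sym (wsum-*ʳ 1 1 (λ Q → wsum 1 2 (failures P D Q)) Y)) ⟩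
        wsum 1 1 (λ P → wsum 1 1 λ D → wsum 1 1 λ Q → wsum 1 2 (failures P D Q) * Y)
          ≤⟨ wsum-mono-≤ 1 1 (λ P → wsum-mono-≤ 1 1 λ D → wsum-mono-≤ 1 1 λ Q → term≤ P D Q) ⟩
        wsum 1 1 (λ P → wsum 1 1 λ D → wsum 1 1 λ Q → x Q * x D * x P * 3 ^ n)
          ≡⟨ wsum-cong 1 1 (λ P → wsum-cong 1 1 λ D → pull (x D) (x P)) ⟩
        wsum 1 1 (λ P → wsum 1 1 λ D → y * x D * x P * 3 ^ n)
          ≡⟨ wsum-cong 1 1 (λ P → trans (wsum-*ʳ 1 1 (λ D → y * x D * x P) (3 ^ n)) (cong (_* 3 ^ n)
               (trans (wsum-*ʳ 1 1 (λ D → y * x D) (x P)) (cong (_* x P)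
                 (trans (wsum-*ˡ 1 1 y x) (cong (y *_) (wsum-power {n} X))))))) ⟩
        wsum 1 1 (λ P → y * y * x P * 3 ^ n)
          ≡⟨ trans (wsum-*ʳ 1 1 (λ P → y * y * x P) (3 ^ n)) (cong (_* 3 ^ n)
               (trans (wsum-*ˡ 1 1 (y * y) x) (cong (y * y *_) (wsum-power {n} X)))) ⟩
        y * y * y * 3 ^ n ∎
        where
        Y = X ^ suc (3 * n)
        y = suc X ^ n
        x : Subset n → ℕ
        x P = X ^ ∣ ∁ P ∣
        pull : ∀ c d → wsum 1 1 (λ Q → x Q * c * d * 3 ^ n) ≡ y * c * d * 3 ^ n
        pull c d = trans (wsum-*ʳ 1 1 (λ Q → x Q * c * d) (3 ^ n)) (cong (_* 3 ^ n)
          (trans (wsum-*ʳ 1 1 (λ Q → x Q * c) d) (cong (_* d)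
            (trans (wsum-*ʳ 1 1 x c) (cong (_* c) (wsum-power {n} X))))))

      6n≤X : 2 * (3 * n) ≤ X
      6n≤X = begin
        2 * (3 * n)          ≡⟨ *-assoc 2 3 n ⟨
        6 * n                ≤⟨ *-mono-≤ (m≤m+n 6 2) (<⇒≤ n<) ⟩
        2 ^ 3 * 2 ^ l        ≡⟨ ^-distribˡ-+-* 2 3 l ⟨
        2 ^ (3 + l)          ≤⟨ ^-monoʳ-≤ 2 (begin
          3 + l                ≡⟨ +-comm 3 l ⟩
          l + 3                ≤⟨ +-monoʳ-≤ l (≤-trans (m≤m+n 3 1) (*-monoʳ-≤ 4 1≤l)) ⟩
          5 * l                ∎) ⟩
        X                    ∎

      bad*X≤ : bad * X ≤ 2 * 3 ^ n
      bad*X≤ = *-cancelʳ-≤ _ _ (X ^ (3 * n)) {{m^n≢0 X (3 * n)}} (begin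
        bad * X * X ^ (3 * n)          ≡⟨ *-assoc bad X _ ⟩
        bad * X ^ suc (3 * n)          ≤⟨ bad*X^≤ ⟩
        y * y * y * 3 ^ n
          ≡⟨ cong (_* 3 ^ n) (trans (ring y) (trans (^-*-assoc (suc X) n 3) (cong (suc X ^_) (*-comm n 3)))) ⟩
        suc X ^ (3 * n) * 3 ^ n
          ≤⟨ *-monoˡ-≤ (3 ^ n) (suc-^≤ (3 * n) X (>-nonZero⁻¹ X) 6n≤X) ⟩
        2 * X ^ (3 * n) * 3 ^ n        ≡⟨ ring₂ (X ^ (3 * n)) (3 ^ n) ⟩
        2 * 3 ^ n * X ^ (3 * n)        ∎)
        where
        y = suc X ^ n
        ring : ∀ y → y * y * y ≡ y * (y * (y * 1))
        ring = solve-∀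
        ring₂ : ∀ x t → 2 * x * t ≡ 2 * t * x
        ring₂ = solve-∀

      -- The failure probability is at most 2 / X, and 2 (n + 1)² ≤ 2^(1 + 2l) ≤ X. The square is
      -- what sends n δ(n) to 0.
      bad-rare : bad * (suc n * suc n) ≤ 3 ^ n
      bad-rare = *-cancelˡ-≤ 2 (begin
        2 * (bad * (suc n * suc n))     ≡⟨ ring bad (suc n * suc n) ⟩
        bad * (2 * (suc n * suc n))     ≤⟨ *-monoʳ-≤ bad (begin
          2 * (suc n * suc n)             ≤⟨ *-monoʳ-≤ 2 (*-mono-≤ n< n<) ⟩
          2 * (2 ^ l * 2 ^ l)             ≡⟨ cong (2 *_) (^-distribˡ-+-* 2 l l) ⟨
          2 ^ suc (l + l)                 ≤⟨ ^-monoʳ-≤ 2 (≤-trans (+-monoˡ-≤ (l + l) 1≤l)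
                                               (≤-trans (m≤m+n (l + (l + l)) (2 * l)) (≤-reflexive (ring₂ l)))) ⟩
          X                               ∎) ⟩
        bad * X                         ≤⟨ bad*X≤ ⟩
        2 * 3 ^ n                       ∎)
        where
        ring : ∀ b s → 2 * (b * s) ≡ b * (2 * s)
        ring = solve-∀
        ring₂ : ∀ l → l + (l + l) + 2 * l ≡ 5 * l
        ring₂ = solve-∀

-- Choice of the constants.

module Constants where

  open import Data.Nat.Base using (_+_; _*_; _^_; _≤_; >-nonZero; >-nonZero⁻¹; NonZero)
  open import Data.Nat.Properties
  -- The binding demand is `short`: its 8193 l³ is at most 65544 L³, since l ≤ 2L, and this has to
  -- be below L⁴. The value is the first power of two above 65544.
  threshold : ℕ
  threshold = 131072

  -- L = ⌊log₂ n⌋ bounds log n from below and l = L + 1 from above. The `suc` in `K<` and the 2 in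
  -- the premise of `sparse` leave room for the slack of the real inequalities.
  record Constants (L l : ℕ) : Set where
    field
      q M K  : ℕ
      q≡     : q ≡ l * l * 1024
      M≡     : M ≡ 4 * q
      K≡     : K ≡ 60 * M * l
      10≤q   : 10 ≤ q
      2M≤K   : 2 * M ≤ K
      K<     : suc K ≤ 2 * L ^ 24
      sparse : ∀ f u → f * L ^ 27 ≤ 2 * u → 3 * M * (K * (2 * f) + 2 * f) ≤ u
      short  : l * (2 * M) + 1 ≤ L ^ 4

  constants : ∀ L l → l ≡ suc L → threshold ≤ L → Constants L l
  constants L l l≡ Λ≤L = build (l * l * 1024) _ _ refl refl refl
    where
    open ≤-Reasoning
    build : ∀ q M K → q ≡ l * l * 1024 → M ≡ 4 * q → K ≡ 60 * M * l → Constants L l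
    build q M K q≡ M≡ K≡ = record
      { q      = q
      ; M      = M
      ; K      = K
      ; q≡     = q≡
      ; M≡     = M≡
      ; K≡     = K≡
      ; 10≤q   = subst (10 ≤_) (sym q≡) (≤-trans (≤ᵇ⇒≤ 10 1024 _) (m≤n*m 1024 (l * l) {{m*n≢0 l l}}))
      ; 2M≤K   = begin
          2 * M            ≤⟨ *-monoˡ-≤ M (≤ᵇ⇒≤ 2 60 _) ⟩
          60 * M           ≤⟨ m≤m*n (60 * M) l ⟩
          60 * M * l       ≡⟨ K≡ ⟨
          K                ∎
      ; K<     = ≤-trans sucK≤ (≤-trans (^-monoʳ-≤ L (≤ᵇ⇒≤ 10 24 _)) (m≤n*m (L ^ 24) 2))
      ; sparse = sparse
      ; short  = short
      }
      where
      instance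
        l≢0 : NonZero l
        l≢0 = subst NonZero (sym l≡) _
      const≤L : ∀ {c} → c ≤ threshold → c ≤ L
      const≤L c≤ = ≤-trans c≤ Λ≤L
      instance
        L≢0 : NonZero L
        L≢0 = >-nonZero (const≤L (≤ᵇ⇒≤ 1 threshold _))
      l≤2L : l ≤ L * 2
      l≤2L = begin
        l            ≡⟨ l≡ ⟩
        1 + L        ≤⟨ +-monoˡ-≤ L (const≤L (≤ᵇ⇒≤ 1 threshold _)) ⟩
        L + L        ≡⟨ trans (cong (L +_) (sym (+-identityʳ L))) (*-comm 2 L) ⟩
        L * 2        ∎
      l≤L² : l ≤ L ^ 2
      l≤L² = ≤-trans l≤2L (*-monoʳ-≤ L (≤-trans (const≤L (≤ᵇ⇒≤ 2 threshold _)) (≤-reflexive (sym (*-identityʳ L)))))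
      q≤ : q ≤ L ^ 5
      q≤ = begin
        q                       ≡⟨ q≡ ⟩
        l * l * 1024            ≤⟨ *-mono-≤ (*-mono-≤ l≤L² l≤L²) (const≤L (≤ᵇ⇒≤ 1024 threshold _)) ⟩
        L ^ 2 * L ^ 2 * L       ≡⟨ ring L ⟩
        L ^ 5                   ∎
        where
        ring : ∀ L → L * (L * 1) * (L * (L * 1)) * L ≡ L * (L * (L * (L * (L * 1))))
        ring = solve-∀
      M≤ : M ≤ L ^ 6
      M≤ = subst (_≤ L ^ 6) (sym M≡) (*-mono-≤ (const≤L (≤ᵇ⇒≤ 4 threshold _)) q≤)
      sucK≤ : suc K ≤ L ^ 10
      sucK≤ = begin
        1 + K                     ≤⟨ +-mono-≤ (m^n>0 L 9) (subst (_≤ L ^ 9) (sym K≡) K≤) ⟩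
        L ^ 9 + L ^ 9             ≡⟨ cong (L ^ 9 +_) (+-identityʳ (L ^ 9)) ⟨
        2 * L ^ 9                 ≤⟨ *-monoˡ-≤ (L ^ 9) (const≤L (≤ᵇ⇒≤ 2 threshold _)) ⟩
        L ^ 10                    ∎
        where
        K≤ : 60 * M * l ≤ L ^ 9
        K≤ = begin
          60 * M * l              ≤⟨ *-mono-≤ (*-mono-≤ (const≤L (≤ᵇ⇒≤ 60 threshold _)) M≤) l≤L² ⟩
          L ^ 7 * L ^ 2           ≡⟨ ^-distribˡ-+-* L 7 2 ⟨
          L ^ 9                   ∎
      sparse : ∀ f u → f * L ^ 27 ≤ 2 * u → 3 * M * (K * (2 * f) + 2 * f) ≤ u
      sparse f u le = *-cancelˡ-≤ 2 (begin
        2 * (3 * M * (K * (2 * f) + 2 * f))     ≡⟨ ring f M K ⟩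
        f * (12 * M * suc K)                    ≤⟨ *-monoʳ-≤ f (begin
          12 * M * suc K
            ≤⟨ *-mono-≤ (*-mono-≤ (const≤L (≤ᵇ⇒≤ 12 threshold _)) M≤) sucK≤ ⟩
          L ^ 7 * L ^ 10                          ≡⟨ ^-distribˡ-+-* L 7 10 ⟨
          L ^ 17                                  ≤⟨ ^-monoʳ-≤ L (≤ᵇ⇒≤ 17 27 _) ⟩
          L ^ 27                                  ∎) ⟩
        f * L ^ 27                              ≤⟨ le ⟩
        2 * u                                   ∎)
        where
        ring : ∀ f M K → 2 * (3 * M * (K * (2 * f) + 2 * f)) ≡ f * (12 * M * (1 + K))
        ring = solve-∀
      short : l * (2 * M) + 1 ≤ L ^ 4
      short = begin
        l * (2 * M) + 1
          ≡⟨ cong (λ M → l * (2 * M) + 1) (trans M≡ (cong (4 *_) q≡)) ⟩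
        l * (2 * (4 * (l * l * 1024))) + 1       ≡⟨ cong (_+ 1) (ring l 1024) ⟩
        l * l * l * 8192 + 1
          ≤⟨ +-monoʳ-≤ (l * l * l * 8192) (>-nonZero⁻¹ (l * l * l) {{m*n≢0 (l * l) l {{m*n≢0 l l}}}}) ⟩
        l * l * l * 8192 + l * l * l             ≡⟨ ring₂ (l * l * l) 8192 ⟩
        l * l * l * 8193
          ≤⟨ *-monoˡ-≤ 8193 (*-mono-≤ (*-mono-≤ l≤2L l≤2L) l≤2L) ⟩
        L * 2 * (L * 2) * (L * 2) * 8193         ≡⟨ ring₃ L 8193 ⟩
        L * L * L * 65544
          ≤⟨ *-monoʳ-≤ (L * L * L) (const≤L (≤ᵇ⇒≤ 65544 threshold _)) ⟩
        L * L * L * L                            ≡⟨ ring₄ L ⟩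
        L ^ 4                                    ∎
        where
        ring : ∀ l c → l * (2 * (4 * (l * l * c))) ≡ l * l * l * (8 * c)
        ring = solve-∀
        ring₂ : ∀ x c → x * c + x ≡ x * (1 + c)
        ring₂ = solve-∀
        ring₃ : ∀ L c → L * 2 * (L * 2) * (L * 2) * c ≡ L * L * L * (8 * c)
        ring₃ = solve-∀
        ring₄ : ∀ L → L * L * L * L ≡ L * (L * (L * (L * 1)))
        ring₄ = solve-∀

  log-unbounded : ∀ Λ → ∃[ N ] ∀ n → N ≤ n → Λ ≤ ⌊log₂ n ⌋
  log-unbounded Λ = 2 ^ Λ , λ n N≤n → subst (_≤ ⌊log₂ n ⌋) (⌊log₂[2^n]⌋≡n Λ) (⌊log₂⌋-mono-≤ N≤n)

open import Data.Integer.Base as ℤ using (+_)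
import Data.Integer.Properties as ℤ
open import Data.Rational.Base as ℚ using (ℚ; mkℚ; 0ℚ; 1ℚ; _/_; toℚᵘ)
import Data.Rational.Properties as ℚ
open import Data.Rational.Solver using (module +-*-Solver)
import Data.Rational.Unnormalised.Base as ℚᵘ
import Data.Rational.Unnormalised.Properties as ℚᵘ

-- Rational arithmetic with natural numerators.

module Rationals where

  frac-mono-≤ : ∀ a b j k → a ℕ.* suc k ℕ.≤ b ℕ.* suc j → + a / suc j ℚ.≤ + b / suc k
  frac-mono-≤ a b j k le = ℚ.toℚᵘ-cancel-≤ (begin
    toℚᵘ (+ a / suc j)       ≃⟨ ℚ.toℚᵘ-fromℚᵘ (ℚᵘ.mkℚᵘ (+ a) j) ⟩
    ℚᵘ.mkℚᵘ (+ a) j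
      ≤⟨ ℚᵘ.*≤* (subst₂ ℤ._≤_ (ℤ.pos-* a (suc k)) (ℤ.pos-* b (suc j)) (ℤ.+≤+ le)) ⟩
    ℚᵘ.mkℚᵘ (+ b) k          ≃⟨ ℚ.toℚᵘ-fromℚᵘ (ℚᵘ.mkℚᵘ (+ b) k) ⟨
    toℚᵘ (+ b / suc k)       ∎)
    where open ℚᵘ.≤-Reasoning

  frac-cancel-≤ : ∀ a b j k → + a / suc j ℚ.≤ + b / suc k → a ℕ.* suc k ℕ.≤ b ℕ.* suc j
  frac-cancel-≤ a b j k le = ℤ.drop‿+≤+ (subst₂ ℤ._≤_ (sym (ℤ.pos-* a (suc k))) (sym (ℤ.pos-* b (suc j)))
    (ℚᵘ.drop-*≤* (begin
      ℚᵘ.mkℚᵘ (+ a) j          ≃⟨ ℚ.toℚᵘ-fromℚᵘ (ℚᵘ.mkℚᵘ (+ a) j) ⟨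
      toℚᵘ (+ a / suc j)       ≤⟨ ℚ.toℚᵘ-mono-≤ le ⟩
      toℚᵘ (+ b / suc k)       ≃⟨ ℚ.toℚᵘ-fromℚᵘ (ℚᵘ.mkℚᵘ (+ b) k) ⟩
      ℚᵘ.mkℚᵘ (+ b) k          ∎)))
    where open ℚᵘ.≤-Reasoning

  frac-* : ∀ a b k → + (a ℕ.* b) / suc k ≡ + a / 1 ℚ.* (+ b / suc k)
  frac-* a b k = ℚ.toℚᵘ-injective (begin-equality
    toℚᵘ (+ (a ℕ.* b) / suc k)
      ≃⟨ ℚ.toℚᵘ-fromℚᵘ (ℚᵘ.mkℚᵘ (+ (a ℕ.* b)) k) ⟩
    ℚᵘ.mkℚᵘ (+ (a ℕ.* b)) k
      ≃⟨ ℚᵘ.*≡* (cong₂ ℤ._*_ (ℤ.pos-* a b) (cong (+_ ∘ suc) (ℕ.+-identityʳ k))) ⟩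
    ℚᵘ.mkℚᵘ (+ a) 0 ℚᵘ.* ℚᵘ.mkℚᵘ (+ b) k
      ≃⟨ ℚᵘ.*-cong (ℚ.toℚᵘ-fromℚᵘ (ℚᵘ.mkℚᵘ (+ a) 0)) (ℚ.toℚᵘ-fromℚᵘ (ℚᵘ.mkℚᵘ (+ b) k)) ⟨
    toℚᵘ (+ a / 1) ℚᵘ.* toℚᵘ (+ b / suc k)
      ≃⟨ ℚ.toℚᵘ-homo-* (+ a / 1) (+ b / suc k) ⟨
    toℚᵘ (+ a / 1 ℚ.* (+ b / suc k)) ∎)
    where open ℚᵘ.≤-Reasoning

  ι : ℕ → ℚ
  ι a = + a / 1

  ι-* : ∀ a b → ι (a ℕ.* b) ≡ ι a ℚ.* ι b
  ι-* a b = frac-* a b 0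

  ι-+ : ∀ a b → ι (a ℕ.+ b) ≡ ι a ℚ.+ ι b
  ι-+ a b = ℚ.toℚᵘ-injective (begin-equality
    toℚᵘ (ι (a ℕ.+ b))
      ≃⟨ ℚ.toℚᵘ-fromℚᵘ (ℚᵘ.mkℚᵘ (+ (a ℕ.+ b)) 0) ⟩
    ℚᵘ.mkℚᵘ (+ (a ℕ.+ b)) 0
      ≃⟨ ℚᵘ.*≡* (cong (ℤ._* + 1) (trans (ℤ.pos-+ a b) (sym (cong₂ ℤ._+_ (ℤ.*-identityʳ (+ a)) (ℤ.*-identityʳ (+ b)))))) ⟩
    ℚᵘ.mkℚᵘ (+ a) 0 ℚᵘ.+ ℚᵘ.mkℚᵘ (+ b) 0
      ≃⟨ ℚᵘ.+-cong (ℚ.toℚᵘ-fromℚᵘ (ℚᵘ.mkℚᵘ (+ a) 0)) (ℚ.toℚᵘ-fromℚᵘ (ℚᵘ.mkℚᵘ (+ b) 0)) ⟨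
    toℚᵘ (ι a) ℚᵘ.+ toℚᵘ (ι b)
      ≃⟨ ℚ.toℚᵘ-homo-+ (ι a) (ι b) ⟨
    toℚᵘ (ι a ℚ.+ ι b) ∎)
    where open ℚᵘ.≤-Reasoning

  ι-mono-≤ : ∀ a b → a ℕ.≤ b → ι a ℚ.≤ ι b
  ι-mono-≤ a b le = frac-mono-≤ a b 0 0 (ℕ.*-monoˡ-≤ 1 le)

  ι-cancel-≤ : ∀ a b → ι a ℚ.≤ ι b → a ℕ.≤ b
  ι-cancel-≤ a b le = ℕ.*-cancelʳ-≤ a b 1 (frac-cancel-≤ a b 0 0 le)

  0≤frac : ∀ a k → 0ℚ ℚ.≤ + a / suc k
  0≤frac a k = frac-mono-≤ 0 a 0 k ℕ.z≤n

  0≤ι : ∀ a → 0ℚ ℚ.≤ ι a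
  0≤ι a = 0≤frac a 0

  half<⇒frac< : ∀ {a b} → a ℕ.< 2 ℕ.* b → + a / 2 ℚ.< ι b
  half<⇒frac< {a} {b} lt = ℚ.≰⇒> λ le → ℕ.<⇒≱ lt (begin
    2 ℕ.* b      ≡⟨ ℕ.*-comm 2 b ⟩
    b ℕ.* 2      ≤⟨ frac-cancel-≤ b a 0 1 le ⟩
    a ℕ.* 1      ≡⟨ ℕ.*-identityʳ a ⟩
    a            ∎)
    where open ℕ.≤-Reasoning

  *-mono-≤-nonNeg : ∀ {a b c d} → 0ℚ ℚ.≤ c → 0ℚ ℚ.≤ b → a ℚ.≤ b → c ℚ.≤ d → a ℚ.* c ℚ.≤ b ℚ.* d
  *-mono-≤-nonNeg {a} {b} {c} {d} 0≤c 0≤b a≤b c≤d = ℚ.≤-trans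
    (ℚ.*-monoʳ-≤-nonNeg c {{ℚ.nonNegative 0≤c}} a≤b)
    (ℚ.*-monoˡ-≤-nonNeg b {{ℚ.nonNegative 0≤b}} c≤d)

  0≤* : ∀ {a b} → 0ℚ ℚ.≤ a → 0ℚ ℚ.≤ b → 0ℚ ℚ.≤ a ℚ.* b
  0≤* {a} {b} 0≤a 0≤b = subst (ℚ._≤ a ℚ.* b) (ℚ.*-zeroˡ 0ℚ) (*-mono-≤-nonNeg ℚ.≤-refl 0≤a 0≤a 0≤b)

  ≤+pos : ∀ {a b η} → 0ℚ ℚ.< η → a ℚ.≤ b → a ℚ.≤ b ℚ.+ η
  ≤+pos {a} {b} {η} 0<η a≤b = ℚ.≤-trans a≤b
    (subst (ℚ._≤ b ℚ.+ η) (ℚ.+-identityʳ b) (ℚ.+-monoʳ-≤ b (ℚ.<⇒≤ 0<η)))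

  archimedean : ∀ η → 0ℚ ℚ.< η → ∃[ d ] + 1 / suc d ℚ.≤ η
  archimedean η@(mkℚ (+ zero)     d _) 0<η = contradiction 0<η λ where (ℚ.*<* (ℤ.+<+ ()))
  archimedean η@(mkℚ (+ (suc p))  d _) 0<η = d , subst (+ 1 / suc d ℚ.≤_) (ℚ.↥p/↧p≡p η)
    (frac-mono-≤ 1 (suc p) d d (ℕ.*-monoˡ-≤ (suc d) (ℕ.s≤s (ℕ.z≤n {p}))))
  archimedean η@(mkℚ (ℤ.-[1+ _ ]) d _) 0<η = contradiction 0<η λ where (ℚ.*<* ())

-- From reals and probabilities to natural numbers.

module Reals where

  open import Defs using (ℝ; seq; fromℚ; fromℕʳ; log₂; log-seq; ℙ; Expander; Graph; _∖_; Nbr; ∣_∣ᴱ;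
    2^⌊log₂n⌋≤n; n<2^[1+⌊log₂n⌋])
    renaming (_≤_ to _≤ʳ_; _*_ to _*ʳ_; _^_ to _^ʳ_)
  open Rationals
  open Expansion using (ExpandsBy)
  open Sums using (bit)
  open Weights using (wsum)

  pointwise : ∀ {x y : ℝ} → (∀ k → seq x k ℚ.≤ seq y k) → x ≤ʳ y
  pointwise h η 0<η = 0 , λ k _ → ≤+pos 0<η (h k)

  ^ʳ-lower : ∀ {x : ℝ} {a} j k → ι a ℚ.≤ seq x j → ι (a ℕ.^ k) ℚ.≤ seq (x ^ʳ k) j
  ^ʳ-lower         j zero    a≤ = ℚ.≤-refl
  ^ʳ-lower {x} {a} j (suc k) a≤ = subst (ℚ._≤ seq (x ^ʳ suc k) j) (sym (ι-* a (a ℕ.^ k)))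
    (*-mono-≤-nonNeg (0≤ι (a ℕ.^ k)) (ℚ.≤-trans (0≤ι a) a≤) a≤ (^ʳ-lower {x} {a} j k a≤))

  0≤^ʳ : ∀ {x : ℝ} j k → 0ℚ ℚ.≤ seq x j → 0ℚ ℚ.≤ seq (x ^ʳ k) j
  0≤^ʳ     j zero    0≤ = 0≤ι 1
  0≤^ʳ {x} j (suc k) 0≤ = 0≤* 0≤ (0≤^ʳ {x} j k 0≤)

  ^ʳ-upper : ∀ {x : ℝ} {b} j k → 0ℚ ℚ.≤ seq x j → seq x j ℚ.≤ ι b → seq (x ^ʳ k) j ℚ.≤ ι (b ℕ.^ k)
  ^ʳ-upper         j zero    0≤ ≤b = ℚ.≤-refl
  ^ʳ-upper {x} {b} j (suc k) 0≤ ≤b = subst (seq (x ^ʳ suc k) j ℚ.≤_) (sym (ι-* b (b ℕ.^ k)))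
    (*-mono-≤-nonNeg (0≤^ʳ {x} j k 0≤) (0≤ι b) ≤b (^ʳ-upper {x} {b} j k 0≤ ≤b))

  -- Valid at every index of the Cauchy sequence, like `log-upper`, so inequalities between powers
  -- of log n can be checked termwise.
  log-lower : ∀ n .{{_ : ℕ.NonZero n}} j → ι ⌊log₂ n ⌋ ℚ.≤ log-seq n j
  log-lower n j = frac-mono-≤ L ⌊log₂ n ℕ.^ suc j ⌋ 0 j (begin
    L ℕ.* suc j                                  ≡⟨ ⌊log₂[2^n]⌋≡n (L ℕ.* suc j) ⟨
    ⌊log₂ 2 ℕ.^ (L ℕ.* suc j) ⌋                  ≡⟨ cong ⌊log₂_⌋ (ℕ.^-*-assoc 2 L (suc j)) ⟨
    ⌊log₂ (2 ℕ.^ L) ℕ.^ suc j ⌋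
      ≤⟨ ⌊log₂⌋-mono-≤ (ℕ.^-monoˡ-≤ (suc j) (2^⌊log₂n⌋≤n n)) ⟩
    ⌊log₂ n ℕ.^ suc j ⌋                          ≡⟨ ℕ.*-identityʳ _ ⟨
    ⌊log₂ n ℕ.^ suc j ⌋ ℕ.* 1                    ∎)
    where
    open ℕ.≤-Reasoning
    L = ⌊log₂ n ⌋

  log-upper : ∀ n j → log-seq n j ℚ.≤ ι (suc ⌊log₂ n ⌋)
  log-upper n j = frac-mono-≤ ⌊log₂ n ℕ.^ suc j ⌋ l j 0 (begin
    ⌊log₂ n ℕ.^ suc j ⌋ ℕ.* 1                    ≡⟨ ℕ.*-identityʳ _ ⟩
    ⌊log₂ n ℕ.^ suc j ⌋
      ≤⟨ ⌊log₂⌋-mono-≤ (ℕ.^-monoˡ-≤ (suc j) (ℕ.<⇒≤ (n<2^[1+⌊log₂n⌋] n))) ⟩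
    ⌊log₂ (2 ℕ.^ l) ℕ.^ suc j ⌋                  ≡⟨ cong ⌊log₂_⌋ (ℕ.^-*-assoc 2 l (suc j)) ⟩
    ⌊log₂ 2 ℕ.^ (l ℕ.* suc j) ⌋                  ≡⟨ ⌊log₂[2^n]⌋≡n (l ℕ.* suc j) ⟩
    l ℕ.* suc j                                  ∎)
    where
    open ℕ.≤-Reasoning
    l = suc ⌊log₂ n ⌋

  0≤log : ∀ n j → 0ℚ ℚ.≤ log-seq n j
  0≤log n j = 0≤frac ⌊log₂ n ℕ.^ suc j ⌋ j

  -- Multiplied by 2048 the premise reads 4u ≤ 2048 m l² + 1 + u, and 1 + u ≤ 2u. This is the origin
  -- of 1024 in q.
  absorb-slack : ∀ u m l → 1 ℕ.≤ u →
    + 1 / 512 ℚ.* ι u ℚ.≤ ι m ℚ.* ι (l ℕ.^ 2) ℚ.+ + 1 / 2048 ℚ.+ + 1 / 2048 ℚ.* ι u →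
    u ℕ.≤ l ℕ.* l ℕ.* 1024 ℕ.* m
  absorb-slack u m l 1≤u scaled =
    ℕ.*-cancelˡ-≤ 2 (ℕ.+-cancelʳ-≤ (1 ℕ.+ u) _ _ (begin
      2 ℕ.* u ℕ.+ (1 ℕ.+ u)              ≤⟨ ℕ.+-monoʳ-≤ (2 ℕ.* u) (ℕ.+-monoˡ-≤ u 1≤u) ⟩
      2 ℕ.* u ℕ.+ (u ℕ.+ u)              ≡⟨ ring u ⟩
      4 ℕ.* u
        ≤⟨ ι-cancel-≤ (4 ℕ.* u) (m ℕ.* l ℕ.^ 2 ℕ.* 2048 ℕ.+ (1 ℕ.+ u)) real ⟩
      m ℕ.* l ℕ.^ 2 ℕ.* 2048 ℕ.+ (1 ℕ.+ u)  ≡⟨ cong (ℕ._+ (1 ℕ.+ u)) (ring₂ m l 1024) ⟩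
      2 ℕ.* (l ℕ.* l ℕ.* 1024 ℕ.* m) ℕ.+ (1 ℕ.+ u) ∎))
    where
    open ℕ.≤-Reasoning
    h = + 1 / 2048
    ring : ∀ u → 2 ℕ.* u ℕ.+ (u ℕ.+ u) ≡ 4 ℕ.* u
    ring = solve-∀
    ring₂ : ∀ m l c → m ℕ.* (l ℕ.* (l ℕ.* 1)) ℕ.* (2 ℕ.* c) ≡ 2 ℕ.* (l ℕ.* l ℕ.* c ℕ.* m)
    ring₂ = solve-∀
    real : ι (4 ℕ.* u) ℚ.≤ ι (m ℕ.* l ℕ.^ 2 ℕ.* 2048 ℕ.+ (1 ℕ.+ u))
    real = subst₂ ℚ._≤_ left right (ℚ.*-monoʳ-≤-nonNeg (ι 2048) scaled)
      where
      open +-*-Solver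
      left : + 1 / 512 ℚ.* ι u ℚ.* ι 2048 ≡ ι (4 ℕ.* u)
      left = trans (solve 3 (λ a b c → a :* b :* c := (a :* c) :* b) refl (+ 1 / 512) (ι u) (ι 2048))
                   (sym (ι-* 4 u))
      right : (ι m ℚ.* ι (l ℕ.^ 2) ℚ.+ h ℚ.+ h ℚ.* ι u) ℚ.* ι 2048 ≡ ι (m ℕ.* l ℕ.^ 2 ℕ.* 2048 ℕ.+ (1 ℕ.+ u))
      right = trans (solve 4 (λ a h u c → (a :+ h :+ h :* u) :* c := a :* c :+ (h :* c :+ (h :* c) :* u)) refl
                      (ι m ℚ.* ι (l ℕ.^ 2)) h (ι u) (ι 2048))
              (sym (trans (ι-+ (m ℕ.* l ℕ.^ 2 ℕ.* 2048) (1 ℕ.+ u)) (cong₂ ℚ._+_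
                (trans (ι-* (m ℕ.* l ℕ.^ 2) 2048) (cong (ℚ._* ι 2048) (ι-* m (l ℕ.^ 2))))
                (trans (ι-+ 1 u) (cong (ι 1 ℚ.+_) (sym (ℚ.*-identityˡ (ι u))))))))

  -- The reals only give each inequality up to η; the strict bound on S, and
  -- 1024 in place of 512, absorb this.
  expander⇒ExpandsBy : ∀ {n} (G : Graph n) (ε s : ℝ) S e l → .{{_ : ℕ.NonZero n}} →
    l ≡ suc ⌊log₂ n ⌋ → Expander ε s G →
    fromℚ (+ 1 / 512) ≤ʳ ε → fromℕʳ 2 *ʳ log₂ n ^ʳ e ≤ʳ s →
    suc S ℕ.≤ 2 ℕ.* ⌊log₂ n ⌋ ℕ.^ e →
    ExpandsBy (l ℕ.* l ℕ.* 1024) S G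
  expander⇒ExpandsBy {n} G ε s S e l l≡ exp ε≥ s≥ S< U F F⊆G 1≤U U≤ F≤ =
    absorb-slack u m l 1≤U scaled
    where
    open ℚ.≤-Reasoning
    m = ∣ Nbr (G ∖ F) U ∣
    h = + 1 / 2048
    0<h : 0ℚ ℚ.< h
    0<h = ℚ.positive⁻¹ h
    u = ∣ U ∣
    f = ∣ F ∣ᴱ
    N₁ = proj₁ (s≥ (ι 1) (ℚ.positive⁻¹ (ι 1)))
    S≤s : ∀ k → N₁ ℕ.≤ k → ι S ℚ.≤ seq s k
    S≤s k N≤k = subst₂ ℚ._≤_ (cancel (ι S) (ι 1)) (cancel (seq s k) (ι 1)) (ℚ.+-monoˡ-≤ (ℚ.- (ι 1)) (begin
      ι S ℚ.+ ι 1                              ≡⟨ ι-+ S 1 ⟨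
      ι (S ℕ.+ 1)
        ≤⟨ ι-mono-≤ (S ℕ.+ 1) (2 ℕ.* ⌊log₂ n ⌋ ℕ.^ e) (ℕ.≤-trans (ℕ.≤-reflexive (ℕ.+-comm S 1)) S<) ⟩
      ι (2 ℕ.* ⌊log₂ n ⌋ ℕ.^ e)              ≡⟨ ι-* 2 (⌊log₂ n ⌋ ℕ.^ e) ⟩
      ι 2 ℚ.* ι (⌊log₂ n ⌋ ℕ.^ e)
        ≤⟨ ℚ.*-monoˡ-≤-nonNeg (ι 2) (^ʳ-lower {log₂ n} {⌊log₂ n ⌋} k e (log-lower n k)) ⟩
      ι 2 ℚ.* seq (log₂ n ^ʳ e) k            ≤⟨ proj₂ (s≥ (ι 1) (ℚ.positive⁻¹ (ι 1))) k N≤k ⟩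
      seq s k ℚ.+ ι 1                          ∎))
      where
      cancel : ∀ a b → a ℚ.+ b ℚ.- b ≡ a
      cancel = solve 2 (λ a b → a :+ b :- b := a) refl
        where open +-*-Solver
    F≤s*U : fromℕʳ f ≤ʳ s *ʳ fromℕʳ u
    F≤s*U η 0<η = N₁ , λ k N≤k → ≤+pos 0<η (begin
      ι f                    ≤⟨ ι-mono-≤ f (u ℕ.* S) F≤ ⟩
      ι (u ℕ.* S)            ≡⟨ trans (cong ι (ℕ.*-comm u S)) (ι-* S u) ⟩
      ι S ℚ.* ι u            ≤⟨ ℚ.*-monoʳ-≤-nonNeg (ι u) {{ℚ.nonNegative (0≤ι u)}} (S≤s k N≤k) ⟩
      seq s k ℚ.* ι u        ∎)
    N₂ = proj₁ (exp U F F⊆G 1≤U U≤ F≤s*U h 0<h)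
    N₃ = proj₁ (ε≥ h 0<h)
    k = N₂ ℕ.⊔ N₃
    scaled : + 1 / 512 ℚ.* ι u ℚ.≤ ι m ℚ.* ι (l ℕ.^ 2) ℚ.+ h ℚ.+ h ℚ.* ι u
    scaled = begin
      + 1 / 512 ℚ.* ι u
        ≤⟨ ℚ.*-monoʳ-≤-nonNeg (ι u) {{ℚ.nonNegative (0≤ι u)}} (proj₂ (ε≥ h 0<h) k (ℕ.m≤n⊔m N₂ N₃)) ⟩
      (seq ε k ℚ.+ h) ℚ.* ι u
        ≡⟨ ℚ.*-distribʳ-+ (ι u) (seq ε k) h ⟩
      seq ε k ℚ.* ι u ℚ.+ h ℚ.* ι u
        ≤⟨ ℚ.+-monoˡ-≤ (h ℚ.* ι u) (proj₂ (exp U F F⊆G 1≤U U≤ F≤s*U h 0<h) k (ℕ.m≤m⊔n N₂ N₃)) ⟩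
      ι m ℚ.* seq (log₂ n ^ʳ 2) k ℚ.+ h ℚ.+ h ℚ.* ι u
        ≤⟨ ℚ.+-monoˡ-≤ (h ℚ.* ι u) (ℚ.+-monoˡ-≤ h (ℚ.*-monoˡ-≤-nonNeg (ι m) {{ℚ.nonNegative (0≤ι m)}}
             (^ʳ-upper {log₂ n} {l} k 2 (0≤log n k)
               (subst (λ l → log-seq n k ℚ.≤ ι l) (sym l≡) (log-upper n k))))) ⟩
      ι m ℚ.* ι (l ℕ.^ 2) ℚ.+ h ℚ.+ h ℚ.* ι u ∎

  -- The real inequality is read with slack 1, which u ≥ 1 absorbs at the cost of the factor 2.
  few-edges : ∀ {n} .{{_ : ℕ.NonZero n}} f u e → 1 ℕ.≤ u → fromℕʳ f *ʳ log₂ n ^ʳ e ≤ʳ fromℕʳ u →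
    f ℕ.* ⌊log₂ n ⌋ ℕ.^ e ℕ.≤ 2 ℕ.* u
  few-edges {n} f u e 1≤u le = ℕ.≤-trans (ι-cancel-≤ (f ℕ.* ⌊log₂ n ⌋ ℕ.^ e) (u ℕ.+ 1) (begin
      ι (f ℕ.* ⌊log₂ n ⌋ ℕ.^ e)               ≡⟨ ι-* f _ ⟩
      ι f ℚ.* ι (⌊log₂ n ⌋ ℕ.^ e)             ≤⟨ ℚ.*-monoˡ-≤-nonNeg (ι f) {{ℚ.nonNegative (0≤ι f)}}
                                                    (^ʳ-lower {log₂ n} {⌊log₂ n ⌋} N e (log-lower n N)) ⟩
      ι f ℚ.* seq (log₂ n ^ʳ e) N             ≤⟨ proj₂ eventually N ℕ.≤-refl ⟩
      ι u ℚ.+ ι 1                               ≡⟨ ι-+ u 1 ⟨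
      ι (u ℕ.+ 1)                              ∎))
    (ℕ.+-monoʳ-≤ u (ℕ.≤-trans 1≤u (ℕ.m≤m+n u 0)))
    where
    open ℚ.≤-Reasoning
    eventually = le (ι 1) (ℚ.positive⁻¹ (ι 1))
    N = proj₁ eventually

  ℙ-wsum : ∀ {n} (E : Subset n → Bool) → ℙ (+ 1 / 3) E ℚ.* ι (3 ℕ.^ n) ≡ ι (wsum 1 2 (bit ∘ E))
  ℙ-wsum {zero} E with E []
  ... | true  = refl
  ... | false = refl
  ℙ-wsum {suc n} E = begin
    (p ℚ.* x ℚ.+ (1ℚ ℚ.- p) ℚ.* y) ℚ.* ι (3 ℕ.* 3 ℕ.^ n)
      ≡⟨ cong ((p ℚ.* x ℚ.+ (1ℚ ℚ.- p) ℚ.* y) ℚ.*_) (ι-* 3 (3 ℕ.^ n)) ⟩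
    (p ℚ.* x ℚ.+ (1ℚ ℚ.- p) ℚ.* y) ℚ.* (ι 3 ℚ.* t)
      ≡⟨ solve 6 (λ p r x y c t → (p :* x :+ r :* y) :* (c :* t) :=
                  (p :* c) :* (x :* t) :+ (r :* c) :* (y :* t)) refl p (1ℚ ℚ.- p) x y (ι 3) t ⟩
    ι 1 ℚ.* (x ℚ.* t) ℚ.+ ι 2 ℚ.* (y ℚ.* t)
      ≡⟨ cong₂ (λ a b → ι 1 ℚ.* a ℚ.+ ι 2 ℚ.* b) (ℙ-wsum (E ∘ (inside ∷_))) (ℙ-wsum (E ∘ (outside ∷_))) ⟩
    ι 1 ℚ.* ι w₁ ℚ.+ ι 2 ℚ.* ι w₀
      ≡⟨ cong₂ ℚ._+_ (ι-* 1 w₁) (ι-* 2 w₀) ⟨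
    ι (1 ℕ.* w₁) ℚ.+ ι (2 ℕ.* w₀)
      ≡⟨ ι-+ (1 ℕ.* w₁) (2 ℕ.* w₀) ⟨
    ι (1 ℕ.* w₁ ℕ.+ 2 ℕ.* w₀) ∎
    where
    open ≡-Reasoning
    open +-*-Solver
    p = + 1 / 3
    t = ι (3 ℕ.^ n)
    x = ℙ p (E ∘ (inside ∷_))
    y = ℙ p (E ∘ (outside ∷_))
    w₁ = wsum 1 2 (bit ∘ E ∘ (inside ∷_))
    w₀ = wsum 1 2 (bit ∘ E ∘ (outside ∷_))

  ℙ-lower : ∀ {n} (E : Subset n → Bool) bad d →
    3 ℕ.^ n ℕ.≤ wsum 1 2 (bit ∘ E) ℕ.+ bad → bad ℕ.* suc d ℕ.≤ 3 ℕ.^ n →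
    1ℚ ℚ.- + 1 / suc d ℚ.≤ ℙ (+ 1 / 3) E
  ℙ-lower {n} E bad d cover rare = ℚ.*-cancelʳ-≤-pos (ι (N ℕ.* suc d)) {{pos}} (begin
    (1ℚ ℚ.- δ) ℚ.* ι (N ℕ.* suc d)
      ≡⟨ cong ((1ℚ ℚ.- δ) ℚ.*_) (ι-* N (suc d)) ⟩
    (1ℚ ℚ.- δ) ℚ.* (ι N ℚ.* ι (suc d))
      ≡⟨ solve 3 (λ δ t c → (con 1ℚ :- δ) :* (t :* c) := t :* c :- t :* (c :* δ)) refl δ (ι N) (ι (suc d)) ⟩
    ι N ℚ.* ι (suc d) ℚ.- ι N ℚ.* (ι (suc d) ℚ.* δ)
      ≡⟨ cong₂ (λ a b → a ℚ.- ι N ℚ.* b) (sym (ι-* N (suc d))) D*δ≡1 ⟩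
    ι (N ℕ.* suc d) ℚ.- ι N ℚ.* 1ℚ
      ≤⟨ ℚ.+-monoˡ-≤ (ℚ.- (ι N ℚ.* 1ℚ)) (ι-mono-≤ (N ℕ.* suc d) (w ℕ.* suc d ℕ.+ N) total) ⟩
    ι (w ℕ.* suc d ℕ.+ N) ℚ.- ι N ℚ.* 1ℚ
      ≡⟨ cong (ℚ._- ι N ℚ.* 1ℚ) (ι-+ (w ℕ.* suc d) N) ⟩
    ι (w ℕ.* suc d) ℚ.+ ι N ℚ.- ι N ℚ.* 1ℚ
      ≡⟨ solve 2 (λ a t → a :+ t :- t :* con 1ℚ := a) refl (ι (w ℕ.* suc d)) (ι N) ⟩
    ι (w ℕ.* suc d)
      ≡⟨ ι-* w (suc d) ⟩
    ι w ℚ.* ι (suc d)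
      ≡⟨ cong (ℚ._* ι (suc d)) (ℙ-wsum E) ⟨
    ℙ (+ 1 / 3) E ℚ.* ι N ℚ.* ι (suc d)
      ≡⟨ trans (ℚ.*-assoc (ℙ (+ 1 / 3) E) (ι N) (ι (suc d))) (cong (ℙ (+ 1 / 3) E ℚ.*_) (sym (ι-* N (suc d)))) ⟩
    ℙ (+ 1 / 3) E ℚ.* ι (N ℕ.* suc d) ∎)
    where
    open ℚ.≤-Reasoning
    open +-*-Solver
    N = 3 ℕ.^ n
    w = wsum 1 2 (bit ∘ E)
    δ = + 1 / suc d
    D*δ≡1 : ι (suc d) ℚ.* δ ≡ 1ℚ
    D*δ≡1 = trans (sym (frac-* (suc d) 1 d)) (ℚ.≤-antisym
      (frac-mono-≤ (suc d ℕ.* 1) 1 d 0 (ℕ.≤-reflexive (trans (ℕ.*-identityʳ _) (ℕ.*-comm (suc d) 1))))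
      (frac-mono-≤ 1 (suc d ℕ.* 1) 0 d (ℕ.≤-reflexive (trans (ℕ.*-comm 1 (suc d)) (sym (ℕ.*-identityʳ _))))))
    total : N ℕ.* suc d ℕ.≤ w ℕ.* suc d ℕ.+ N
    total = ℕ.≤-trans (ℕ.*-monoˡ-≤ (suc d) cover)
      (ℕ.≤-trans (ℕ.≤-reflexive (ℕ.*-distribʳ-+ (suc d) w bad)) (ℕ.+-monoʳ-≤ (w ℕ.* suc d) rare))
    pos : ℚ.Positive (ι (N ℕ.* suc d))
    pos = ℚ.positive (ℚ.<-≤-trans (ℚ.positive⁻¹ 1ℚ)
      (ι-mono-≤ 1 (N ℕ.* suc d) (ℕ.*-mono-≤ (ℕ.m^n>0 3 n) (ℕ.s≤s (ℕ.z≤n {d})))))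

  short-enough : ∀ {n} .{{_ : ℕ.NonZero n}} ℓ e → ℓ ℕ.≤ ⌊log₂ n ⌋ ℕ.^ e → fromℕʳ ℓ ≤ʳ log₂ n ^ʳ e
  short-enough {n} ℓ e ℓ≤ = pointwise {fromℕʳ ℓ} {log₂ n ^ʳ e} λ k →
    ℚ.≤-trans (ι-mono-≤ ℓ (⌊log₂ n ⌋ ℕ.^ e) ℓ≤) (^ʳ-lower {log₂ n} {⌊log₂ n ⌋} k e (log-lower n k))

-- The function δ and the statement for random V.

module Conclusion where

  open import Defs using (ℝ; fromℚ; fromℕʳ; log₂; ℙ; Expander; Graph; _∖_; ∣_∣ᴱ; _⊆ᴱ_;
      Ball; _<#_; ProbAtLeast; _⟶_; 2^⌊log₂n⌋≤n; n<2^[1+⌊log₂n⌋])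
    renaming (_≤_ to _≤ʳ_; _*_ to _*ʳ_; _^_ to _^ʳ_; _-_ to _-ʳ_)
  open Rationals
  open Reals
  open Constants
  open Edges using (T-does⁻)
  open Paths using (reverse)
  open Growth using (Fail; majority; first-stage; Majority)
  open UnionBound

  Expands-in : ∀ {n} → Graph n → Subset n → Set
  Expands-in {n} G V = ∀ (U : Subset n) → Nonempty U → ∀ (F : Graph n) → F ⊆ᴱ G →
    fromℕʳ ∣ F ∣ᴱ *ʳ log₂ n ^ʳ 27 ≤ʳ fromℕʳ ∣ U ∣ →
    (+ ∣ V ∣ / 2) <# Ball (G ∖ F) (log₂ n ^ʳ 4) U V

  module _ {n : ℕ} .{{_ : ℕ.NonZero n}} (2≤n : 2 ℕ.≤ n) (G : Graph n) (l : ℕ)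
    (l≡ : l ≡ suc ⌊log₂ n ⌋) (c : Constants ⌊log₂ n ⌋ l) where

    open Constants.Constants c

    n<2^l : n ℕ.< 2 ℕ.^ l
    n<2^l = subst (λ l → n ℕ.< 2 ℕ.^ l) (sym l≡) (n<2^[1+⌊log₂n⌋] n)

    1≤M : 1 ℕ.≤ M
    1≤M = subst (1 ℕ.≤_) (sym M≡) (ℕ.*-mono-≤ (ℕ.s≤s (ℕ.z≤n {3})) (ℕ.≤-trans (ℕ.s≤s ℕ.z≤n) 10≤q))

    good⇒Expands-in : Expansion.ExpandsBy q K G → ∀ V → (∀ P D Q → ¬ Fail G K M P D Q V) → Expands-in G V
    good⇒Expands-in exp V good U U≢∅ F F⊆G F≤ = reach⇒ball
      (majority G F V U K M 1≤M 2M≤K good l n<2^l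
        (proj₂ (first-stage G F V U K M 1≤M 2M≤K good {q} {K} 2≤n M≡ exp ℕ.≤-refl U≢∅ small)))
      where
      small : 3 ℕ.* M ℕ.* (K ℕ.* (2 ℕ.* ∣ F ∣ᴱ) ℕ.+ 2 ℕ.* ∣ F ∣ᴱ) ℕ.≤ ∣ U ∣
      small = sparse ∣ F ∣ᴱ ∣ U ∣ (few-edges ∣ F ∣ᴱ ∣ U ∣ 27 (Sets.1≤∣p∣ (proj₂ U≢∅)) F≤)
      reach⇒ball : Majority G F V U K M 1≤M 2M≤K good (l ℕ.* (2 ℕ.* M) ℕ.+ 1) →
        (+ ∣ V ∣ / 2) <# Ball (G ∖ F) (log₂ n ^ʳ 4) U V
      reach⇒ball (W , reached , big) = W , inBall , half<⇒frac< {∣ V ∣} {∣ W ∣} big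
        where
        inBall : ∀ v → v ∈ W → Ball (G ∖ F) (log₂ n ^ʳ 4) U V v
        inBall v v∈W with reached v∈W
        ... | v∈V , u , u∈U , ℓ , ℓ≤ , P =
          v∈V , u , u∈U , ℓ , short-enough ℓ 4 (ℕ.≤-trans ℓ≤ short) , reverse P

    likely : Expansion.ExpandsBy q K G →
      ProbAtLeast (+ 1 / 3) (fromℕʳ 1 -ʳ fromℚ (+ 1 / suc (n ℕ.+ n ℕ.* suc n))) (Expands-in G)
    likely exp = E , (λ V t → good⇒Expands-in exp V
        (avoids-failure G K M V (T-does⁻ (count G K M V ℕ.≟ 0) t))) ,
      pointwise {fromℕʳ 1 -ʳ fromℚ (+ 1 / suc d)} {fromℚ (ℙ (+ 1 / 3) E)} λ _ →
        ℙ-lower E (bad G K M) d (good+bad G K M)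
          (bad-rare G K M {q} {K} {l} M≡ K≡ exp ℕ.≤-refl 10≤q (subst (1 ℕ.≤_) (sym l≡) (ℕ.s≤s ℕ.z≤n)) n<2^l)
      where
      -- Chosen so that `suc d` computes to `suc n * suc n`, the factor in `bad-rare`.
      d = n ℕ.+ n ℕ.* suc n
      E : Subset n → Bool
      E V = does (count G K M V ℕ.≟ 0)

  -- δ(n) is 1 / (n + 1)² when ⌊log₂ n⌋ reaches the threshold and 1 otherwise.
  denominator-1 : ∀ n → Dec (threshold ℕ.≤ ⌊log₂ n ⌋) → ℕ
  denominator-1 n (yes _) = n ℕ.+ n ℕ.* suc n
  denominator-1 n (no _)  = 0

  δℚ : ∀ n → Dec (threshold ℕ.≤ ⌊log₂ n ⌋) → ℚ
  δℚ n large? = + 1 / suc (denominator-1 n large?)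

  δ : ℕ → ℝ
  δ n = fromℚ (δℚ n (threshold ℕ.≤? ⌊log₂ n ⌋))

  0≤δ≤1 : ∀ n → fromℕʳ 0 ≤ʳ δ n × δ n ≤ʳ fromℕʳ 1
  0≤δ≤1 n =
    pointwise {fromℕʳ 0} {δ n} (λ _ → 0≤frac 1 (denominator-1 n large?)) ,
    pointwise {δ n} {fromℕʳ 1} (λ _ → frac-mono-≤ 1 1 (denominator-1 n large?) 0
      (ℕ.*-monoʳ-≤ 1 (ℕ.s≤s (ℕ.z≤n {denominator-1 n large?}))))
    where large? = threshold ℕ.≤? ⌊log₂ n ⌋

  n*δℚ≤ : ∀ n d large? → threshold ℕ.≤ ⌊log₂ n ⌋ → d ℕ.≤ n → ι n ℚ.* δℚ n large? ℚ.≤ + 1 / suc d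
  n*δℚ≤ n d (no ¬large) large d≤n = contradiction large ¬large
  n*δℚ≤ n d (yes _)     _     d≤n = ℚ.≤-trans (ℚ.≤-reflexive (sym (frac-* n 1 x)))
    (frac-mono-≤ (n ℕ.* 1) 1 x d (begin
      n ℕ.* 1 ℕ.* suc d          ≡⟨ cong (ℕ._* suc d) (ℕ.*-identityʳ n) ⟩
      n ℕ.* suc d                ≤⟨ ℕ.*-mono-≤ (ℕ.n≤1+n n) (ℕ.s≤s d≤n) ⟩
      suc n ℕ.* suc n            ≡⟨ ℕ.*-identityˡ (suc n ℕ.* suc n) ⟨
      1 ℕ.* suc x                ∎))
    where
    open ℕ.≤-Reasoning
    x = n ℕ.+ n ℕ.* suc n

  n*δ⟶0 : (λ n → fromℕʳ n *ʳ δ n) ⟶ fromℕʳ 0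
  n*δ⟶0 η 0<η = N₁ ℕ.⊔ d , λ n N≤n →
      (λ θ 0<θ → 0 , λ _ _ → ≤+pos 0<θ (lower n)) ,
      (λ θ 0<θ → 0 , λ _ _ → ≤+pos 0<θ (upper n N≤n))
    where
    d = proj₁ (archimedean η 0<η)
    N₁ = proj₁ (log-unbounded threshold)
    large? : ∀ n → Dec (threshold ℕ.≤ ⌊log₂ n ⌋)
    large? n = threshold ℕ.≤? ⌊log₂ n ⌋
    lower : ∀ n → ι 0 ℚ.- η ℚ.≤ ι n ℚ.* δℚ n (large? n)
    lower n = ℚ.≤-trans (subst (ι 0 ℚ.- η ℚ.≤_) (ℚ.+-identityʳ (ι 0))
        (ℚ.+-monoʳ-≤ (ι 0) (ℚ.neg-antimono-≤ (ℚ.<⇒≤ 0<η))))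
      (0≤* (0≤ι n) (0≤frac 1 (denominator-1 n (large? n))))
    upper : ∀ n → N₁ ℕ.⊔ d ℕ.≤ n → ι n ℚ.* δℚ n (large? n) ℚ.≤ ι 0 ℚ.+ η
    upper n N≤n = ℚ.≤-trans
      (n*δℚ≤ n d (large? n) (proj₂ (log-unbounded threshold) n (ℕ.m⊔n≤o⇒m≤o N₁ d N≤n))
        (ℕ.m⊔n≤o⇒n≤o N₁ d N≤n))
      (ℚ.≤-trans (proj₂ (archimedean η 0<η)) (ℚ.≤-reflexive (sym (ℚ.+-identityˡ η))))

  probability : ∀ n large? (G : Graph n) (ε s : ℝ) → Expander ε s G →
    fromℚ (+ 1 / 512) ≤ʳ ε → fromℕʳ 2 *ʳ log₂ n ^ʳ 24 ≤ʳ s →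
    ProbAtLeast (+ 1 / 3) (fromℕʳ 1 -ʳ fromℚ (δℚ n large?)) (Expands-in G)
  -- Here δ(n) = 1, so probability at least 0 is asked for and the empty event suffices.
  probability n (no small) G ε s exp ε≥ s≥ = E , (λ _ ()) ,
    pointwise {fromℕʳ 1 -ʳ fromℚ (δℚ n (no small))} {fromℚ (ℙ (+ 1 / 3) E)} λ _ →
      ℙ-lower E (3 ℕ.^ n) 0 (ℕ.m≤n+m (3 ℕ.^ n) _) (ℕ.≤-reflexive (ℕ.*-identityʳ (3 ℕ.^ n)))
    where
    E : Subset n → Bool
    E _ = Bool.false
  probability zero (yes large) G ε s exp ε≥ s≥ = contradiction large λ ()
  probability n@(suc _) (yes large) G ε s exp ε≥ s≥ = likely 2≤n G l refl c
    (subst (λ q → Expansion.ExpandsBy q K G) (sym q≡)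
      (expander⇒ExpandsBy G ε s K 24 l refl exp ε≥ s≥ K<))
    where
    l = suc ⌊log₂ n ⌋
    c = constants ⌊log₂ n ⌋ l refl large
    open Constants.Constants c
    2≤n : 2 ℕ.≤ n
    2≤n = ℕ.≤-trans (ℕ.^-monoʳ-≤ 2 (ℕ.≤-trans (ℕ.≤ᵇ⇒≤ 1 threshold _) large)) (2^⌊log₂n⌋≤n n)

open import Defs
open Conclusion using (δ; 0≤δ≤1; n*δ⟶0; probability)
open Constants using (threshold)

lemma19 :
    Σ[ δ ∈ (ℕ → ℝ) ]
      (∀ n → fromℕʳ 0 ≤ δ n × δ n ≤ fromℕʳ 1) ×
      ((λ n → fromℕʳ n * δ n) ⟶ fromℕʳ 0) ×
      (∀ (n : ℕ) (G : Graph n) (ε s : ℝ) →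
        Expander ε s G →
        fromℚ (+ 1 / 512) ≤ ε → ε ≤ fromℕʳ 1 →
        fromℕʳ 2 * log₂ n ^ 24 ≤ s →
        ProbAtLeast (+ 1 / 3) (fromℕʳ 1 - δ n) λ V →
          ∀ (U : Subset n) → Nonempty U →
          ∀ (F : Graph n) → F ⊆ᴱ G →
          fromℕʳ ∣ F ∣ᴱ * log₂ n ^ 27 ≤ fromℕʳ ∣ U ∣ →
          (+ ∣ V ∣ / 2) <# Ball (G ∖ F) (log₂ n ^ 4) U V)
lemma19 = δ , 0≤δ≤1 , n*δ⟶0 , λ n G ε s exp ε≥ _ s≥ →
  probability n (threshold ℕ.≤? ⌊log₂ n ⌋) G ε s exp ε≥ s≥
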